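{- Let $n\ge 1$, $r\ge 2$ and $s\ge 0$ be integers, let $\mathcal{P}=\{P_1,\dots,P_l\}$ be a partition of $[n]$ with $|P_i|\le r$ for all $i$, and let $\mathcal{F}$ be a family of non-empty subsets of $[n]$ such that $s<|F|$ for every $F\in\mathcal{F}$. Then $$\chi(\widetilde{\mathrm{KG}}^r(\mathcal{F},\mathcal{P},s))\ge \left\lceil\frac{\mathrm{ecd}^r(\mathcal{F},\lfloor s/2\rfloor)}{r-1}\right\rceil.$$
   Context: $\widetilde{\mathrm{KG}}^r(\mathcal{F},\mathcal{P},s)$ is the $r$-uniform hypergraph whose vertex set consists of all $A\in\mathcal{F}$ with $\sum_{i=1}^l\max\{|A\cap P_i|-1,0\}\le\lfloor s/2\rfloor$, and whose edges are all $r$-subsets $\{A_1,\dots,A_r\}$ of the vertex set with $|A_i\cap A_j|\le s$ for all $1\le i<j\le r$. $\chi$ denotes the chromatic number (minimum number of colors in a vertex coloring with no monochromatic edge). For $s'\ge0$ and $A,B\subseteq[n]$, write $A\subseteq_{s'}B$ if there is a set $E$ with $|E|\le s'$ and $A\setminus E\subseteq B$. An equitable partition of a set $X$ into $r$ parts is a partition $X=X_1\cup\dots\cup X_r$ (parts possibly empty) with $||X_i|-|X_j||\le1$ for all $i,j$. $\mathrm{ecd}^r(\mathcal{F},s')$ is the minimum size of a set $X_0\subseteq[n]$ such that there is an equitable partition $[n]\setminus X_0=X_1\cup\dots\cup X_r$ with no $F\in\mathcal{F}$ and $i\in\{1,\dots,r\}$ satisfying $F\subseteq_{s'}X_i$.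 -}

module Defs where

open import Data.Nat using (ℕ; zero; suc; _+_; _*_; _∸_; _≤_; _<_; _/_; ⌊_/2⌋)
open import Data.Fin using (Fin)
open import Data.Fin.Subset using (Subset; _∈_; _∉_; _⊆_; _∩_; _─_; ∣_∣; Nonempty; ⊤)
open import Data.Vec using (sum; tabulate)
open import Data.Bool using (Bool; true)
open import Data.Product using (Σ; ∃; ∃-syntax; _×_)
open import Relation.Nullary using (¬_)
open import Relation.Binary.PropositionalEquality using (_≡_; _≢_)

-- ⌈ m / d ⌉ for d ≥ 1 (junk value 0 for d = 0, never used below).
⌈_/_⌉ : ℕ → ℕ → ℕ
⌈ m / zero  ⌉ = 0
⌈ m / suc d ⌉ = (m + d) / suc d

record IsPartition {n l : ℕ} (P : Fin l → Subset n) : Set where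
  field
    nonempty : ∀ i → Nonempty (P i)
    disjoint : ∀ i j → i ≢ j → ∀ x → x ∈ P i → x ∉ P j
    covering : ∀ x → ∃[ i ] (x ∈ P i)

Family : ℕ → Set
Family n = Subset n → Bool

IsVertex : {n l : ℕ} → Family n → (Fin l → Subset n) → ℕ → Subset n → Set
IsVertex {n} {l} 𝓕 P s A =
  (𝓕 A ≡ true) × (sum (tabulate (λ i → ∣ A ∩ P i ∣ ∸ 1)) ≤ ⌊ s /2⌋)

-- Edges: r-subsets {A_1,...,A_r} of the vertex set (given as an injective
-- r-tuple) with |A_i ∩ A_j| ≤ s for i ≠ j.
IsEdge : {n l : ℕ} → Family n → (Fin l → Subset n) → ℕ → (r : ℕ) →
         (Fin r → Subset n) → Set
IsEdge 𝓕 P s r e =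
  (∀ i → IsVertex 𝓕 P s (e i)) ×
  (∀ i j → i ≢ j → e i ≢ e j) ×
  (∀ i j → i ≢ j → ∣ e i ∩ e j ∣ ≤ s)

Colouring : {n l : ℕ} → Family n → (Fin l → Subset n) → ℕ → ℕ → Set
Colouring {n} 𝓕 P s k = (A : Subset n) → IsVertex 𝓕 P s A → Fin k

IsProper : {n l : ℕ} (𝓕 : Family n) (P : Fin l → Subset n) (s r k : ℕ) →
           Colouring 𝓕 P s k → Set
IsProper {n} 𝓕 P s r k c =
  (e : Fin r → Subset n) → (E : IsEdge 𝓕 P s r e) →
  ¬ (∀ i j → c (e i) (Σ.proj₁ E i) ≡ c (e j) (Σ.proj₁ E j))

IsChromaticNumber : {n l : ℕ} (𝓕 : Family n) (P : Fin l → Subset n) (s r χ : ℕ) → Set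
IsChromaticNumber 𝓕 P s r χ =
  (Σ (Colouring 𝓕 P s χ) (IsProper 𝓕 P s r χ)) ×
  (∀ k → Σ (Colouring 𝓕 P s k) (IsProper 𝓕 P s r k) → χ ≤ k)

_⊆[_]_ : {n : ℕ} → Subset n → ℕ → Subset n → Set
_⊆[_]_ {n} A s' B = Σ (Subset n) (λ E → (∣ E ∣ ≤ s') × ((A ─ E) ⊆ B))

record IsEquitablePartition {n r : ℕ} (X₀ : Subset n) (X : Fin r → Subset n) : Set where
  field
    disjoint  : ∀ i j → i ≢ j → ∀ x → x ∈ X i → x ∉ X j
    avoidX₀   : ∀ i x → x ∈ X i → x ∉ X₀
    covering  : ∀ x → x ∉ X₀ → ∃[ i ] (x ∈ X i)
    equitable : ∀ i j → ∣ X i ∣ ≤ suc ∣ X j ∣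

EcdAdmissible : {n : ℕ} (r : ℕ) → Family n → ℕ → Subset n → Set
EcdAdmissible {n} r 𝓕 s' X₀ =
  Σ (Fin r → Subset n) (λ X → IsEquitablePartition X₀ X ×
     (∀ F → 𝓕 F ≡ true → ∀ i → ¬ (F ⊆[ s' ] X i)))

IsEcd : {n : ℕ} (r : ℕ) → Family n → ℕ → ℕ → Set
IsEcd {n} r 𝓕 s' m =
  (Σ (Subset n) (λ X₀ → (∣ X₀ ∣ ≡ m) × EcdAdmissible r 𝓕 s' X₀)) ×
  (∀ X₀ → EcdAdmissible r 𝓕 s' X₀ → m ≤ ∣ X₀ ∣)

{-# OPTIONS --safe #-}

-- Suppose first that r = p is prime and that there are neither a monochromatic edge nor an equitable
-- partition into free parts that covers all but (p - 1) χ points. Read X ∈ (ℤ/p ∪ {0})ⁿ \ {0} as p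
-- disjoint sets X_1, …, X_p. If a vertex lies in some X_i up to ⌊s/2⌋ points, count the pairs (i, colour)
-- that occur: without a monochromatic edge there are at most (p - 1) χ of them. Otherwise a subset of X_i
-- with one point from each block is free, so the numbers of blocks that X_1, …, X_p meet, cut down to an
-- equitable family, have a sum that is too small for a good partition. This yields a level < n that is
-- monotone in X. Some family of p weights that is constant along chains of constant level has a total
-- prime to p; its centre of mass is a sign in ℤ/p that is equivariant in X. The ℤ/p-Tucker lemma excludes
-- such a pair: pulling back the cocycles of ℤ/p along the sign and evaluating them on the iterated cones
-- over the orbits of the previous cone gives 1 mod p in every dimension, but a chain of n vectors repeats
-- a level, hence a sign, so that the value in dimension n - 1 is 0.
--
-- For r = r′ r″, apply the case r′ with s = 0 to the sets that have no good partition into r″ parts, coloured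
-- by the colour of an r″-edge inside, after splitting each block into r″ pieces with at most r′ points.
module Submission where

open import Defs
open import Data.Nat using (ℕ; _≤_; _<_; _∸_; ⌊_/2⌋)
open import Data.Fin using (Fin)
open import Data.Fin.Subset using (Subset; ∣_∣; Nonempty)
open import Data.Bool using (true)
open import Relation.Binary.PropositionalEquality using (_≡_)

open import Axiom.UniquenessOfIdentityProofs using (module Decidable⇒UIP)
open import Data.Bool.Base using (Bool; false; if_then_else_; not)
import Data.Bool.Properties as Bool
open import Data.Empty using (⊥; ⊥-elim)
open import Data.Fin.Base using (zero; suc; toℕ; fromℕ; inject₁; fromℕ<; combine; remQuot; _↑ˡ_; _↑ʳ_)
import Data.Fin.Properties as Fin
open import Data.Fin.Relation.Unary.Top using (view; view-fromℕ; view-inject₁; ‵fromℕ; ‵inject₁)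
open import Data.Maybe.Base as Maybe using (Maybe; just; nothing)
import Data.Maybe.Properties as Maybe
open import Data.Nat.Base as ℕ using (zero; suc; z≤n; s≤s; _<ᵇ_; _≡ᵇ_)
open import Data.Nat.DivMod using (_%_; _mod_)
import Data.Nat.DivMod as ℕ
import Data.Nat.Properties as ℕ
open import Data.Product using (_×_; _,_; proj₁; proj₂; ∃-syntax; Σ-syntax; uncurry)
open import Data.Sum.Base as Sum using (_⊎_; inj₁; inj₂)
open import Data.Unit.Base using (tt)
open import Data.Vec.Base as Vec using (Vec; []; _∷_; map; lookup; replicate; tabulate; here; there)
import Data.Vec.Properties as Vec
open import Function.Base using (_∘_)
open import Relation.Binary.PropositionalEquality
open import Relation.Nullary using (¬_; Dec; yes; no; does)
open import Relation.Nullary.Decidable using (dec-true; dec-false; map′; _×-dec_; _→-dec_; ¬?)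

-- The sign must stay fixed along chains of constant level and must rotate with the vector, so ties
-- between the parts cannot be broken by a choice. A centre of mass respects both, but it divides by
-- the total weight mod p; this forces p to be prime and forces several weights to be tried in turn.
-- If the rank is divisible by p, all parts meet equally many blocks, and constant level fixes which
-- ones. A block met by some parts but not by all gives a total between 1 and p - 1. A block met by
-- all p parts has no unassigned point left, because it has at most p points; membership of its
-- points is then frozen and gives total 1. The half of s comes from intersections: two sets that
-- lie in disjoint sets up to ⌊s/2⌋ points share at most s points. The level stays below n by one
-- point exactly: without a good partition and without hits the rank is at most |N| - (p - 1) χ - 1,
-- and at most (p - 1) χ hits are stacked on top of that value.

module Topology where

  open import Data.Integer.Base using (ℤ; 0ℤ; 1ℤ; _+_; _-_; _*_)
  import Data.Integer.Base as ℤ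
  import Data.Integer.Properties as ℤ
  open import Data.Integer.Tactic.RingSolver using (solve-∀)
  open import Data.Unit.Base using (⊤)
  open import Data.Vec.Relation.Unary.All using (All; []; _∷_)
  import Data.Vec.Relation.Unary.All as All
  import Data.Vec.Relation.Unary.All.Properties as All
  open import Data.Vec.Relation.Unary.AllPairs using (AllPairs; []; _∷_)
  import Data.Vec.Relation.Unary.AllPairs as AllPairs
  import Data.Vec.Relation.Unary.AllPairs.Properties as AllPairs

  private variable
    A B : Set
    k : ℕ

  minus-minus-minus : ∀ a b c d → a - b - (c - d) ≡ (a - c) - (b - d)
  minus-minus-minus = solve-∀

  +-minus-+ : ∀ a b c d → a + b - (c + d) ≡ (a - c) + (b - d)
  +-minus-+ = solve-∀

  minus-+-minus : ∀ a b c d → a - b + (c - d) ≡ (a + c) - (b + d)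
  minus-+-minus = solve-∀

  -- Cochains on ordered tuples and the prism homotopy

  Cochain : Set → ℕ → Set
  Cochain A k = Vec A k → ℤ

  -- Augmented: a 0-tuple is the empty simplex.
  δ : Cochain A k → Cochain A (suc k)
  δ {k = zero}  F _        = F []
  δ {k = suc _} F (x ∷ xs) = F xs - δ (F ∘ (x ∷_)) xs

  pull : (A → B) → Cochain B k → Cochain A k
  pull f F = F ∘ map f

  δ-pull : (f : A → B) (F : Cochain B k) → ∀ xs → δ (pull f F) xs ≡ pull f (δ F) xs
  δ-pull {k = zero}  f F (_ ∷ [])  = refl
  δ-pull {k = suc _} f F (x ∷ xs) = cong (λ u → F (map f xs) - u) (δ-pull f (F ∘ (f x ∷_)) xs)

  δ-zero : ∀ xs → δ {A} {k} (λ _ → 0ℤ) xs ≡ 0ℤ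
  δ-zero {k = zero}  _        = refl
  δ-zero {k = suc _} (x ∷ xs) = cong (λ u → 0ℤ - u) (δ-zero xs)

  δ-+ : (F G : Cochain A k) → ∀ xs → δ (λ ys → F ys + G ys) xs ≡ δ F xs + δ G xs
  δ-+ {k = zero}  F G _        = refl
  δ-+ {k = suc _} F G (x ∷ xs) =
    trans (cong (λ u → F xs + G xs - u) (δ-+ (F ∘ (x ∷_)) (G ∘ (x ∷_)) xs)) (+-minus-+ (F xs) (G xs) _ _)

  δ-minus : (F G : Cochain A k) → ∀ xs → δ (λ ys → F ys - G ys) xs ≡ δ F xs - δ G xs
  δ-minus {k = zero}  F G _        = refl
  δ-minus {k = suc _} F G (x ∷ xs) =
    trans (cong (λ u → F xs - G xs - u) (δ-minus (F ∘ (x ∷_)) (G ∘ (x ∷_)) xs))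
        (minus-minus-minus (F xs) (G xs) _ _)

  δ-scale : (z : ℤ) (F : Cochain A k) → ∀ xs → δ (λ ys → z * F ys) xs ≡ z * δ F xs
  δ-scale {k = zero}  z F _        = refl
  δ-scale {k = suc _} z F (x ∷ xs) =
    trans (cong (λ u → z * F xs - u) (δ-scale z (F ∘ (x ∷_)) xs)) (sym (distrib z _ _))
    where
    distrib : ∀ a b c → a * (b - c) ≡ a * b - a * c
    distrib = solve-∀

  -- The prism operator: each term switches from `f` to `g` at one entry, which occurs under both
  -- maps, with a sign that alternates with its position.
  prism : (f g : A → B) → Cochain B (suc k) → Cochain A k
  prism f g F []       = 0ℤ
  prism f g F (x ∷ xs) = F (f x ∷ g x ∷ map g xs) - prism f g (F ∘ (f x ∷_)) xs

  module _ (f g : A → B) where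

    prism-minus : (F G : Cochain B (suc k)) → ∀ xs →
                  prism f g (λ ys → F ys - G ys) xs ≡ prism f g F xs - prism f g G xs
    prism-minus F G []       = refl
    prism-minus F G (x ∷ xs) =
      trans (cong (λ u → F (f x ∷ g x ∷ map g xs) - G (f x ∷ g x ∷ map g xs) - u)
                  (prism-minus (F ∘ (f x ∷_)) (G ∘ (f x ∷_)) xs))
            (minus-minus-minus (F (f x ∷ g x ∷ map g xs)) (G (f x ∷ g x ∷ map g xs)) _ _)

    -- Dual of ∂P + P∂ = g - f. Faces that drop one of the two copies at a switch cancel between
    -- neighbouring switches; the pure `g` tuple and the pure `f` tuple remain.
    prism-homotopy : (F : Cochain B (suc k)) → ∀ xs →
                     prism f g (δ F) xs + δ (prism f g F) xs ≡ F (map g xs) - F (map f xs)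
    prism-homotopy {zero} F (x ∷ []) = alg (F (g x ∷ [])) (F (f x ∷ []))
      where
      alg : ∀ a b → a - b - 0ℤ + 0ℤ ≡ a - b
      alg = solve-∀
    prism-homotopy {suc k} F (x ∷ xs) = begin
      (F (g x ∷ map g xs) - (F (f x ∷ map g xs) - δ Fxx (map g xs))
        - prism f g (λ ys → F ys - δ Fx ys) xs)
        + (prism f g F xs - δ (λ ys → Fxx (map g ys) - prism f g Fx ys) xs)
        ≡⟨ cong₂ (λ u v → (F (g x ∷ map g xs) - (F (f x ∷ map g xs) - δ Fxx (map g xs)) - u) +
            (prism f g F xs - v))
                 (prism-minus F (δ Fx) xs)
                 (trans (δ-minus (pull g Fxx) (prism f g Fx) xs)
                     (cong (_- δ (prism f g Fx) xs) (δ-pull g Fxx xs))) ⟩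
      (F (g x ∷ map g xs) - (F (f x ∷ map g xs) - δ Fxx (map g xs)) - (prism f g F xs - prism f g (δ Fx) xs))
        + (prism f g F xs - (δ Fxx (map g xs) - δ (prism f g Fx) xs))
        ≡⟨ alg₁ (F (g x ∷ map g xs)) (F (f x ∷ map g xs)) (δ Fxx (map g xs)) (prism f g F xs) _ _ ⟩
      (F (g x ∷ map g xs) - F (f x ∷ map g xs)) + (prism f g (δ Fx) xs + δ (prism f g Fx) xs)
        ≡⟨ cong (λ u → (F (g x ∷ map g xs) - F (f x ∷ map g xs)) + u) (prism-homotopy Fx xs) ⟩
      (F (g x ∷ map g xs) - F (f x ∷ map g xs)) + (F (f x ∷ map g xs) - F (f x ∷ map f xs))
        ≡⟨ alg₂ (F (g x ∷ map g xs)) (F (f x ∷ map g xs)) (F (f x ∷ map f xs)) ⟩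
      F (g x ∷ map g xs) - F (f x ∷ map f xs) ∎
      where
      open ≡-Reasoning
      Fx = λ ys → F (f x ∷ ys)
      Fxx = λ ys → F (f x ∷ g x ∷ ys)
      alg₁ : ∀ a b c d e h → (a - (b - c) - (d - e)) + (d - (c - h)) ≡ (a - b) + (e + h)
      alg₁ = solve-∀
      alg₂ : ∀ a b c → (a - b) + (b - c) ≡ a - c
      alg₂ = solve-∀

  module _ (_≼A_ : A → A → Set) (_≼B_ : B → B → Set) (f g : A → B)
           (f-mono : ∀ {x y} → x ≼A y → f x ≼B f y)
           (g-mono : ∀ {x y} → x ≼A y → g x ≼B g y)
           (f≼g : ∀ {x y} → x ≼A y → f x ≼B g y)
           (f≼g′ : ∀ x → f x ≼B g x) where

    -- The prism over a chain consists of chains, because `f` stays below `g`. `L` is variable so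
    -- that the recursion can add to it that all later entries lie above the fixed head `f x`.
    prism-agree : (L : B → Set) {F G : Cochain B (suc k)} →
      (∀ ys → AllPairs _≼B_ ys → All L ys → F ys ≡ G ys) →
      ∀ xs → AllPairs _≼A_ xs → All (L ∘ f) xs → All (L ∘ g) xs →
      prism f g F xs ≡ prism f g G xs
    prism-agree L e [] _ _ _ = refl
    prism-agree L e (x ∷ xs) (p ∷ ps) (lf ∷ lfs) (lg ∷ lgs) = cong₂ _-_
      (e _ ((f≼g′ x ∷ All.map⁺ (All.map f≼g p)) ∷ (All.map⁺ (All.map g-mono p)) ∷ AllPairs.map⁺
          (AllPairs.map g-mono ps))
           (lf ∷ lg ∷ All.map⁺ lgs))
      (prism-agree (λ y → L y × f x ≼B y)
        (λ ys c l → e (f x ∷ ys) (All.map proj₂ l ∷ c) (lf ∷ All.map proj₁ l))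
        xs ps (All.zip (lfs , All.map f-mono p)) (All.zip (lgs , All.map f≼g p)))

  -- Norm and shift operators of a cyclic action

  iter : (A → A) → ℕ → A → A
  iter f zero    x = x
  iter f (suc h) x = iter f h (f x)

  iter-map : (f : A → A) (h : ℕ) (xs : Vec A k) → iter (map f) h xs ≡ map (iter f h) xs
  iter-map f zero    xs = sym (Vec.map-id xs)
  iter-map f (suc h) xs = trans (iter-map f h (map f xs)) (sym (Vec.map-∘ (iter f h) f xs))

  module Action (ρ : A → A) where

    norm : ℕ → Cochain A k → Cochain A k
    norm zero    F xs = 0ℤ
    norm (suc h) F xs = F xs + norm h F (map ρ xs)

    shift-1 : Cochain A k → Cochain A k
    shift-1 F xs = F (map ρ xs) - F xs

    -- The differentials of the periodic resolution of ℤ over ℤ[ℤ/p], preceded by the augmentation.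
    T : (p : ℕ) → ℕ → Cochain A k → Cochain A k
    T p zero                F = F
    T p (suc zero)          F = shift-1 F
    T p (suc (suc zero))    F = norm p F
    T p (suc (suc (suc m))) F = T p (suc m) F

    module _ {Q : Vec A k → Set} (closed : ∀ {xs} → Q xs → Q (map ρ xs)) where

      norm-agree : ∀ h {F G : Cochain A k} → (∀ xs → Q xs → F xs ≡ G xs) →
                   ∀ xs → Q xs → norm h F xs ≡ norm h G xs
      norm-agree zero    e xs q = refl
      norm-agree (suc h) e xs q = cong₂ _+_ (e xs q) (norm-agree h e _ (closed q))

      -- Cochains get compared on a class of tuples closed under ρ, later the chains of nonzero
      -- vectors: labels are equivariant only there.
      T-agree : ∀ p m {F G : Cochain A k} → (∀ xs → Q xs → F xs ≡ G xs) →
                ∀ xs → Q xs → T p m F xs ≡ T p m G xs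
      T-agree p zero                e xs q = e xs q
      T-agree p (suc zero)          e xs q = cong₂ _-_ (e _ (closed q)) (e xs q)
      T-agree p (suc (suc zero))    e xs q = norm-agree p e xs q
      T-agree p (suc (suc (suc m))) e xs q = T-agree p (suc m) e xs q

    T-cong : ∀ p m {F G : Cochain A k} → (∀ xs → F xs ≡ G xs) → ∀ xs → T p m F xs ≡ T p m G xs
    T-cong p m e xs = T-agree {Q = λ _ → ⊤} _ p m (λ ys _ → e ys) xs tt

    norm-minus : ∀ h (F G : Cochain A k) → ∀ xs → norm h (λ ys → F ys - G ys) xs ≡ norm h F xs - norm h G xs
    norm-minus zero    F G xs = refl
    norm-minus (suc h) F G xs =
      trans (cong (λ u → F xs - G xs + u) (norm-minus h F G (map ρ xs))) (minus-+-minus (F xs) (G xs) _ _)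

    T-minus : ∀ p m (F G : Cochain A k) → ∀ xs → T p m (λ ys → F ys - G ys) xs ≡ T p m F xs - T p m G xs
    T-minus p zero                F G xs = refl
    T-minus p (suc zero)          F G xs = minus-minus-minus (F (map ρ xs)) (G (map ρ xs)) (F xs) (G xs)
    T-minus p (suc (suc zero))    F G xs = norm-minus p F G xs
    T-minus p (suc (suc (suc m))) F G xs = T-minus p (suc m) F G xs

    norm-δ : ∀ h (F : Cochain A k) → ∀ xs → norm h (δ F) xs ≡ δ (norm h F) xs
    norm-δ zero    F xs = sym (δ-zero xs)
    norm-δ (suc h) F xs = begin
      δ F xs + norm h (δ F) (map ρ xs)      ≡⟨ cong (δ F xs +_) (norm-δ h F (map ρ xs)) ⟩
      δ F xs + pull ρ (δ (norm h F)) xs     ≡⟨ cong (δ F xs +_) (δ-pull ρ (norm h F) xs) ⟨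
      δ F xs + δ (pull ρ (norm h F)) xs     ≡⟨ δ-+ F (pull ρ (norm h F)) xs ⟨
      δ (norm (suc h) F) xs                 ∎
      where open ≡-Reasoning

    T-δ : ∀ p m (F : Cochain A k) → ∀ xs → T p m (δ F) xs ≡ δ (T p m F) xs
    T-δ p zero                F xs = refl
    T-δ p (suc zero)          F xs =
      trans (cong (λ u → u - δ F xs) (sym (δ-pull ρ F xs))) (sym (δ-minus (pull ρ F) F xs))
    T-δ p (suc (suc zero))    F xs = norm-δ p F xs
    T-δ p (suc (suc (suc m))) F xs = T-δ p (suc m) F xs

    module _ (z : Cochain A k) (invariant : ∀ xs → z (map ρ xs) ≡ z xs) where

      norm-scale : ∀ h (F : Cochain A k) → ∀ xs → norm h (λ ys → z ys * F ys) xs ≡ z xs * norm h F xs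
      norm-scale zero    F xs = sym (ℤ.*-zeroʳ (z xs))
      norm-scale (suc h) F xs = begin
        z xs * F xs + norm h (λ ys → z ys * F ys) (map ρ xs)
          ≡⟨ cong (z xs * F xs +_) (norm-scale h F (map ρ xs)) ⟩
        z xs * F xs + z (map ρ xs) * norm h F (map ρ xs)
          ≡⟨ cong (λ u → z xs * F xs + u * norm h F (map ρ xs)) (invariant xs) ⟩
        z xs * F xs + z xs * norm h F (map ρ xs)              ≡⟨ ℤ.*-distribˡ-+ (z xs) _ _ ⟨
        z xs * norm (suc h) F xs                              ∎
        where open ≡-Reasoning

      T-scale : ∀ p m (F : Cochain A k) → ∀ xs → T p m (λ ys → z ys * F ys) xs ≡ z xs * T p m F xs
      T-scale p zero                F xs = refl
      T-scale p (suc zero)          F xs =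
        trans (cong (λ u → u * F (map ρ xs) - z xs * F xs) (invariant xs))
            (factor (z xs) (F (map ρ xs)) (F xs))
        where
        factor : ∀ a b c → a * b - a * c ≡ a * (b - c)
        factor = solve-∀
      T-scale p (suc (suc zero))    F xs = norm-scale p F xs
      T-scale p (suc (suc (suc m))) F xs = T-scale p (suc m) F xs

    norm-telescope : ∀ h (F : Cochain A k) → ∀ xs → norm h (shift-1 F) xs ≡ F (iter (map ρ) h xs) - F xs
    norm-telescope zero    F xs = sym (ℤ.+-inverseʳ (F xs))
    norm-telescope (suc h) F xs =
      trans (cong (shift-1 F xs +_) (norm-telescope h F (map ρ xs)))
          (shuffle (F (map ρ xs)) (F xs) (F (iter (map ρ) h (map ρ xs))))
      where
      shuffle : ∀ a b c → a - b + (c - a) ≡ c - b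
      shuffle = solve-∀

    norm-pull : ∀ h (F : Cochain A k) → ∀ xs → norm h (pull ρ F) xs ≡ norm h F (map ρ xs)
    norm-pull zero    F xs = refl
    norm-pull (suc h) F xs = cong (F (map ρ xs) +_) (norm-pull h F (map ρ xs))

    module _ (p : ℕ) (period : ∀ x → iter ρ p x ≡ x) where

      norm-shift-1 : (F : Cochain A k) → ∀ xs → norm p (shift-1 F) xs ≡ 0ℤ
      norm-shift-1 F xs = begin
        norm p (shift-1 F) xs           ≡⟨ norm-telescope p F xs ⟩
        F (iter (map ρ) p xs) - F xs
          ≡⟨ cong (λ ys → F ys - F xs) (trans (iter-map ρ p xs)
          (trans (Vec.map-cong period xs) (Vec.map-id xs))) ⟩
        F xs - F xs                     ≡⟨ ℤ.+-inverseʳ (F xs) ⟩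
        0ℤ                              ∎
        where open ≡-Reasoning

      shift-1-norm : (F : Cochain A k) → ∀ xs → shift-1 (norm p F) xs ≡ 0ℤ
      shift-1-norm F xs = begin
        norm p F (map ρ xs) - norm p F xs   ≡⟨ cong (λ u → u - norm p F xs) (norm-pull p F xs) ⟨
        norm p (pull ρ F) xs - norm p F xs  ≡⟨ norm-minus p (pull ρ F) F xs ⟨
        norm p (shift-1 F) xs               ≡⟨ norm-shift-1 F xs ⟩
        0ℤ                                  ∎
        where open ≡-Reasoning

      -- The norm of a shift telescopes around the orbit, and a norm is invariant under ρ; both use
      -- that the p-th power of ρ is the identity.
      T-T : ∀ m (F : Cochain A k) → ∀ xs → T p (suc m) (T p (suc (suc m)) F) xs ≡ 0ℤ
      T-T zero          F xs = shift-1-norm F xs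
      T-T (suc zero)    F xs = norm-shift-1 F xs
      T-T (suc (suc m)) F xs = T-T m F xs

  module Natural {j k : ℕ} (ρA : A → A) (ρB : B → B) (t : Vec A j → Vec B k) {Q : Vec A j → Set}
                 (closed : ∀ {xs} → Q xs → Q (map ρA xs))
                 (equivariant : ∀ xs → Q xs → t (map ρA xs) ≡ map ρB (t xs)) where

    private
      module TA = Action ρA
      module TB = Action ρB

    norm-natural : ∀ h (F : Cochain B k) → ∀ xs → Q xs → TA.norm h (F ∘ t) xs ≡ TB.norm h F (t xs)
    norm-natural zero    F xs c = refl
    norm-natural (suc h) F xs c = cong (F (t xs) +_)
      (trans (norm-natural h F (map ρA xs) (closed c)) (cong (TB.norm h F) (equivariant xs c)))

    T-natural : ∀ p m (F : Cochain B k) → ∀ xs → Q xs → TA.T p m (F ∘ t) xs ≡ TB.T p m F (t xs)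
    T-natural p zero                F xs c = refl
    T-natural p (suc zero)          F xs c = cong (λ ys → F ys - F (t xs)) (equivariant xs c)
    T-natural p (suc (suc zero))    F xs c = norm-natural p F xs c
    T-natural p (suc (suc (suc m))) F xs c = T-natural p (suc m) F xs c

  -- Sign vectors and their iterated cones

  module Sphere (q : ℕ) where

    p : ℕ
    p = suc q

    rot : Fin p → Fin p
    rot a with view a
    ... | ‵fromℕ     = zero
    ... | ‵inject₁ i = suc i

    V : ℕ → Set
    V m = Vec (Maybe (Fin p)) m

    ρ : ∀ {m} → V m → V m
    ρ = map (Maybe.map rot)

    open module ActV {m} = Action (ρ {m})

    infix 4 _≼_
    _≼_ : ∀ {m} → V m → V m → Set
    X ≼ Y = ∀ x s → lookup X x ≡ just s → lookup Y x ≡ just s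

    NonZero : ∀ {m} → V m → Set
    NonZero X = ∃[ x ] ∃[ s ] lookup X x ≡ just s

    raise base : ∀ {m} → V m → V (suc m)
    raise = just zero ∷_
    base  = nothing ∷_

    apex : ∀ {m} → V (suc m)
    apex = raise (replicate _ nothing)

    -- The boundary of the prism consists of the base and of the raised copy, which is coned off with the apex.
    cone : ∀ {m} → Cochain (V (suc m)) (suc k) → Cochain (V m) k
    cone F xs = F (apex ∷ map raise xs) - prism base raise F xs

    -- Evaluation on the (m - 1)-dimensional chain that is obtained by alternately applying
    -- ρ - 1 or the norm to the previous one and coning off with a new apex.
    C : ∀ m → Cochain (V m) m → ℤ
    C zero    F = F []
    C (suc m) F = C m (T p m (cone F))

    Chain : ∀ {m} → Vec (V m) k → Set
    Chain xs = AllPairs _≼_ xs × All NonZero xs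

    [m+n%p]%p≡[m+n]%p : ∀ m n → (m ℕ.+ n % p) % p ≡ (m ℕ.+ n) % p
    [m+n%p]%p≡[m+n]%p m n = begin
      (m ℕ.+ n % p) % p          ≡⟨ ℕ.%-distribˡ-+ m (n % p) p ⟩
      (m % p ℕ.+ n % p % p) % p  ≡⟨ cong (λ u → (m % p ℕ.+ u) % p) (ℕ.m%n%n≡m%n n p) ⟩
      (m % p ℕ.+ n % p) % p      ≡⟨ ℕ.%-distribˡ-+ m n p ⟨
      (m ℕ.+ n) % p              ∎
      where open ≡-Reasoning

    toℕ-rot : ∀ a → toℕ (rot a) ≡ suc (toℕ a) % p
    toℕ-rot a with view a
    ... | ‵fromℕ     = sym (trans (cong (λ u → suc u % p) (Fin.toℕ-fromℕ q)) (ℕ.n%n≡0 p))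
    ... | ‵inject₁ i = sym (trans (cong (λ u → suc u % p) (Fin.toℕ-inject₁ i))
        (ℕ.m<n⇒m%n≡m (ℕ.s<s (Fin.toℕ<n i))))

    toℕ-iter-rot : ∀ h a → toℕ (iter rot h a) ≡ (h ℕ.+ toℕ a) % p
    toℕ-iter-rot zero    a = sym (ℕ.m<n⇒m%n≡m (Fin.toℕ<n a))
    toℕ-iter-rot (suc h) a = begin
      toℕ (iter rot h (rot a))          ≡⟨ toℕ-iter-rot h (rot a) ⟩
      (h ℕ.+ toℕ (rot a)) % p           ≡⟨ cong (λ u → (h ℕ.+ u) % p) (toℕ-rot a) ⟩
      (h ℕ.+ suc (toℕ a) % p) % p       ≡⟨ [m+n%p]%p≡[m+n]%p h (suc (toℕ a)) ⟩
      (h ℕ.+ suc (toℕ a)) % p           ≡⟨ cong (_% p) (ℕ.+-suc h (toℕ a)) ⟩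
      suc (h ℕ.+ toℕ a) % p             ∎
      where open ≡-Reasoning

    rot-period : ∀ a → iter rot p a ≡ a
    rot-period a = Fin.toℕ-injective (begin
      toℕ (iter rot p a)       ≡⟨ toℕ-iter-rot p a ⟩
      (p ℕ.+ toℕ a) % p        ≡⟨ cong (_% p) (ℕ.+-comm p (toℕ a)) ⟩
      (toℕ a ℕ.+ p) % p        ≡⟨ ℕ.[m+n]%n≡m%n (toℕ a) p ⟩
      toℕ a % p                ≡⟨ ℕ.m<n⇒m%n≡m (Fin.toℕ<n a) ⟩
      toℕ a                    ∎)
      where open ≡-Reasoning

    iter-Maybe : ∀ h (a : Maybe (Fin p)) → iter (Maybe.map rot) h a ≡ Maybe.map (iter rot h) a
    iter-Maybe zero    a        = sym (Maybe.map-id a)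
    iter-Maybe (suc h) a        = trans (iter-Maybe h (Maybe.map rot a)) (sym (Maybe.map-∘ a))

    ρ-period : ∀ {m} (X : V m) → iter ρ p X ≡ X
    ρ-period X = begin
      iter ρ p X                           ≡⟨ iter-map (Maybe.map rot) p X ⟩
      map (iter (Maybe.map rot) p) X
        ≡⟨ Vec.map-cong (λ a → trans (iter-Maybe p a) (trans (Maybe.map-cong rot-period a) (Maybe.map-id a)))
        X ⟩
      map (λ a → a) X                      ≡⟨ Vec.map-id X ⟩
      X                                    ∎
      where open ≡-Reasoning

    just-injective-map : ∀ {a : Maybe (Fin p)} {s} → Maybe.map rot a ≡ just s →
        ∃[ s′ ] (a ≡ just s′ × rot s′ ≡ s)
    just-injective-map {just s′} refl = s′ , refl , refl

    ρ-mono : ∀ {m} {X Y : V m} → X ≼ Y → ρ X ≼ ρ Y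
    ρ-mono {X = X} {Y} X≼Y x s eq with just-injective-map
        (trans (sym (Vec.lookup-map x (Maybe.map rot) X)) eq)
    ... | s′ , Xx , refl = trans (Vec.lookup-map x (Maybe.map rot) Y) (cong (Maybe.map rot) (X≼Y x s′ Xx))

    ρ-NonZero : ∀ {m} {X : V m} → NonZero X → NonZero (ρ X)
    ρ-NonZero {X = X} (x , s , eq) = x , rot s , trans (Vec.lookup-map x (Maybe.map rot) X)
        (cong (Maybe.map rot) eq)

    ρ-Chain : ∀ {m} {xs : Vec (V m) k} → Chain xs → Chain (map ρ xs)
    ρ-Chain (c , l) = AllPairs.map⁺ (AllPairs.map (λ {X} {Y} → ρ-mono {X = X} {Y}) c) , All.map⁺
        (All.map (λ {X} → ρ-NonZero {X = X}) l)

    base-mono : ∀ {m} {X Y : V m} → X ≼ Y → base X ≼ base Y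
    base-mono X≼Y (suc x) = X≼Y x

    raise-mono : ∀ {m} {X Y : V m} → X ≼ Y → raise X ≼ raise Y
    raise-mono X≼Y zero    s eq = eq
    raise-mono X≼Y (suc x) = X≼Y x

    base≼raise : ∀ {m} {X Y : V m} → X ≼ Y → base X ≼ raise Y
    base≼raise X≼Y (suc x) = X≼Y x

    ≼-refl : ∀ {m} (X : V m) → X ≼ X
    ≼-refl X x s eq = eq

    apex≼raise : ∀ {m} (X : V m) → apex ≼ raise X
    apex≼raise X zero    s eq = eq
    apex≼raise X (suc x) s eq with () ← trans (sym (Vec.lookup-replicate x nothing)) eq

    raise-NonZero : ∀ {m} (X : V m) → NonZero (raise X)
    raise-NonZero X = zero , zero , refl

    base-NonZero : ∀ {m} {X : V m} → NonZero X → NonZero (base X)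
    base-NonZero (x , s , eq) = suc x , s , eq

    cone-agree : ∀ {m} {F G : Cochain (V (suc m)) (suc k)} → (∀ ys → Chain ys → F ys ≡ G ys) →
                 ∀ xs → Chain xs → cone F xs ≡ cone G xs
    cone-agree e xs (c , l) = cong₂ _-_
      (e _ ( All.map⁺ (All.universal apex≼raise xs) ∷ AllPairs.map⁺ (AllPairs.map raise-mono c)
           , raise-NonZero _ ∷ All.map⁺ (All.universal raise-NonZero xs)))
      (prism-agree _≼_ _≼_ base raise base-mono raise-mono base≼raise (λ X → base≼raise (≼-refl X))
         NonZero (λ ys c l → e ys (c , l)) xs c (All.map base-NonZero l) (All.universal raise-NonZero xs))

    cone-minus : ∀ {m} (F G : Cochain (V (suc m)) (suc k)) → ∀ xs →
                 cone (λ ys → F ys - G ys) xs ≡ cone F xs - cone G xs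
    cone-minus F G xs =
      trans (cong (λ u → F (apex ∷ map raise xs) - G (apex ∷ map raise xs) - u)
          (prism-minus base raise F G xs))
            (minus-minus-minus (F (apex ∷ map raise xs)) _ _ _)

    -- Dual of ∂(cone σ) = base σ - cone(∂σ): the raised end of the prism cancels against the face
    -- opposite the apex.
    cone-δ : ∀ {m} (F : Cochain (V (suc m)) (suc k)) → ∀ xs → cone (δ F) xs ≡ F (map base xs) - δ (cone F) xs
    cone-δ F xs = begin
      F (map raise xs) - δ Fa (map raise xs) - prism base raise (δ F) xs
        ≡⟨ alg₁ (F (map raise xs)) (δ Fa (map raise xs)) (prism base raise (δ F) xs)
            (δ (prism base raise F) xs) ⟩
      F (map raise xs) - (δ Fa (map raise xs) - δ (prism base raise F) xs)
        - (prism base raise (δ F) xs + δ (prism base raise F) xs)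
        ≡⟨ cong (λ u → F (map raise xs) - (δ Fa (map raise xs) - δ (prism base raise F) xs) - u)
            (prism-homotopy base raise F xs) ⟩
      F (map raise xs) - (δ Fa (map raise xs) - δ (prism base raise F) xs) -
          (F (map raise xs) - F (map base xs))
        ≡⟨ alg₂ (F (map raise xs)) _ (F (map base xs)) ⟩
      F (map base xs) - (δ Fa (map raise xs) - δ (prism base raise F) xs)
        ≡⟨ cong (λ u → F (map base xs) - (u - δ (prism base raise F) xs)) (δ-pull raise Fa xs) ⟨
      F (map base xs) - (δ (pull raise Fa) xs - δ (prism base raise F) xs)
        ≡⟨ cong (λ u → F (map base xs) - u) (δ-minus (pull raise Fa) (prism base raise F) xs) ⟨
      F (map base xs) - δ (cone F) xs ∎
      where
      open ≡-Reasoning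
      Fa = λ ys → F (apex ∷ ys)
      alg₁ : ∀ a b c d → a - b - c ≡ a - (b - d) - (c + d)
      alg₁ = solve-∀
      alg₂ : ∀ a b c → a - b - (a - c) ≡ c - b
      alg₂ = solve-∀

    -- The chain behind `C` is supported on increasing tuples of nonzero vectors, since the apex
    -- lies below every raised vector and base vectors lie below raised ones.
    C-agree : ∀ m {F G : Cochain (V m) m} → (∀ xs → Chain xs → F xs ≡ G xs) → C m F ≡ C m G
    C-agree zero    e = e [] ([] , [])
    C-agree (suc m) e = C-agree m (T-agree ρ-Chain p m (cone-agree e))

    C-cong : ∀ m {F G : Cochain (V m) m} → (∀ xs → F xs ≡ G xs) → C m F ≡ C m G
    C-cong m e = C-agree m (λ xs _ → e xs)

    C-minus : ∀ m (F G : Cochain (V m) m) → C m (λ xs → F xs - G xs) ≡ C m F - C m G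
    C-minus zero    F G = refl
    C-minus (suc m) F G =
      trans (C-cong m λ xs → trans (T-cong p m (cone-minus F G) xs) (T-minus p m (cone F) (cone G) xs))
            (C-minus m (T p m (cone F)) (T p m (cone G)))

    C-vanish : ∀ m {F : Cochain (V m) m} → (∀ xs → Chain xs → F xs ≡ 0ℤ) → C m F ≡ 0ℤ
    C-vanish m {F} e =
      trans (C-agree m λ xs c → trans (e xs c) (sym (ℤ.+-inverseʳ (F xs))))
          (trans (C-minus m F F) (ℤ.+-inverseʳ (C m F)))

    C-T-T : ∀ m (F : Cochain (V m) m) → C m (T p m (T p (suc m) F)) ≡ 0ℤ
    -- `T p 0` is the identity, and the shift vanishes on the empty tuple, which ρ fixes.
    C-T-T zero    F = ℤ.+-inverseʳ (F [])
    C-T-T (suc m) F = C-vanish (suc m) (λ xs _ → T-T p ρ-period m F xs)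

    T-base : ∀ {m} r (F : Cochain (V (suc m)) k) → ∀ xs → T p r (pull base F) xs ≡ T p r F (map base xs)
    T-base r F xs = Natural.T-natural ρ ρ (map base) {Q = λ _ → ⊤} _
      (λ ys _ → trans (sym (Vec.map-∘ base ρ ys)) (Vec.map-∘ ρ base ys)) p r F xs tt

    -- If c_m is the chain behind `C m`, this says ∂c_{m+1} = T_m c_m, embedded by `base`. The cone
    -- over ∂(T_m c_m) drops out, because by induction that boundary is T_m T_{m-1} c_{m-1} = 0.
    C-δ : ∀ m (F : Cochain (V (suc m)) m) → C (suc m) (δ F) ≡ C m (T p m (pull base F))
    C-δ zero    F = ℤ.+-identityʳ (F [])
    C-δ (suc m) F = begin
      C (suc m) (T p (suc m) (cone (δ F)))
        ≡⟨ C-cong (suc m) (λ xs → trans (T-cong p (suc m) (cone-δ F) xs)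
            (T-minus p (suc m) (pull base F) (δ (cone F)) xs)) ⟩
      C (suc m) (λ xs → T p (suc m) (pull base F) xs - T p (suc m) (δ (cone F)) xs)
        ≡⟨ C-minus (suc m) (T p (suc m) (pull base F)) (T p (suc m) (δ (cone F))) ⟩
      C (suc m) (T p (suc m) (pull base F)) - C (suc m) (T p (suc m) (δ (cone F)))
        ≡⟨ cong (λ u → C (suc m) (T p (suc m) (pull base F)) - u) boundary-term ⟩
      C (suc m) (T p (suc m) (pull base F)) - 0ℤ
        ≡⟨ ℤ.+-identityʳ _ ⟩
      C (suc m) (T p (suc m) (pull base F)) ∎
      where
      open ≡-Reasoning
      boundary-term : C (suc m) (T p (suc m) (δ (cone F))) ≡ 0ℤ
      boundary-term = begin
        C (suc m) (T p (suc m) (δ (cone F)))           ≡⟨ C-cong (suc m) (T-δ p (suc m) (cone F)) ⟩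
        C (suc m) (δ (T p (suc m) (cone F)))           ≡⟨ C-δ m (T p (suc m) (cone F)) ⟩
        C m (T p m (pull base (T p (suc m) (cone F))))
          ≡⟨ C-cong m (T-cong p m λ xs → T-base (suc m) (cone F) xs) ⟨
        C m (T p m (T p (suc m) (pull base (cone F)))) ≡⟨ C-T-T m (pull base (cone F)) ⟩
        0ℤ                                             ∎

    -- Cocycles of ℤ/p on tuples of signs

    ⟦_⟧ : Bool → ℤ
    ⟦ b ⟧ = if b then 1ℤ else 0ℤ

    last : Fin p → ℤ
    last a = ⟦ toℕ a ≡ᵇ q ⟧

    descent : Fin p → Fin p → ℤ
    descent a b = ⟦ toℕ b <ᵇ toℕ a ⟧

    last-fromℕ : last (fromℕ q) ≡ 1ℤ
    last-fromℕ = cong ⟦_⟧ (dec-true (toℕ (fromℕ q) ℕ.≟ q) (Fin.toℕ-fromℕ q))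

    last-inject₁ : (i : Fin q) → last (inject₁ i) ≡ 0ℤ
    last-inject₁ i = cong ⟦_⟧ (dec-false (toℕ (inject₁ i) ℕ.≟ q)
      λ eq → ℕ.<⇒≢ (Fin.toℕ<n i) (trans (sym (Fin.toℕ-inject₁ i)) eq))

    descent-irrefl : ∀ a → descent a a ≡ 0ℤ
    descent-irrefl a = cong ⟦_⟧ (dec-false (toℕ a ℕ.<? toℕ a) (ℕ.n≮n (toℕ a)))

    -- Rotation keeps the order of two signs unless exactly one of them wraps around from the last
    -- position.
    descent-rot : ∀ a b → descent (rot a) (rot b) - descent a b ≡ last b - last a
    descent-rot a b with view a | view b
    ... | ‵fromℕ | ‵fromℕ = trans (cong (λ u → 0ℤ - u) (descent-irrefl (fromℕ q)))
      (sym (ℤ.+-inverseʳ (last (fromℕ q))))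
    ... | ‵fromℕ | ‵inject₁ i = cong₂ _-_ (sym (last-inject₁ i))
      (trans (cong ⟦_⟧ (dec-true (toℕ (inject₁ i) ℕ.<? toℕ (fromℕ q)) i<q)) (sym last-fromℕ))
      where
      i<q : toℕ (inject₁ i) ℕ.< toℕ (fromℕ q)
      i<q = subst₂ ℕ._<_ (sym (Fin.toℕ-inject₁ i)) (sym (Fin.toℕ-fromℕ q)) (Fin.toℕ<n i)
    ... | ‵inject₁ i | ‵fromℕ = cong₂ _-_ (sym last-fromℕ)
      (trans (cong ⟦_⟧ (dec-false (toℕ (fromℕ q) ℕ.<? toℕ (inject₁ i)) q≮i)) (sym (last-inject₁ i)))
      where
      q≮i : ¬ toℕ (fromℕ q) ℕ.< toℕ (inject₁ i)
      q≮i q<i = ℕ.<-asym (Fin.toℕ<n i) (subst₂ ℕ._<_ (Fin.toℕ-fromℕ q) (Fin.toℕ-inject₁ i) q<i)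
    ... | ‵inject₁ i | ‵inject₁ j = begin
      ⟦ toℕ j <ᵇ toℕ i ⟧ - ⟦ toℕ (inject₁ j) <ᵇ toℕ (inject₁ i) ⟧
        ≡⟨ cong₂ (λ u v → ⟦ toℕ j <ᵇ toℕ i ⟧ - ⟦ u <ᵇ v ⟧) (Fin.toℕ-inject₁ j) (Fin.toℕ-inject₁ i) ⟩
      ⟦ toℕ j <ᵇ toℕ i ⟧ - ⟦ toℕ j <ᵇ toℕ i ⟧
        ≡⟨ ℤ.+-inverseʳ ⟦ toℕ j <ᵇ toℕ i ⟧ ⟩
      0ℤ
        ≡⟨ cong₂ _-_ (last-inject₁ j) (last-inject₁ i) ⟨
      last (inject₁ j) - last (inject₁ i) ∎
      where open ≡-Reasoning

    private module R = Action rot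

    shift-toℕ : ∀ a → ℤ.+ toℕ (rot a) - ℤ.+ toℕ a ≡ 1ℤ - ℤ.+ p * last a
    shift-toℕ a with view a
    ... | ‵fromℕ rewrite last-fromℕ | Fin.toℕ-fromℕ q = alg (ℤ.+ q)
      where
      alg : ∀ x → 0ℤ - x ≡ 1ℤ - (1ℤ + x) * 1ℤ
      alg = solve-∀
    ... | ‵inject₁ i rewrite last-inject₁ i | Fin.toℕ-inject₁ i | ℤ.*-zeroʳ (ℤ.+ p) = alg (ℤ.+ toℕ i)
      where
      alg : ∀ x → (1ℤ + x) - x ≡ 1ℤ - 0ℤ
      alg = solve-∀

    -- A chain map from tuples of signs to the periodic resolution: carry is the invariant cocycle
    -- δ descent, and Ψ (2 + k) is its cup product with Ψ k.
    Ψ : ∀ k → Cochain (Fin p) k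
    carry : Fin p → Fin p → Fin p → ℤ
    carry a b c = descent b c - (descent a c - descent a b)
    Ψ zero                _                = 0ℤ
    Ψ (suc zero)          (a ∷ [])         = last a
    Ψ (suc (suc zero))    (a ∷ b ∷ [])     = descent a b
    Ψ (suc (suc (suc k))) (a ∷ b ∷ c ∷ xs) = carry a b c * Ψ (suc k) (c ∷ xs)

    norm-one : ∀ h (xs : Vec (Fin p) k) → R.norm h (λ _ → 1ℤ) xs ≡ ℤ.+ h
    norm-one zero    xs = refl
    norm-one (suc h) xs = cong (1ℤ +_) (norm-one h (map rot xs))

    -- Each orbit passes the last sign once. Instead of counting, `shift-toℕ` writes p times `last`
    -- as 1 minus a shift; the norm of 1 is p and the norm of a shift is 0.
    norm-last : ∀ a → R.norm p (Ψ 1) (a ∷ []) ≡ 1ℤ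
    norm-last a = ℤ.*-cancelˡ-≡ (ℤ.+ p) _ 1ℤ (begin
      ℤ.+ p * R.norm p (Ψ 1) (a ∷ [])
        ≡⟨ R.norm-scale (λ _ → ℤ.+ p) (λ _ → refl) p (Ψ 1) (a ∷ []) ⟨
      R.norm p (λ ys → ℤ.+ p * Ψ 1 ys) (a ∷ [])
        ≡⟨ alg (ℤ.+ p) (R.norm p (λ ys → ℤ.+ p * Ψ 1 ys) (a ∷ [])) ⟩
      ℤ.+ p - (ℤ.+ p - R.norm p (λ ys → ℤ.+ p * Ψ 1 ys) (a ∷ []))
        ≡⟨ cong (λ u → ℤ.+ p - u) telescoped ⟩
      ℤ.+ p - 0ℤ                                          ≡⟨ alg₂ (ℤ.+ p) ⟩
      ℤ.+ p * 1ℤ                                          ∎)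
      where
      open ≡-Reasoning
      alg : ∀ a b → b ≡ a - (a - b)
      alg = solve-∀
      alg₂ : ∀ a → a - 0ℤ ≡ a * 1ℤ
      alg₂ = solve-∀
      position : Cochain (Fin p) 1
      position (b ∷ []) = ℤ.+ toℕ b
      telescoped : ℤ.+ p - R.norm p (λ ys → ℤ.+ p * Ψ 1 ys) (a ∷ []) ≡ 0ℤ
      telescoped = begin
        ℤ.+ p - R.norm p (λ ys → ℤ.+ p * Ψ 1 ys) (a ∷ [])
          ≡⟨ cong (λ u → u - R.norm p (λ ys → ℤ.+ p * Ψ 1 ys) (a ∷ [])) (norm-one p (a ∷ [])) ⟨
        R.norm p (λ _ → 1ℤ) (a ∷ []) - R.norm p (λ ys → ℤ.+ p * Ψ 1 ys) (a ∷ [])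
          ≡⟨ R.norm-minus p (λ _ → 1ℤ) (λ ys → ℤ.+ p * Ψ 1 ys) (a ∷ []) ⟨
        R.norm p (λ ys → 1ℤ - ℤ.+ p * Ψ 1 ys) (a ∷ [])
          ≡⟨ R.norm-agree {Q = λ _ → ⊤} _ p {F = R.shift-1 position} {G = λ ys → 1ℤ - ℤ.+ p * Ψ 1 ys}
             (λ { (b ∷ []) _ → shift-toℕ b }) (a ∷ []) tt ⟨
        R.norm p (R.shift-1 position) (a ∷ [])
          ≡⟨ R.norm-shift-1 p rot-period position (a ∷ []) ⟩
        0ℤ ∎

    -- `carry a b c` is the carry in the addition of the residues of b - a and c - b, so it depends
    -- on differences only. Formally, the change of `descent` under rotation is the coboundary of
    -- `last`, which has coboundary 0.
    carry-rot : ∀ a b c → carry (rot a) (rot b) (rot c) ≡ carry a b c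
    carry-rot a b c = begin
      carry (rot a) (rot b) (rot c)
        ≡⟨ alg₁ (descent (rot b) (rot c)) (descent (rot a) (rot c)) (descent (rot a) (rot b)) (descent b c)
            (descent a c) (descent a b) ⟩
      carry a b c + ((descent (rot b) (rot c) - descent b c)
                    - ((descent (rot a) (rot c) - descent a c) - (descent (rot a) (rot b) - descent a b)))
        ≡⟨ cong (carry a b c +_) (cong₂ _-_ (descent-rot b c) (cong₂ _-_ (descent-rot a c) (descent-rot a b))) ⟩
      carry a b c + ((last c - last b) - ((last c - last a) - (last b - last a)))
        ≡⟨ alg₂ (carry a b c) (last a) (last b) (last c) ⟩
      carry a b c ∎
      where
      open ≡-Reasoning
      alg₁ : ∀ a b c d e f → a - (b - c) ≡ d - (e - f) + ((a - d) - ((b - e) - (c - f)))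
      alg₁ = solve-∀
      alg₂ : ∀ z a b c → z + ((c - b) - ((c - a) - (b - a))) ≡ z
      alg₂ = solve-∀

    drop₂ : Vec (Fin p) (suc (suc k)) → Vec (Fin p) k
    drop₂ (_ ∷ _ ∷ xs) = xs

    carry₃ : Cochain (Fin p) (suc (suc (suc k)))
    carry₃ (a ∷ b ∷ c ∷ _) = carry a b c

    T-Ψ : ∀ r m xs → R.T p r (Ψ (suc (suc (suc m)))) xs ≡ carry₃ xs * R.T p r (Ψ (suc m)) (drop₂ xs)
    T-Ψ r m xs = begin
      R.T p r (Ψ (suc (suc (suc m)))) xs                  ≡⟨ R.T-cong p r (λ { (a ∷ b ∷ c ∷ _) → refl }) xs ⟩
      R.T p r (λ ys → carry₃ ys * Ψ (suc m) (drop₂ ys)) xs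
        ≡⟨ R.T-scale carry₃ (λ { (a ∷ b ∷ c ∷ _) → carry-rot a b c }) p r (Ψ (suc m) ∘ drop₂) xs ⟩
      carry₃ xs * R.T p r (Ψ (suc m) ∘ drop₂) xs
        ≡⟨ cong (carry₃ xs *_) (Natural.T-natural rot rot drop₂ {Q = λ _ → ⊤} _ (λ { (_ ∷ _ ∷ _) _ → refl }) p
            r (Ψ (suc m)) xs tt) ⟩
      carry₃ xs * R.T p r (Ψ (suc m)) (drop₂ xs) ∎
      where open ≡-Reasoning

    -- On triples the orbit sum of `last` is 1 and leaves `carry`. For longer tuples δ passes to the
    -- second factor since `carry` is a cocycle, and `T` has period two.
    δ-Ψ : ∀ m xs → δ (Ψ (suc m)) xs ≡ R.T p (suc m) (Ψ (suc (suc m))) xs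
    δ-Ψ zero (a ∷ b ∷ []) = sym (descent-rot a b)
    δ-Ψ (suc zero) (a ∷ b ∷ c ∷ []) = sym (begin
      R.norm p (Ψ 3) (a ∷ b ∷ c ∷ [])              ≡⟨ T-Ψ 2 0 (a ∷ b ∷ c ∷ []) ⟩
      carry a b c * R.norm p (Ψ 1) (c ∷ [])        ≡⟨ cong (carry a b c *_) (norm-last c) ⟩
      carry a b c * 1ℤ                             ≡⟨ ℤ.*-identityʳ (carry a b c) ⟩
      carry a b c                                  ∎)
      where open ≡-Reasoning
    δ-Ψ (suc (suc m)) (a ∷ b ∷ c ∷ d ∷ xs) = begin
      carry b c d * F (d ∷ xs) - (carry a c d * F (d ∷ xs)
        - (carry a b d * F (d ∷ xs) - δ (λ ys → carry a b c * F (c ∷ ys)) (d ∷ xs)))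
        ≡⟨ cong (λ u → carry b c d * F (d ∷ xs) - (carry a c d * F (d ∷ xs) - (carry a b d * F (d ∷ xs) - u)))
                (δ-scale (carry a b c) (F ∘ (c ∷_)) (d ∷ xs)) ⟩
      carry b c d * F (d ∷ xs) - (carry a c d * F (d ∷ xs)
        - (carry a b d * F (d ∷ xs) - carry a b c * δ (F ∘ (c ∷_)) (d ∷ xs)))
        ≡⟨ cocycle (descent a b) (descent a c) (descent a d) (descent b c) (descent b d) (descent c d)
                   (F (d ∷ xs)) (δ (F ∘ (c ∷_)) (d ∷ xs)) ⟩
      carry a b c * δ F (c ∷ d ∷ xs)
        ≡⟨ cong (carry a b c *_) (δ-Ψ m (c ∷ d ∷ xs)) ⟩
      carry a b c * R.T p (suc m) (Ψ (suc (suc m))) (c ∷ d ∷ xs)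
        ≡⟨ T-Ψ (suc m) (suc m) (a ∷ b ∷ c ∷ d ∷ xs) ⟨
      R.T p (suc m) (Ψ (suc (suc (suc (suc m))))) (a ∷ b ∷ c ∷ d ∷ xs) ∎
      where
      open ≡-Reasoning
      F = Ψ (suc m)
      cocycle : ∀ ab ac ad bc bd cd f g →
        (cd - (bd - bc)) * f - ((cd - (ad - ac)) * f - ((bd - (ad - ab)) * f - (bc - (ac - ab)) * g))
        ≡ (bc - (ac - ab)) * (f - g)
      cocycle = solve-∀

    -- Comparing neighbours is enough: along a chain levels do not decrease, so a repeated level
    -- occurs at neighbouring places.
    data Degenerate {A : Set} : ∀ {k} → Vec A k → Set where
      here  : ∀ {k} x (xs : Vec A k) → Degenerate (x ∷ x ∷ xs)
      there : ∀ {k} x {xs : Vec A k} → Degenerate xs → Degenerate (x ∷ xs)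

    -- The cocycles are normalised: as `descent a a` is 0, a `carry` with two equal neighbours
    -- vanishes.
    Ψ-degenerate : ∀ k {xs : Vec (Fin p) k} → Degenerate xs → Ψ k xs ≡ 0ℤ
    Ψ-degenerate zero d = refl
    Ψ-degenerate (suc zero) (there _ ())
    Ψ-degenerate (suc (suc zero)) (here a []) = descent-irrefl a
    Ψ-degenerate (suc (suc zero)) (there _ (there _ ()))
    Ψ-degenerate (suc (suc (suc k))) (here a (c ∷ xs)) = begin
      carry a a c * Ψ (suc k) (c ∷ xs)
        ≡⟨ cong (_* Ψ (suc k) (c ∷ xs)) (trans (alg (descent a c) _) (descent-irrefl a)) ⟩
      0ℤ * Ψ (suc k) (c ∷ xs)              ≡⟨ ℤ.*-zeroˡ (Ψ (suc k) (c ∷ xs)) ⟩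
      0ℤ                                   ∎
      where
      open ≡-Reasoning
      alg : ∀ x y → x - (x - y) ≡ y
      alg = solve-∀
    Ψ-degenerate (suc (suc (suc k))) (there a (here b xs)) = begin
      carry a b b * Ψ (suc k) (b ∷ xs)
        ≡⟨ cong (_* Ψ (suc k) (b ∷ xs)) (trans (alg (descent b b) (descent a b)) (descent-irrefl b)) ⟩
      0ℤ * Ψ (suc k) (b ∷ xs)              ≡⟨ ℤ.*-zeroˡ (Ψ (suc k) (b ∷ xs)) ⟩
      0ℤ                                   ∎
      where
      open ≡-Reasoning
      alg : ∀ x y → x - (y - y) ≡ x
      alg = solve-∀
    Ψ-degenerate (suc (suc (suc k))) (there a (there b {c ∷ xs} d)) =
      trans (cong (carry a b c *_) (Ψ-degenerate (suc k) d)) (ℤ.*-zeroʳ (carry a b c))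

    -- Degree of an equivariant sign and the ℤ/p-Tucker lemma

    Equivariant : ∀ {m} → (V m → Fin p) → Set
    Equivariant ℓ = ∀ X → NonZero X → ℓ (ρ X) ≡ rot (ℓ X)

    label : ∀ {m} (k : ℕ) → (V m → Fin p) → Cochain (V m) k
    label k ℓ = pull ℓ (Ψ k)

    module _ {m k : ℕ} {ℓ : V m → Fin p} (equivariant : Equivariant ℓ) where

      map-equivariant : (xs : Vec (V m) k) → Chain xs → map ℓ (map ρ xs) ≡ map rot (map ℓ xs)
      map-equivariant xs (_ , nz) = go nz
        where
        go : ∀ {k} {xs : Vec (V m) k} → All NonZero xs → map ℓ (map ρ xs) ≡ map rot (map ℓ xs)
        go []       = refl
        go (z ∷ zs) = cong₂ _∷_ (equivariant _ z) (go zs)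

      private module Nat = Natural ρ rot (map ℓ) {Q = Chain} ρ-Chain map-equivariant
      open Nat using () renaming (T-natural to T-label) public

    δ-label : ∀ {m} r {ℓ : V m → Fin p} → Equivariant ℓ → ∀ xs → Chain xs →
              δ (label (suc r) ℓ) xs ≡ T p (suc r) (label (suc (suc r)) ℓ) xs
    δ-label r {ℓ} equivariant xs c = begin
      δ (pull ℓ (Ψ (suc r))) xs                          ≡⟨ δ-pull ℓ (Ψ (suc r)) xs ⟩
      δ (Ψ (suc r)) (map ℓ xs)                           ≡⟨ δ-Ψ r (map ℓ xs) ⟩
      Action.T rot p (suc r) (Ψ (suc (suc r))) (map ℓ xs)
        ≡⟨ T-label equivariant p (suc r) (Ψ (suc (suc r))) xs c ⟨
      T p (suc r) (label (suc (suc r)) ℓ) xs             ∎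
      where open ≡-Reasoning

    -- Stokes: `δ-label` makes the left side the value of a coboundary, and `C-δ` moves it to the
    -- boundary of the chain.
    C-T-label : ∀ m {ℓ : V (suc (suc m)) → Fin p} → Equivariant ℓ →
                C (suc (suc m)) (T p (suc m) (label (suc (suc m)) ℓ)) ≡
                C (suc m) (T p (suc m) (label (suc m) (ℓ ∘ base)))
    C-T-label m {ℓ} equivariant = begin
      C (suc (suc m)) (T p (suc m) (label (suc (suc m)) ℓ))
        ≡⟨ C-agree (suc (suc m)) (δ-label m equivariant) ⟨
      C (suc (suc m)) (δ (label (suc m) ℓ))                    ≡⟨ C-δ (suc m) (label (suc m) ℓ) ⟩
      C (suc m) (T p (suc m) (pull base (label (suc m) ℓ)))
        ≡⟨ C-cong (suc m) (T-cong p (suc m) λ xs → cong (Ψ (suc m)) (sym (Vec.map-∘ ℓ base xs))) ⟩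
      C (suc m) (T p (suc m) (label (suc m) (ℓ ∘ base)))       ∎
      where open ≡-Reasoning

    ∘ρ-equivariant : ∀ {m} {ℓ : V m → Fin p} → Equivariant ℓ → Equivariant (ℓ ∘ ρ)
    ∘ρ-equivariant e X nz = e (ρ X) (ρ-NonZero {X = X} nz)

    C-+ : ∀ m (F G : Cochain (V m) m) → C m (λ xs → F xs + G xs) ≡ C m F + C m G
    C-+ m F G = begin
      C m (λ xs → F xs + G xs)                      ≡⟨ restore (C m (λ xs → F xs + G xs)) (C m G) ⟩
      C m (λ xs → F xs + G xs) - C m G + C m G      ≡⟨ cong (_+ C m G) (C-minus m (λ xs → F xs + G xs) G) ⟨
      C m (λ xs → F xs + G xs - G xs) + C m G
        ≡⟨ cong (_+ C m G) (C-cong m λ xs → cancel (F xs) (G xs)) ⟨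
      C m F + C m G                                 ∎
      where
      open ≡-Reasoning
      cancel : ∀ a b → a ≡ a + b - b
      cancel = solve-∀
      restore : ∀ a b → a ≡ a - b + b
      restore = solve-∀

    -- Quantified over all actions and dimensions because `norm-defect` needs the same alternative
    -- in two consecutive dimensions.
    T-cases : ∀ m → (∀ {A : Set} {k} (f : A → A) (F : Cochain A k) →
                     Action.T f p (suc m) F ≡ Action.shift-1 f F)
                  ⊎ (∀ {A : Set} {k} (f : A → A) (F : Cochain A k) →
                     Action.T f p (suc m) F ≡ Action.norm f p F)
    T-cases zero          = inj₁ λ f F → refl
    T-cases (suc zero)    = inj₂ λ f F → refl
    T-cases (suc (suc m)) = T-cases m

    -- ρ only shifts the defect of evaluating a label in two consecutive dimensions, so that its sum
    -- over an orbit is a multiple of p.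
    module _ (m : ℕ) (T≡shift-1 : ∀ {A : Set} {k} (f : A → A) (F : Cochain A k) →
        Action.T f p (suc m) F ≡ Action.shift-1 f F) where

      defect : (V (suc (suc m)) → Fin p) → ℤ
      defect ℓ = C (suc (suc m)) (label (suc (suc m)) ℓ) - C (suc m) (label (suc m) (ℓ ∘ base))

      defect-ρ : ∀ {ℓ} → Equivariant ℓ → defect (ℓ ∘ ρ) ≡ defect ℓ
      defect-ρ {ℓ} equivariant = begin
        C (suc (suc m)) (label (suc (suc m)) (ℓ ∘ ρ)) - C (suc m) (label (suc m) (ℓ ∘ base ∘ ρ))
          ≡⟨ cong₂ _-_ (split (suc (suc m)) ℓ) (split (suc m) (ℓ ∘ base)) ⟩
        (C (suc (suc m)) (T p (suc m) L₂) + C (suc (suc m)) L₂) - (C (suc m) (T p (suc m) L₁) + C (suc m) L₁)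
          ≡⟨ cong (λ u → (u + C (suc (suc m)) L₂) - (C (suc m) (T p (suc m) L₁) + C (suc m) L₁))
              (C-T-label m equivariant) ⟩
        (C (suc m) (T p (suc m) L₁) + C (suc (suc m)) L₂) - (C (suc m) (T p (suc m) L₁) + C (suc m) L₁)
          ≡⟨ alg (C (suc m) (T p (suc m) L₁)) (C (suc (suc m)) L₂) (C (suc m) L₁) ⟩
        defect ℓ ∎
        where
        open ≡-Reasoning
        L₂ = label (suc (suc m)) ℓ
        L₁ = label (suc m) (ℓ ∘ base)
        alg : ∀ a b c → (a + b) - (a + c) ≡ b - c
        alg = solve-∀
        alg′ : ∀ a b → a ≡ a - b + b
        alg′ = solve-∀
        split : ∀ k (ℓ : V k → Fin p) → C k (label k (ℓ ∘ ρ)) ≡ C k (T p (suc m) (label k ℓ)) + C k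
            (label k ℓ)
        split k ℓ = begin
          C k (label k (ℓ ∘ ρ))
            ≡⟨ C-cong k (λ xs → cong (Ψ k) (Vec.map-∘ ℓ ρ xs)) ⟩
          C k (pull ρ (label k ℓ))                                   ≡⟨ alg′ _ (C k (label k ℓ)) ⟩
          C k (pull ρ (label k ℓ)) - C k (label k ℓ) + C k (label k ℓ)
            ≡⟨ cong (_+ C k (label k ℓ)) (C-minus k (pull ρ (label k ℓ)) (label k ℓ)) ⟨
          C k (shift-1 (label k ℓ)) + C k (label k ℓ)
            ≡⟨ cong (λ F → C k F + C k (label k ℓ)) (T≡shift-1 ρ (label k ℓ)) ⟨
          C k (T p (suc m) (label k ℓ)) + C k (label k ℓ)            ∎

      norm-defect : ∀ h {ℓ} → Equivariant ℓ →
        C (suc (suc m)) (norm h (label (suc (suc m)) ℓ)) ≡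
        C (suc m) (norm h (label (suc m) (ℓ ∘ base))) + ℤ.+ h * defect ℓ
      norm-defect zero {ℓ} equivariant = begin
        C (suc (suc m)) (λ _ → 0ℤ)                ≡⟨ C-vanish (suc (suc m)) (λ _ _ → refl) ⟩
        0ℤ                                        ≡⟨ C-vanish (suc m) (λ _ _ → refl) ⟨
        C (suc m) (λ _ → 0ℤ)                      ≡⟨ ℤ.+-identityʳ _ ⟨
        C (suc m) (λ _ → 0ℤ) + 0ℤ                 ≡⟨ cong (C (suc m) (λ _ → 0ℤ) +_) (ℤ.*-zeroˡ (defect ℓ)) ⟨
        C (suc m) (λ _ → 0ℤ) + 0ℤ * defect ℓ      ∎
        where open ≡-Reasoning
      norm-defect (suc h) {ℓ} equivariant = begin
        C (suc (suc m)) (norm (suc h) (label (suc (suc m)) ℓ))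
          ≡⟨ unfold (suc (suc m)) ℓ ⟩
        C (suc (suc m)) L₂ + C (suc (suc m)) (norm h (label (suc (suc m)) (ℓ ∘ ρ)))
          ≡⟨ cong (C (suc (suc m)) L₂ +_) (norm-defect h (∘ρ-equivariant equivariant)) ⟩
        C (suc (suc m)) L₂ + (N + ℤ.+ h * defect (ℓ ∘ ρ))
          ≡⟨ cong (λ u → C (suc (suc m)) L₂ + (N + ℤ.+ h * u)) (defect-ρ equivariant) ⟩
        C (suc (suc m)) L₂ + (N + ℤ.+ h * defect ℓ)
          ≡⟨ alg (C (suc (suc m)) L₂) (C (suc m) L₁) N (ℤ.+ h) ⟩
        C (suc m) L₁ + N + ℤ.+ suc h * defect ℓ
          ≡⟨ cong (_+ ℤ.+ suc h * defect ℓ) (unfold (suc m) (ℓ ∘ base)) ⟨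
        C (suc m) (norm (suc h) L₁) + ℤ.+ suc h * defect ℓ ∎
        where
        open ≡-Reasoning
        L₂ = label (suc (suc m)) ℓ
        L₁ = label (suc m) (ℓ ∘ base)
        N = C (suc m) (norm h (label (suc m) (ℓ ∘ base ∘ ρ)))
        alg : ∀ a b n h → a + (n + h * (a - b)) ≡ b + n + (1ℤ + h) * (a - b)
        alg = solve-∀
        unfold : ∀ k (ℓ : V k → Fin p) → C k (norm (suc h) (label k ℓ)) ≡ C k (label k ℓ) + C k
            (norm h (label k (ℓ ∘ ρ)))
        unfold k ℓ = trans
          (C-+ k (label k ℓ) (norm h (label k ℓ) ∘ map ρ))
          (cong (C k (label k ℓ) +_) (C-cong k λ xs → begin
            norm h (label k ℓ) (map ρ xs)        ≡⟨ norm-pull h (label k ℓ) xs ⟨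
            norm h (pull ρ (label k ℓ)) xs
              ≡⟨ norm-agree {Q = λ _ → ⊤} _ h (λ ys _ → cong (Ψ k) (Vec.map-∘ ℓ ρ ys)) xs tt ⟨
            norm h (label k (ℓ ∘ ρ)) xs          ∎))

    -- The parity of the dimension decides the step. If `T p (suc m)` is the norm, `C-T-label` is
    -- the desired equality. If it is the shift, `C-T-label` only says that the defect is invariant,
    -- and the orbit sums differ by p times the defect.
    degree : ∀ m {ℓ : V (suc m) → Fin p} → Equivariant ℓ →
             ∃[ d ] C (suc m) (norm p (label (suc m) ℓ)) ≡ 1ℤ + ℤ.+ p * d
    degree zero {ℓ} equivariant = 0ℤ , (begin
      norm p (label 1 ℓ) (apex ∷ []) - 0ℤ            ≡⟨ ℤ.+-identityʳ _ ⟩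
      norm p (label 1 ℓ) (apex ∷ [])
        ≡⟨ T-label equivariant p 2 (Ψ 1) (apex ∷ []) ([] ∷ [] , raise-NonZero [] ∷ []) ⟩
      Action.norm rot p (Ψ 1) (ℓ apex ∷ [])          ≡⟨ norm-last (ℓ apex) ⟩
      1ℤ                                             ≡⟨ cong (1ℤ +_) (ℤ.*-zeroʳ (ℤ.+ p)) ⟨
      1ℤ + ℤ.+ p * 0ℤ                                ∎)
      where open ≡-Reasoning
    degree (suc m) {ℓ} equivariant with degree m {ℓ ∘ base}
        (λ X nz → equivariant (base X) (base-NonZero {X = X} nz)) | T-cases m
    ... | d , eq | inj₁ T≡shift-1 = d + defect m T≡shift-1 ℓ , (begin
      C (suc (suc m)) (norm p (label (suc (suc m)) ℓ))
        ≡⟨ norm-defect m T≡shift-1 p equivariant ⟩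
      C (suc m) (norm p (label (suc m) (ℓ ∘ base))) + ℤ.+ p * e          ≡⟨ cong (_+ ℤ.+ p * e) eq ⟩
      1ℤ + ℤ.+ p * d + ℤ.+ p * e                                         ≡⟨ alg (ℤ.+ p) d e ⟩
      1ℤ + ℤ.+ p * (d + e)                                               ∎)
      where
      open ≡-Reasoning
      e = defect m T≡shift-1 ℓ
      alg : ∀ p d e → 1ℤ + p * d + p * e ≡ 1ℤ + p * (d + e)
      alg = solve-∀
    ... | d , eq | inj₂ T≡norm = d , (begin
      C (suc (suc m)) (norm p (label (suc (suc m)) ℓ))
        ≡⟨ cong (C (suc (suc m))) (T≡norm ρ _) ⟨
      C (suc (suc m)) (T p (suc m) (label (suc (suc m)) ℓ))              ≡⟨ C-T-label m equivariant ⟩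
      C (suc m) (T p (suc m) (label (suc m) (ℓ ∘ base)))                 ≡⟨ cong (C (suc m)) (T≡norm ρ _) ⟩
      C (suc m) (norm p (label (suc m) (ℓ ∘ base)))                      ≡⟨ eq ⟩
      1ℤ + ℤ.+ p * d                                                     ∎)
      where open ≡-Reasoning

    -- Either two neighbours share a level, hence a sign, or the level rises at each of the k steps.
    ascending : ∀ {m k} (level : V m → ℕ) (sign : V m → Fin p) {M : ℕ} →
      (∀ X → NonZero X → level X ℕ.≤ M) →
      (∀ X Y → NonZero X → X ≼ Y → level X ℕ.≤ level Y) →
      (∀ X Y → NonZero X → X ≼ Y → level X ≡ level Y → sign X ≡ sign Y) →
      ∀ X (xs : Vec (V m) k) → Chain (X ∷ xs) → Degenerate (map sign (X ∷ xs)) ⊎ level X ℕ.+ k ℕ.≤ M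
    ascending level sign bound mono same X [] (_ , z ∷ _) =
        inj₂ (subst (ℕ._≤ _) (sym (ℕ.+-identityʳ (level X))) (bound X z))
    ascending {k = suc k} level sign {M} bound mono same X (Y ∷ xs) ((X≼Y ∷ _) ∷ c , zX ∷ zs)
      with ascending level sign bound mono same Y xs (c , zs) | ℕ.m≤n⇒m<n∨m≡n (mono X Y zX X≼Y)
    ... | inj₁ d | _        = inj₁ (there _ d)
    ... | inj₂ _ | inj₂ eq  = inj₁ (subst (λ a → Degenerate (a ∷ map sign (Y ∷ xs)))
        (sym (same X Y zX X≼Y eq)) (here _ _))
    ... | inj₂ b | inj₁ X<Y = inj₂ (begin
      level X ℕ.+ suc k   ≡⟨ ℕ.+-suc (level X) k ⟩
      suc (level X) ℕ.+ k ≤⟨ ℕ.+-monoˡ-≤ k X<Y ⟩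
      level Y ℕ.+ k       ≤⟨ b ⟩
      M                   ∎)
      where open ℕ.≤-Reasoning

    Z-Tucker : ∀ {m} → 2 ℕ.≤ p → (level : V (suc m) → ℕ) (sign : V (suc m) → Fin p) →
      (∀ X → NonZero X → 1 ℕ.≤ level X) →
      (∀ X → NonZero X → level X ℕ.≤ m) →
      (∀ X Y → NonZero X → X ≼ Y → level X ℕ.≤ level Y) →
      (∀ X Y → NonZero X → X ≼ Y → level X ≡ level Y → sign X ≡ sign Y) →
      Equivariant sign → ⊥
    Z-Tucker {m} 2≤p level sign positive bound mono same equivariant with degree m equivariant
    -- From 0 = 1 + p d, the absolute value of p d is 1, which contradicts p ≥ 2.
    ... | d , eq = ℕ.<⇒≢ 2≤p (sym (ℕ.m*n≡1⇒m≡1 p ℤ.∣ d ∣ (begin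
      p ℕ.* ℤ.∣ d ∣            ≡⟨ ℤ.abs-* (ℤ.+ p) d ⟨
      ℤ.∣ ℤ.+ p * d ∣          ≡⟨ cong ℤ.∣_∣ (alg (ℤ.+ p * d)) ⟩
      ℤ.∣ 1ℤ + ℤ.+ p * d - 1ℤ ∣ ≡⟨ cong (λ u → ℤ.∣ u - 1ℤ ∣) (trans (sym eq) vanishes) ⟩
      1                        ∎)))
      where
      open ≡-Reasoning
      alg : ∀ x → x ≡ 1ℤ + x - 1ℤ
      alg = solve-∀
      Ψ-vanishes : ∀ xs → Chain xs → label (suc m) sign xs ≡ 0ℤ
      Ψ-vanishes (X ∷ xs) c@(_ , z ∷ _) with ascending level sign bound mono same X xs c
      ... | inj₁ d = Ψ-degenerate (suc m) d
      ... | inj₂ b = ⊥-elim (ℕ.<⇒≱ (ℕ.+-monoˡ-≤ m (positive X z)) b)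
      vanishes : C (suc m) (norm p (label (suc m) sign)) ≡ 0ℤ
      vanishes = C-vanish (suc m) λ xs c → trans
        (norm-agree ρ-Chain p {G = λ _ → 0ℤ} Ψ-vanishes xs c) (norm-zero p xs)
        where
        norm-zero : ∀ {k} h (xs : Vec (V (suc m)) k) → norm h (λ _ → 0ℤ) xs ≡ 0ℤ
        norm-zero zero    xs = refl
        norm-zero (suc h) xs = trans (ℤ.+-identityˡ _) (norm-zero h (map ρ xs))

open Topology using (iter; module Sphere)

open import Algebra.Properties.CommutativeMonoid.Sum ℕ.+-0-commutativeMonoid
  using (sum; sum-cong-≗; ∑-distrib-+; ∑-comm; sum-init-last)
open import Data.Fin.Subset using (_∈_; _∉_; _⊆_; _∩_; _─_; ⊤; ∁; inside; outside) renaming (⊥ to ∅)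
open import Data.Fin.Subset.Properties as Sub using (_∈?_)
open import Data.List.Base as List using (List; []; _∷_)
open import Data.List.Relation.Binary.Pointwise as Pointwise using (Pointwise; []; _∷_)
open import Data.List.Relation.Unary.Any using (Any; here; there)
import Data.List.Relation.Unary.Any.Properties as Any
open import Data.Nat.Base using (_+_; _*_; _⊓_; nonTrivial⇒n>1; n>1⇒nonTrivial; >-nonZero)
open import Data.Nat.Coprimality using (Coprime; coprime-Bézout)
open import Data.Nat.Divisibility using (_∣_; _∣?_)
import Data.Nat.Divisibility as ℕ
open import Data.Nat.GCD using (module Bézout)
open import Data.Nat.Induction using (<-rec)
open import Data.Nat.Primality
  using (Prime; prime?; composite; prime⇒irreducible; prime⇒nonTrivial; ¬prime[0]; ¬prime⇒composite)
open import Data.Nat.Tactic.RingSolver using (solve-∀)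

-- Finite sums and counting of points

sum-mono : ∀ {n} {f g : Fin n → ℕ} → (∀ i → f i ≤ g i) → sum f ≤ sum g
sum-mono {zero}  f≤g = z≤n
sum-mono {suc n} f≤g = ℕ.+-mono-≤ (f≤g zero) (sum-mono (f≤g ∘ suc))

+-squeeze : ∀ {a b c d} → a ≤ b → c ≤ d → a + c ≡ b + d → a ≡ b × c ≡ d
+-squeeze {a} {b} {c} {d} a≤b c≤d eq with ℕ.m≤n⇒m<n∨m≡n a≤b
... | inj₁ a<b  = ⊥-elim (ℕ.<⇒≢ (ℕ.+-mono-<-≤ a<b c≤d) eq)
... | inj₂ refl = refl , ℕ.+-cancelˡ-≡ a c d eq

-- The tool for constant level: summands that can only grow cannot change while their sum is fixed.
sum-squeeze : ∀ {n} {f g : Fin n → ℕ} → (∀ i → f i ≤ g i) → sum f ≡ sum g → ∀ i → f i ≡ g i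
sum-squeeze {suc n} f≤g eq i with +-squeeze (f≤g zero) (sum-mono (f≤g ∘ suc)) eq
sum-squeeze {suc n} f≤g eq zero    | eq₀ , _  = eq₀
sum-squeeze {suc n} f≤g eq (suc i) | _ , eqs = sum-squeeze (f≤g ∘ suc) eqs i

sum-mono-< : ∀ {m} {f g : Fin m → ℕ} → (∀ i → f i ≤ g i) → ∀ k → f k < g k → sum f < sum g
sum-mono-< f≤g k fk<gk = ℕ.≤∧≢⇒< (sum-mono f≤g) λ eq → ℕ.<⇒≢ fk<gk (sum-squeeze f≤g eq k)

term≤sum : ∀ {n} (f : Fin n → ℕ) i → f i ≤ sum f
term≤sum f zero    = ℕ.m≤m+n (f zero) _
term≤sum f (suc i) = ℕ.≤-trans (term≤sum (f ∘ suc) i) (ℕ.m≤n+m _ (f zero))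

sum-const : ∀ n c → sum {n} (λ _ → c) ≡ n * c
sum-const zero    c = refl
sum-const (suc n) c = cong (c +_) (sum-const n c)

sum-bounded : ∀ {n} {f : Fin n → ℕ} c → (∀ i → f i ≤ c) → sum f ≤ n * c
sum-bounded {n} c f≤c = ℕ.≤-trans (sum-mono f≤c) (ℕ.≤-reflexive (sum-const n c))

sum-++ : ∀ m {n} (f : Fin (m + n) → ℕ) → sum f ≡ sum (f ∘ (_↑ˡ n)) + sum (f ∘ (m ↑ʳ_))
sum-++ zero    f = refl
sum-++ (suc m) f = trans (cong (f zero +_) (sum-++ m (f ∘ suc))) (sym (ℕ.+-assoc (f zero) _ _))

sum-combine : ∀ m {n} (f : Fin (m * n) → ℕ) → sum f ≡ sum (λ i → sum (λ j → f (combine {m} i j)))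
sum-combine zero        f = refl
sum-combine (suc m) {n} f = trans (sum-++ n f)
    (cong (sum (f ∘ (_↑ˡ (m * n))) +_) (sum-combine m (f ∘ (n ↑ʳ_))))

sum-tabulate : ∀ {n} (f : Fin n → ℕ) → Vec.sum (tabulate f) ≡ sum f
sum-tabulate {zero}  f = refl
sum-tabulate {suc n} f = cong (f zero +_) (sum-tabulate (f ∘ suc))

𝟙 : Bool → ℕ
𝟙 b = if b then 1 else 0

𝟙-yes : {P : Set} (P? : Dec P) → P → 𝟙 (does P?) ≡ 1
𝟙-yes P? p = cong 𝟙 (dec-true P? p)

𝟙-no : {P : Set} (P? : Dec P) → ¬ P → 𝟙 (does P?) ≡ 0
𝟙-no P? ¬p = cong 𝟙 (dec-false P? ¬p)

𝟙-mono : {P Q : Set} (P? : Dec P) (Q? : Dec Q) → (P → Q) → 𝟙 (does P?) ≤ 𝟙 (does Q?)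
𝟙-mono (no _)  Q? f = z≤n
𝟙-mono (yes p) Q? f = ℕ.≤-reflexive (sym (𝟙-yes Q? (f p)))

𝟙-≤1 : ∀ b → 𝟙 b ≤ 1
𝟙-≤1 false = z≤n
𝟙-≤1 true  = s≤s z≤n

sum-𝟙-unique : ∀ {n} (k : Fin n) → sum (λ i → 𝟙 (does (i Fin.≟ k))) ≡ 1
sum-𝟙-unique {suc n} zero    = cong suc (trans
    (sum-cong-≗ {n} (λ i → 𝟙-no (suc i Fin.≟ zero) λ ())) (trans (sum-const n 0) (ℕ.*-zeroʳ n)))
sum-𝟙-unique {suc n} (suc k) = trans (cong₂ _+_ (𝟙-no (zero Fin.≟ suc k) λ ())
  (sum-cong-≗ {n} λ i → ℕ.≤-antisym (𝟙-mono (suc i Fin.≟ suc k) (i Fin.≟ k) Fin.suc-injective)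
                                    (𝟙-mono (i Fin.≟ k) (suc i Fin.≟ suc k) (cong suc)))) (sum-𝟙-unique k)

module _ {n : ℕ} where

  ⟪_⟫ : {P : Fin n → Set} → (∀ x → Dec (P x)) → Subset n
  ⟪ P? ⟫ = tabulate (λ x → does (P? x))

  ∈⟪⟫⁺ : {P : Fin n → Set} (P? : ∀ x → Dec (P x)) → ∀ {x} → P x → x ∈ ⟪ P? ⟫
  ∈⟪⟫⁺ P? {x} p = Vec.lookup⇒[]= x ⟪ P? ⟫ (trans (Vec.lookup∘tabulate _ x) (dec-true (P? x) p))

  ∈⟪⟫⁻ : {P : Fin n → Set} (P? : ∀ x → Dec (P x)) → ∀ {x} → x ∈ ⟪ P? ⟫ → P x
  ∈⟪⟫⁻ P? {x} x∈ with P? x in eq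
  ... | yes p = p
  ... | no _ with () ← trans (sym (Vec.[]=⇒lookup x∈)) (trans (Vec.lookup∘tabulate _ x) (cong does eq))

  mem : Subset n → Fin n → ℕ
  mem A x = 𝟙 (does (x ∈? A))

  mem-mono : {A B : Subset n} (x : Fin n) → (x ∈ A → x ∈ B) → mem A x ≤ mem B x
  mem-mono {A} {B} x = 𝟙-mono (x ∈? A) (x ∈? B)

∣∣-sum : ∀ {n} (A : Subset n) → ∣ A ∣ ≡ sum (mem A)
∣∣-sum {zero}  []            = refl
∣∣-sum {suc n} (inside ∷ A)  = cong suc (trans (∣∣-sum A) (sum-cong-≗ {n} λ x → ℕ.≤-antisym
  (𝟙-mono (x ∈? A) (suc x ∈? (inside ∷ A)) there) (𝟙-mono (suc x ∈? (inside ∷ A)) (x ∈? A) Sub.drop-there)))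
∣∣-sum {suc n} (outside ∷ A) = trans (∣∣-sum A) (sum-cong-≗ {n} λ x → ℕ.≤-antisym
  (𝟙-mono (x ∈? A) (suc x ∈? (outside ∷ A)) there) (𝟙-mono (suc x ∈? (outside ∷ A)) (x ∈? A) Sub.drop-there))

module _ {n : ℕ} where

  ∣∣-≤-sum : ∀ {l} (A : Subset n) (B : Fin l → Subset n) →
             (∀ x → x ∈ A → ∃[ j ] x ∈ B j) → ∣ A ∣ ≤ sum (λ j → ∣ B j ∣)
  ∣∣-≤-sum {l} A B cover = begin
    ∣ A ∣                              ≡⟨ ∣∣-sum A ⟩
    sum (mem A)                        ≤⟨ sum-mono pointwise ⟩
    sum (λ x → sum (λ j → mem (B j) x)) ≡⟨ ∑-comm {n} {l} (λ x j → mem (B j) x) ⟩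
    sum (λ j → sum (λ x → mem (B j) x)) ≡⟨ sum-cong-≗ {l} (λ j → ∣∣-sum (B j)) ⟨
    sum (λ j → ∣ B j ∣)                ∎
    where
    open ℕ.≤-Reasoning
    pointwise : ∀ x → mem A x ≤ sum (λ j → mem (B j) x)
    pointwise x with x ∈? A
    ... | no _  = z≤n
    ... | yes a with j , b ← cover x a = ℕ.≤-trans (ℕ.≤-reflexive (sym (𝟙-yes (x ∈? B j) b)))
                                                  (term≤sum (λ j → mem (B j) x) j)

  sum-≤-∣∣ : ∀ {l} (A : Subset n) (B : Fin l → Subset n) → (∀ j → B j ⊆ A) →
             (∀ i j → i ≢ j → ∀ x → x ∈ B i → x ∉ B j) → sum (λ j → ∣ B j ∣) ≤ ∣ A ∣
  sum-≤-∣∣ {l} A B B⊆A disjoint = begin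
    sum (λ j → ∣ B j ∣)                ≡⟨ sum-cong-≗ {l} (λ j → ∣∣-sum (B j)) ⟩
    sum (λ j → sum (λ x → mem (B j) x)) ≡⟨ ∑-comm {l} {n} (λ j x → mem (B j) x) ⟩
    sum (λ x → sum (λ j → mem (B j) x)) ≤⟨ sum-mono pointwise ⟩
    sum (mem A)                        ≡⟨ ∣∣-sum A ⟨
    ∣ A ∣                              ∎
    where
    open ℕ.≤-Reasoning
    pointwise : ∀ x → sum (λ j → mem (B j) x) ≤ mem A x
    pointwise x with Fin.any? (λ j → x ∈? B j)
    ... | yes (k , b) = begin
      sum (λ j → mem (B j) x)           ≤⟨ sum-mono (λ j → 𝟙-mono (x ∈? B j) (j Fin.≟ k) (only j)) ⟩
      sum (λ j → 𝟙 (does (j Fin.≟ k)))  ≡⟨ sum-𝟙-unique k ⟩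
      1                                 ≡⟨ 𝟙-yes (x ∈? A) (B⊆A k b) ⟨
      mem A x                           ∎
      where
      only : ∀ j → x ∈ B j → j ≡ k
      only j b′ with j Fin.≟ k
      ... | yes eq = eq
      ... | no  ne = ⊥-elim (disjoint j k ne x b′ b)
    ... | no none = begin
      sum (λ j → mem (B j) x)           ≡⟨ sum-cong-≗ {l} (λ j → 𝟙-no (x ∈? B j) (λ b → none (j , b))) ⟩
      sum {l} (λ _ → 0)                 ≡⟨ trans (sum-const l 0) (ℕ.*-zeroʳ l) ⟩
      0                                 ≤⟨ z≤n ⟩
      mem A x                           ∎

  ⊆-squeeze : {A B : Subset n} → A ⊆ B → ∣ B ∣ ≤ ∣ A ∣ → B ⊆ A
  ⊆-squeeze {A} {B} A⊆B B≤A {x} x∈B with x ∈? A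
  ... | yes x∈A = x∈A
  ... | no  x∉A = ⊥-elim (ℕ.<⇒≱ (Sub.p⊂q⇒∣p∣<∣q∣ (A⊆B , x , x∈B , x∉A)) B≤A)

  ∣∣-nonempty : {A : Subset n} → Nonempty A → 1 ≤ ∣ A ∣
  ∣∣-nonempty {A} (x , x∈A) = begin
    1           ≡⟨ 𝟙-yes (x ∈? A) x∈A ⟨
    mem A x     ≤⟨ term≤sum (mem A) x ⟩
    sum (mem A) ≡⟨ ∣∣-sum A ⟨
    ∣ A ∣       ∎
    where open ℕ.≤-Reasoning

  ∣∣-empty : {A : Subset n} → ¬ Nonempty A → ∣ A ∣ ≡ 0
  ∣∣-empty {A} e = trans (cong ∣_∣ (Sub.Empty-unique e)) (Sub.∣⊥∣≡0 n)

  ∣∣-unique : {A : Subset n} → (∀ x y → x ∈ A → y ∈ A → x ≡ y) → ∣ A ∣ ≤ 1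
  ∣∣-unique {A} unique with Sub.nonempty? A
  ... | no  e = subst (_≤ 1) (sym (∣∣-empty e)) z≤n
  ... | yes (y , y∈A) = begin
    ∣ A ∣                            ≡⟨ ∣∣-sum A ⟩
    sum (mem A)
      ≤⟨ sum-mono (λ x → 𝟙-mono (x ∈? A) (x Fin.≟ y) λ x∈A → unique x y x∈A y∈A) ⟩
    sum (λ x → 𝟙 (does (x Fin.≟ y))) ≡⟨ sum-𝟙-unique y ⟩
    1                                ∎
    where open ℕ.≤-Reasoning

  x∈p─q⁻ : ∀ {x} (A B : Subset n) → x ∈ A ─ B → x ∈ A × x ∉ B
  x∈p─q⁻ A B x∈ = Sub.p─q⊆p A B x∈ , go A B x∈
    where
    go : ∀ {n} {x : Fin n} (A B : Subset n) → x ∈ A ─ B → x ∉ B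
    go (_ ∷ A) (inside ∷ B)  (there x∈) (there y) = go A B x∈ y
    go (_ ∷ A) (outside ∷ B) (there x∈) (there y) = go A B x∈ y

  ∣∣-≤-+ : (A B D : Subset n) → (∀ x → x ∈ A → x ∈ B ⊎ x ∈ D) → ∣ A ∣ ≤ ∣ B ∣ + ∣ D ∣
  ∣∣-≤-+ A B D cover = ℕ.≤-trans (∣∣-≤-sum A B⊔D (λ x a → covered (cover x a)))
    (ℕ.≤-reflexive (cong (∣ B ∣ +_) (ℕ.+-identityʳ ∣ D ∣)))
    where
    B⊔D : Fin 2 → Subset n
    B⊔D zero    = B
    B⊔D (suc _) = D
    covered : ∀ {x} → x ∈ B ⊎ x ∈ D → ∃[ j ] x ∈ B⊔D j
    covered (inj₁ b) = zero , b
    covered (inj₂ d) = suc zero , d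

subset-of-size : ∀ {n} (A : Subset n) k → k ≤ ∣ A ∣ → ∃[ B ] (B ⊆ A × ∣ B ∣ ≡ k)
subset-of-size []            zero    _       = [] , (λ ()) , refl
subset-of-size (outside ∷ A) k       k≤      with B , B⊆A , eq ← subset-of-size A k k≤ =
  outside ∷ B , Sub.s⊆s B⊆A , eq
subset-of-size (inside ∷ A)  zero    _       with B , B⊆A , eq ← subset-of-size A zero z≤n =
  outside ∷ B , Sub.out⊆ B⊆A , eq
subset-of-size (inside ∷ A)  (suc k) (s≤s k≤) with B , B⊆A , eq ← subset-of-size A k k≤ =
  inside ∷ B , Sub.s⊆s B⊆A , cong suc eq

sum-positive : ∀ {m} (f : Fin m → ℕ) → 1 ≤ sum f → ∃[ i ] 1 ≤ f i
sum-positive {suc m} f le with f zero in eq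
... | suc _ = zero , subst (1 ≤_) (sym eq) (s≤s z≤n)
... | zero with i , fi ← sum-positive (f ∘ suc) le = suc i , fi

-- The order is a parameter so that one recursion serves both `least` and `greatest`.
extremum : ∀ {_≤′_ : ℕ → ℕ → Set} → (∀ {a b c} → a ≤′ b → b ≤′ c → a ≤′ c) → (∀ a b → a ≤′ b ⊎ b ≤′ a) →
           ∀ {m} (f : Fin (suc m) → ℕ) → ∃[ i ] ∀ j → f i ≤′ f j
extremum transitive total {zero} f = zero , λ { zero → Sum.reduce (total (f zero) (f zero)) }
extremum {_≤′_} transitive total {suc m} f with extremum {_≤′_} transitive total (f ∘ suc)
... | i , i≤ with total (f zero) (f (suc i))
...   | inj₁ p = zero , λ { zero → Sum.reduce (total (f zero) (f zero)) ; (suc j) → transitive p (i≤ j) }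
...   | inj₂ p = suc i , λ { zero → p ; (suc j) → i≤ j }

private variable n l r : ℕ

-- Blocks, stable sets and transversals

-- A partition is given by its block map: disjointness and covering are automatic, and empty blocks
-- are allowed, as they can arise when blocks are split.
fibre : (Fin n → Fin l) → Fin l → Subset n
fibre π j = ⟪ (λ x → π x Fin.≟ j) ⟫

∈fibre⁺ : ∀ (π : Fin n → Fin l) {j x} → π x ≡ j → x ∈ fibre π j
∈fibre⁺ π {j} = ∈⟪⟫⁺ (λ x → π x Fin.≟ j)

∈fibre⁻ : ∀ (π : Fin n → Fin l) {j x} → x ∈ fibre π j → π x ≡ j
∈fibre⁻ π {j} = ∈⟪⟫⁻ (λ x → π x Fin.≟ j)

∈∩fibre⁺ : ∀ (π : Fin n → Fin l) {A x} → x ∈ A → x ∈ A ∩ fibre π (π x)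
∈∩fibre⁺ π x∈A = Sub.x∈p∩q⁺ (x∈A , ∈fibre⁺ π refl)

∈∩fibre⁻ : ∀ (π : Fin n → Fin l) {A j x} → x ∈ A ∩ fibre π j → x ∈ A × π x ≡ j
∈∩fibre⁻ π {A} {j} x∈ with a , f ← Sub.x∈p∩q⁻ A (fibre π j) x∈ = a , ∈fibre⁻ π f

∩fibre-mono : ∀ (π : Fin n → Fin l) {A B} → A ⊆ B → ∀ j → A ∩ fibre π j ⊆ B ∩ fibre π j
∩fibre-mono π A⊆B j x∈ with a , f ← Sub.x∈p∩q⁻ _ (fibre π j) x∈ = Sub.x∈p∩q⁺ (A⊆B a , f)

∣∣-≤-sum-fibres : ∀ (π : Fin n → Fin l) A → ∣ A ∣ ≤ sum (λ j → ∣ A ∩ fibre π j ∣)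
∣∣-≤-sum-fibres π A = ∣∣-≤-sum A (λ j → A ∩ fibre π j) (λ x a → π x , ∈∩fibre⁺ π a)

sum-fibres-≤-∣∣ : ∀ (π : Fin n → Fin l) A → sum (λ j → ∣ A ∩ fibre π j ∣) ≤ ∣ A ∣
sum-fibres-≤-∣∣ π A = sum-≤-∣∣ A (λ j → A ∩ fibre π j) (λ j → Sub.p∩q⊆p A _)
  (λ i j i≢j x x∈i x∈j → i≢j (trans (sym (proj₂ (∈∩fibre⁻ π x∈i))) (proj₂ (∈∩fibre⁻ π x∈j))))

Stable : (Fin n → Fin l) → ℕ → Subset n → Set
Stable π h A = sum (λ j → ∣ A ∩ fibre π j ∣ ∸ 1) ≤ h

Transversal : (Fin n → Fin l) → Subset n → Set
Transversal π A = ∀ j → ∣ A ∩ fibre π j ∣ ≤ 1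

-- In each block `A` contains at most one point of `F`, so the excess over one is paid for by
-- `F ─ A`. Thus members of the family near a transversal are vertices and have a colour.
near-transversal⇒stable : ∀ (π : Fin n → Fin l) {h} (A F : Subset n) → Transversal π A → ∣ F ─ A ∣ ≤ h →
    Stable π h F
near-transversal⇒stable π {h} A F trans-A F─A≤h = begin
  sum (λ j → ∣ F ∩ fibre π j ∣ ∸ 1)        ≤⟨ sum-mono (λ j → ℕ.m≤n+o⇒m∸n≤o _ 1 (split j)) ⟩
  sum (λ j → ∣ (F ─ A) ∩ fibre π j ∣)      ≤⟨ sum-fibres-≤-∣∣ π (F ─ A) ⟩
  ∣ F ─ A ∣                                ≤⟨ F─A≤h ⟩
  h                                        ∎
  where
  open ℕ.≤-Reasoning
  split : ∀ j → ∣ F ∩ fibre π j ∣ ≤ 1 + ∣ (F ─ A) ∩ fibre π j ∣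
  split j = ℕ.≤-trans
    (∣∣-≤-+ (F ∩ fibre π j) (A ∩ fibre π j) ((F ─ A) ∩ fibre π j) cover)
    (ℕ.+-monoˡ-≤ _ (trans-A j))
    where
    cover : ∀ x → x ∈ F ∩ fibre π j → x ∈ A ∩ fibre π j ⊎ x ∈ (F ─ A) ∩ fibre π j
    cover x x∈ with Sub.x∈p∩q⁻ F (fibre π j) x∈ | x ∈? A
    ... | f , p | yes a  = inj₁ (Sub.x∈p∩q⁺ (a , p))
    ... | f , p | no  ¬a = inj₂ (Sub.x∈p∩q⁺ (Sub.x∈p∧x∉q⇒x∈p─q f ¬a , p))

meets : (Fin n → Fin l) → Subset n → Fin l → ℕ
meets π A j = 𝟙 (does (Sub.nonempty? (A ∩ fibre π j)))

∃-transversal : ∀ (π : Fin n → Fin l) U → ∃[ A ] (A ⊆ U × Transversal π A × sum (meets π U) ≤ ∣ A ∣)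
∃-transversal {n} {l} π U = A , A⊆U , transversal , large
  where
  -- The representative of a block is the witness returned by `Sub.nonempty?`; it depends on the
  -- block alone.
  Chosen : Fin l → Fin n → Set
  Chosen j x with Sub.nonempty? (U ∩ fibre π j)
  ... | yes (y , _) = x ≡ y
  ... | no  _       = ⊥
  chosen? : ∀ j x → Dec (Chosen j x)
  chosen? j x with Sub.nonempty? (U ∩ fibre π j)
  ... | yes (y , _) = x Fin.≟ y
  ... | no  _       = no λ ()
  chosen-∈ : ∀ j {x} → Chosen j x → x ∈ U ∩ fibre π j
  chosen-∈ j c with Sub.nonempty? (U ∩ fibre π j)
  chosen-∈ j refl | yes (_ , y∈) = y∈
  chosen-unique : ∀ j {x y} → Chosen j x → Chosen j y → x ≡ y
  chosen-unique j c c′ with Sub.nonempty? (U ∩ fibre π j)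
  chosen-unique j refl refl | yes _ = refl
  chosen-exists : ∀ j → Nonempty (U ∩ fibre π j) → ∃[ x ] Chosen j x
  chosen-exists j ne with Sub.nonempty? (U ∩ fibre π j)
  ... | yes (y , _) = y , refl
  ... | no  e       = ⊥-elim (e ne)
  A : Subset n
  A = ⟪ (λ x → chosen? (π x) x) ⟫
  A⊆U : A ⊆ U
  A⊆U x∈A = proj₁ (∈∩fibre⁻ π (chosen-∈ _ (∈⟪⟫⁻ (λ x → chosen? (π x) x) x∈A)))
  transversal : Transversal π A
  transversal j = ∣∣-unique unique
    where
    unique : ∀ x y → x ∈ A ∩ fibre π j → y ∈ A ∩ fibre π j → x ≡ y
    unique x y x∈ y∈ with ∈∩fibre⁻ π x∈ | ∈∩fibre⁻ π y∈
    ... | a , refl | b , eq = chosen-unique (π x) (∈⟪⟫⁻ (λ x → chosen? (π x) x) a)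
      (subst (λ k → Chosen k y) eq (∈⟪⟫⁻ (λ x → chosen? (π x) x) b))
  meets≤ : ∀ j → meets π U j ≤ ∣ A ∩ fibre π j ∣
  meets≤ j with Sub.nonempty? (U ∩ fibre π j)
  ... | no _ = z≤n
  ... | yes ne with chosen-exists j ne
  ...   | x , c with ∈∩fibre⁻ π (chosen-∈ j c)
  ...     | _ , refl = ∣∣-nonempty (x , ∈∩fibre⁺ π (∈⟪⟫⁺ (λ x → chosen? (π x) x) c))
  large : sum (meets π U) ≤ ∣ A ∣
  large = ℕ.≤-trans (sum-mono meets≤) (sum-fibres-≤-∣∣ π A)

-- Good partitions and monochromatic edges, with their decidability

-- The topological argument only refutes that both alternatives fail; exhaustive search turns this
-- into a disjunction. Tuples are stored as vectors, since a search through functions finds them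
-- only up to pointwise equality.
Searchable : Set → Set₁
Searchable A = ∀ {P : A → Set} → (∀ a → Dec (P a)) → Dec (∃[ a ] P a)

search-Vec : {A : Set} → Searchable A → ∀ r → Searchable (Vec A r)
search-Vec search zero    P? = map′ ([] ,_) (λ { ([] , p) → p }) (P? [])
search-Vec search (suc r) P? = map′ (λ { (a , as , p) → a ∷ as , p }) (λ { (a ∷ as , p) → a , as , p })
  (search λ a → search-Vec search r λ as → P? (a ∷ as))

search-Subset : Searchable (Subset n)
search-Subset = Sub.anySubset?

module _ {n : ℕ} (𝓕 : Family n) where

  -- `F ─ U` is the smallest exceptional set that could witness `F ⊆[ h ] U`, so that no quantifier
  -- over exceptional sets remains.
  Free : ℕ → Subset n → Set
  Free h U = ¬ (∃[ F ] (𝓕 F ≡ true × ∣ F ─ U ∣ ≤ h))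

  -- The points of `N` left over play the part of X₀. `large` bounds their number by (r - 1) t in
  -- additive form, so that losses can be added up when parts are partitioned again.
  record IsGood (h t : ℕ) (N : Subset n) {r : ℕ} (X : Fin r → Subset n) : Set where
    field
      within    : ∀ i → X i ⊆ N
      disjoint  : ∀ i j → i ≢ j → ∀ x → x ∈ X i → x ∉ X j
      equitable : ∀ i j → ∣ X i ∣ ≤ suc ∣ X j ∣
      free      : ∀ i → Free h (X i)
      large     : ∣ N ∣ ≤ sum (λ i → ∣ X i ∣) + (r ∸ 1) * t

  Good : ℕ → ℕ → (r : ℕ) → Subset n → Set
  Good h t r N = Σ[ X ∈ Vec (Subset n) r ] IsGood h t N (lookup X)

  module _ {h t : ℕ} {N : Subset n} {r : ℕ} where

    isGood? : (X : Fin r → Subset n) → Dec (IsGood h t N X)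
    isGood? X = map′
      (λ { (a , b , c , d , e) → record { within = a ; disjoint = b ; equitable = c ; free = d ; large = e }
          })
      (λ g → let open IsGood g in within , disjoint , equitable , free , large)
      (Fin.all? (λ i → X i Sub.⊆? N)
        ×-dec Fin.all? (λ i → Fin.all? λ j → ¬? (i Fin.≟ j) →-dec Fin.all? λ x → x ∈? X i →-dec ¬? (x ∈? X j))
        ×-dec Fin.all? (λ i → Fin.all? λ j → ∣ X i ∣ ℕ.≤? suc ∣ X j ∣)
        ×-dec Fin.all? (λ i → ¬? (search-Subset λ F → (𝓕 F Bool.≟ true) ×-dec (∣ F ─ X i ∣ ℕ.≤? h)))
        ×-dec (∣ N ∣ ℕ.≤? _))

    abstract
      good? : Dec (Good h t r N)
      good? = search-Vec search-Subset r (λ X → isGood? (lookup X))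

    good : (X : Fin r → Subset n) → IsGood h t N X → Good h t r N
    good X g = tabulate X , record
      { within    = λ i → subst (_⊆ N) (sym (eq i)) (within i)
      ; disjoint  = λ i j i≢j x x∈i x∈j → disjoint i j i≢j x (subst (x ∈_) (eq i) x∈i)
          (subst (x ∈_) (eq j) x∈j)
      ; equitable = λ i j → subst₂ (λ A B → ∣ A ∣ ≤ suc ∣ B ∣) (sym (eq i)) (sym (eq j)) (equitable i j)
      ; free      = λ i → subst (Free h) (sym (eq i)) (free i)
      ; large     = subst (λ u → ∣ N ∣ ≤ u + (r ∸ 1) * t) (sum-cong-≗ {r} λ i → cong ∣_∣ (sym (eq i))) large
      }
      where
      open IsGood g
      eq : ∀ i → lookup (tabulate X) i ≡ X i
      eq = Vec.lookup∘tabulate X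

  Vertex : (Fin n → Fin l) → ℕ → Subset n → Set
  Vertex π h A = 𝓕 A ≡ true × Stable π h A

  vertex? : ∀ (π : Fin n → Fin l) h A → Dec (Vertex π h A)
  vertex? π h A = (𝓕 A Bool.≟ true) ×-dec (_ ℕ.≤? h)

  -- Distinctness of the sets follows from `small-∩`, since members of the family have more than s
  -- points.
  record IsMono (π : Fin n → Fin l) (s : ℕ) (c : Subset n → ℕ) (N : Subset n) {r : ℕ} (e : Fin r → Subset n) :
      Set where
    field
      vertex  : ∀ i → Vertex π ⌊ s /2⌋ (e i)
      near    : ∀ i → ∣ e i ─ N ∣ ≤ ⌊ s /2⌋
      small-∩ : ∀ i j → i ≢ j → ∣ e i ∩ e j ∣ ≤ s
      mono    : ∀ i j → c (e i) ≡ c (e j)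

  Mono : (Fin n → Fin l) → ℕ → (Subset n → ℕ) → (r : ℕ) → Subset n → Set
  Mono π s c r N = Σ[ e ∈ Vec (Subset n) r ] IsMono π s c N (lookup e)

  module _ {π : Fin n → Fin l} {s : ℕ} {c : Subset n → ℕ} {r : ℕ} {N : Subset n} where

    abstract
      mono? : Dec (Mono π s c r N)
      mono? = search-Vec search-Subset r λ v → let e = lookup v in map′
        (λ { (a , b , c , d) → record { vertex = a ; near = b ; small-∩ = c ; mono = d } })
        (λ m → let open IsMono m in vertex , near , small-∩ , mono)
        (Fin.all? (λ i → vertex? π _ (e i))
          ×-dec Fin.all? (λ i → ∣ e i ─ N ∣ ℕ.≤? _)
          ×-dec Fin.all? (λ i → Fin.all? λ j → ¬? (i Fin.≟ j) →-dec (∣ e i ∩ e j ∣ ℕ.≤? s))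
          ×-dec Fin.all? (λ i → Fin.all? λ j → c (e i) ℕ.≟ c (e j)))

    mono-edge : (e : Fin r → Subset n) → IsMono π s c N e → Mono π s c r N
    mono-edge e m = tabulate e , record
      { vertex  = λ i → subst (Vertex π _) (sym (eq i)) (vertex i)
      ; near    = λ i → subst (λ A → ∣ A ─ N ∣ ≤ _) (sym (eq i)) (near i)
      ; small-∩ = λ i j i≢j → subst₂ (λ A B → ∣ A ∩ B ∣ ≤ s) (sym (eq i)) (sym (eq j)) (small-∩ i j i≢j)
      ; mono    = λ i j → trans (cong c (eq i)) (trans (mono i j) (cong c (sym (eq j))))
      }
      where
      open IsMono m
      eq : ∀ i → lookup (tabulate e) i ≡ e i
      eq = Vec.lookup∘tabulate e

-- Edges need to lie in the ground set N only up to ⌊ s /2⌋ elements: then edges found in disjoint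
-- ground sets can be joined, and freeness does not refer to N.
Theorem : ℕ → Set
Theorem r = ∀ {n l} (𝓕 : Family n) (π : Fin n → Fin l) (N : Subset n) (s t : ℕ) (c : Subset n → ℕ) →
  (∀ j → ∣ N ∩ fibre π j ∣ ≤ r) →
  (∀ F → 𝓕 F ≡ true → s < ∣ F ∣) →
  (∀ A → Vertex 𝓕 π ⌊ s /2⌋ A → c A < t) →
  Mono 𝓕 π s c r N ⊎ Good 𝓕 ⌊ s /2⌋ t r N

empty-good : ∀ {n} (𝓕 : Family n) {h t r N} → (∀ F → 𝓕 F ≡ true → h < ∣ F ∣) → ∣ N ∣ ≤ (r ∸ 1) * t →
    Good 𝓕 h t r N
empty-good {n} 𝓕 {h} {t} {r} {N} 𝓕-large N≤ = good 𝓕 {r = r} (λ _ → ∅) record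
  { within    = λ _ x∈ → ⊥-elim (Sub.∉⊥ x∈)
  ; disjoint  = λ _ _ _ _ x∈ _ → Sub.∉⊥ x∈
  ; equitable = λ _ _ → ℕ.n≤1+n _
  ; free      = λ { _ (F , F∈𝓕 , near) → ℕ.<⇒≱ (𝓕-large F F∈𝓕) (subst (λ A → ∣ A ∣ ≤ h) (Sub.p─⊥≡p F) near) }
  ; large     = ℕ.≤-trans N≤ (ℕ.m≤n+m _ (sum {r} (λ _ → ∣ ∅ {n} ∣)))
  }

⌊s/2⌋<∣F∣ : ∀ {n} {𝓕 : Family n} {s} → (∀ F → 𝓕 F ≡ true → s < ∣ F ∣) → ∀ F → 𝓕 F ≡ true → ⌊ s /2⌋ < ∣ F ∣
⌊s/2⌋<∣F∣ {s = s} 𝓕-large F F∈𝓕 = ℕ.≤-<-trans (ℕ.⌊n/2⌋≤n s) (𝓕-large F F∈𝓕)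

─-antimono : ∀ {n} (F : Subset n) {A B} → A ⊆ B → ∣ F ─ B ∣ ≤ ∣ F ─ A ∣
─-antimono F {A} {B} A⊆B = Sub.p⊆q⇒∣p∣≤∣q∣ λ x∈ → let f , ¬b = x∈p─q⁻ F B x∈ in Sub.x∈p∧x∉q⇒x∈p─q f (¬b ∘ A⊆B)

half-+-half : ∀ s → ⌊ s /2⌋ + ⌊ s /2⌋ ≤ s
half-+-half zero          = z≤n
half-+-half (suc zero)    = z≤n
half-+-half (suc (suc s)) = s≤s (subst (_≤ suc s) (sym (ℕ.+-suc ⌊ s /2⌋ ⌊ s /2⌋)) (s≤s (half-+-half s)))

-- A common point misses `C` or `D`, hence lies in one of two remainders of at most ⌊s/2⌋ points
-- each.
near-disjoint : ∀ {n} s (A B : Subset n) {C D : Subset n} → (∀ x → x ∈ C → x ∉ D) →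
                ∣ A ─ C ∣ ≤ ⌊ s /2⌋ → ∣ B ─ D ∣ ≤ ⌊ s /2⌋ → ∣ A ∩ B ∣ ≤ s
near-disjoint s A B {C} {D} disjoint a b =
  ℕ.≤-trans (∣∣-≤-+ (A ∩ B) (A ─ C) (B ─ D) cover) (ℕ.≤-trans (ℕ.+-mono-≤ a b) (half-+-half s))
  where
  cover : ∀ x → x ∈ A ∩ B → x ∈ A ─ C ⊎ x ∈ B ─ D
  cover x x∈ with Sub.x∈p∩q⁻ A B x∈ | x ∈? C
  ... | xA , xB | no  ¬c = inj₁ (Sub.x∈p∧x∉q⇒x∈p─q xA ¬c)
  ... | xA , xB | yes c  = inj₂ (Sub.x∈p∧x∉q⇒x∈p─q xB (disjoint x c))

meets-≤-∣∣ : ∀ {n l} (π : Fin n → Fin l) A j → meets π A j ≤ ∣ A ∩ fibre π j ∣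
meets-≤-∣∣ π A j with Sub.nonempty? (A ∩ fibre π j)
... | no  _  = z≤n
... | yes ne = ∣∣-nonempty ne

meets-mono : ∀ {n l} (π : Fin n → Fin l) {A B} → A ⊆ B → ∀ j → meets π A j ≤ meets π B j
meets-mono π {A} {B} A⊆B j = 𝟙-mono (Sub.nonempty? (A ∩ fibre π j)) (Sub.nonempty? (B ∩ fibre π j))
  λ { (x , x∈) → x , ∩fibre-mono π A⊆B j x∈ }

-- Signs as centres of mass mod p

module Signs (q : ℕ) (prime : Prime (suc q)) where
  open Sphere q using (p; rot; rot-period; toℕ-rot; [m+n%p]%p≡[m+n]%p)

  rot-fromℕ : rot (fromℕ q) ≡ zero
  rot-fromℕ rewrite view-fromℕ q = refl

  rot-inject₁ : ∀ i → rot (inject₁ i) ≡ suc i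
  rot-inject₁ i rewrite view-inject₁ i = refl

  rot-surjective : ∀ i → ∃[ j ] rot j ≡ i
  rot-surjective zero    = fromℕ q , rot-fromℕ
  rot-surjective (suc i) = inject₁ i , rot-inject₁ i

  Weight : Set
  Weight = Fin p → ℕ

  sum-rot : (w : Weight) → sum (w ∘ rot) ≡ sum w
  sum-rot w = begin
    sum (w ∘ rot)                                       ≡⟨ sum-init-last (w ∘ rot) ⟩
    sum (λ i → w (rot (inject₁ i))) + w (rot (fromℕ q))
      ≡⟨ cong₂ _+_ (sum-cong-≗ {q} (λ i → cong w (rot-inject₁ i))) (cong w rot-fromℕ) ⟩
    sum (w ∘ suc) + w zero                              ≡⟨ ℕ.+-comm (sum (w ∘ suc)) (w zero) ⟩
    sum w                                               ∎
    where open ≡-Reasoning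

  Rotated : Weight → Weight → Set
  Rotated w w′ = ∀ i → w′ (rot i) ≡ w i

  sum-Rotated : ∀ {w w′} → Rotated w w′ → sum w′ ≡ sum w
  sum-Rotated {w} {w′} R = trans (sym (sum-rot w′)) (sum-cong-≗ R)

  sum-%-cong : ∀ {n} (f g : Fin n → ℕ) → (∀ i → f i % p ≡ g i % p) → sum f % p ≡ sum g % p
  sum-%-cong {zero}  f g eq = refl
  sum-%-cong {suc n} f g eq = begin
    (f zero + sum (f ∘ suc)) % p          ≡⟨ ℕ.%-distribˡ-+ (f zero) _ p ⟩
    (f zero % p + sum (f ∘ suc) % p) % p
      ≡⟨ cong₂ (λ u v → (u + v) % p) (eq zero) (sum-%-cong (f ∘ suc) (g ∘ suc) (eq ∘ suc)) ⟩
    (g zero % p + sum (g ∘ suc) % p) % p  ≡⟨ ℕ.%-distribˡ-+ (g zero) _ p ⟨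
    (g zero + sum (g ∘ suc)) % p          ∎
    where open ≡-Reasoning

  moment : Weight → ℕ
  moment w = sum (λ i → toℕ i * w i)

  -- All positions move up by one, the wrap-around being invisible mod p, so each unit of weight
  -- contributes 1.
  moment-Rotated : ∀ {w w′} → Rotated w w′ → moment w′ % p ≡ (sum w + moment w) % p
  moment-Rotated {w} {w′} R = begin
    moment w′ % p                                ≡⟨ cong (_% p) (sum-rot (λ i → toℕ i * w′ i)) ⟨
    sum (λ i → toℕ (rot i) * w′ (rot i)) % p
      ≡⟨ sum-%-cong (λ i → toℕ (rot i) * w′ (rot i)) (λ i → w i + toℕ i * w i) step ⟩
    sum (λ i → w i + toℕ i * w i) % p            ≡⟨ cong (_% p) (∑-distrib-+ w (λ i → toℕ i * w i)) ⟩
    (sum w + moment w) % p                       ∎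
    where
    open ≡-Reasoning
    step : ∀ i → (toℕ (rot i) * w′ (rot i)) % p ≡ (suc (toℕ i) * w i) % p
    step i = begin
      (toℕ (rot i) * w′ (rot i)) % p             ≡⟨ cong₂ (λ u v → (u * v) % p) (toℕ-rot i) (R i) ⟩
      (suc (toℕ i) % p * w i) % p                ≡⟨ ℕ.%-distribˡ-* (suc (toℕ i) % p) (w i) p ⟩
      (suc (toℕ i) % p % p * (w i % p)) % p
        ≡⟨ cong (λ u → (u * (w i % p)) % p) (ℕ.m%n%n≡m%n (suc (toℕ i)) p) ⟩
      (suc (toℕ i) % p * (w i % p)) % p          ≡⟨ ℕ.%-distribˡ-* (suc (toℕ i)) (w i) p ⟨
      (suc (toℕ i) * w i) % p                    ∎

  ∤⇒coprime : ∀ {w} → ¬ (p ∣ w) → Coprime p w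
  ∤⇒coprime p∤w (d∣p , d∣w) with prime⇒irreducible prime d∣p
  ... | inj₁ d≡1  = d≡1
  ... | inj₂ refl = ⊥-elim (p∤w d∣w)

  inverse-exists : ∀ w → ¬ (p ∣ w) → ∃[ k ] (k * w) % p ≡ 1 % p
  inverse-exists w p∤w with coprime-Bézout (∤⇒coprime p∤w)
  ... | Bézout.-+ x y eq = y , trans (cong (_% p) (sym eq)) (ℕ.[m+kn]%n≡m%n 1 x p)
  -- Here y w is -1 mod p, and so is q.
  ... | Bézout.+- x y eq = q * y , (begin
    (q * y * w) % p              ≡⟨ ℕ.[m+n]%n≡m%n (q * y * w) p ⟨
    (q * y * w + suc q) % p      ≡⟨ cong (_% p) (alg q y w) ⟩
    (1 + q * (1 + y * w)) % p    ≡⟨ cong (λ u → (1 + q * u) % p) eq ⟩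
    (1 + q * (x * p)) % p        ≡⟨ cong (λ u → (1 + u) % p) (ℕ.*-assoc q x p) ⟨
    (1 + q * x * p) % p          ≡⟨ ℕ.[m+kn]%n≡m%n 1 (q * x) p ⟩
    1 % p                        ∎)
    where
    open ≡-Reasoning
    alg : ∀ q y w → q * y * w + suc q ≡ 1 + q * (1 + y * w)
    alg = solve-∀

  inverse : ℕ → ℕ
  inverse w with p ∣? w
  -- A default value: `sgn` takes a centre only of weights whose total is prime to p.
  ... | yes _   = 0
  ... | no  p∤w = proj₁ (inverse-exists w p∤w)

  inverse-* : ∀ w → ¬ (p ∣ w) → (inverse w * w) % p ≡ 1 % p
  inverse-* w p∤w with p ∣? w
  ... | yes p∣w  = ⊥-elim (p∤w p∣w)
  ... | no  p∤w′ = proj₂ (inverse-exists w p∤w′)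

  -- The weighted mean of the positions, with division mod p.
  centre : Weight → Fin p
  centre w = (inverse (sum w) * moment w) mod p

  toℕ-centre : ∀ w → toℕ (centre w) ≡ (inverse (sum w) * moment w) % p
  toℕ-centre w = Fin.toℕ-fromℕ< _

  centre-cong : ∀ {w w′} → w ≗ w′ → centre w ≡ centre w′
  centre-cong {w} {w′} eq = cong₂ (λ u v → (inverse u * v) mod p) (sum-cong-≗ eq)
      (sum-cong-≗ (λ i → cong (toℕ i *_) (eq i)))

  centre-Rotated : ∀ {w w′} → Rotated w w′ → ¬ (p ∣ sum w) → centre w′ ≡ rot (centre w)
  centre-Rotated {w} {w′} R p∤w = Fin.toℕ-injective (begin
    toℕ (centre w′)                                ≡⟨ toℕ-centre w′ ⟩
    (inverse (sum w′) * moment w′) % p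
      ≡⟨ cong (λ u → (inverse u * moment w′) % p) (sum-Rotated {w} {w′} R) ⟩
    (k * moment w′) % p                            ≡⟨ ℕ.%-distribˡ-* k (moment w′) p ⟩
    (k % p * (moment w′ % p)) % p
      ≡⟨ cong (λ u → (k % p * u) % p) (moment-Rotated {w} {w′} R) ⟩
    (k % p * ((sum w + moment w) % p)) % p         ≡⟨ ℕ.%-distribˡ-* k (sum w + moment w) p ⟨
    (k * (sum w + moment w)) % p                   ≡⟨ cong (_% p) (ℕ.*-distribˡ-+ k (sum w) (moment w)) ⟩
    (k * sum w + k * moment w) % p                 ≡⟨ ℕ.%-distribˡ-+ (k * sum w) (k * moment w) p ⟩
    ((k * sum w) % p + (k * moment w) % p) % p
      ≡⟨ cong (λ u → (u + (k * moment w) % p) % p) (inverse-* (sum w) p∤w) ⟩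
    (1 % p + (k * moment w) % p) % p               ≡⟨ ℕ.%-distribˡ-+ 1 (k * moment w) p ⟨
    suc (k * moment w) % p                         ≡⟨ [m+n%p]%p≡[m+n]%p 1 (k * moment w) ⟨
    suc ((k * moment w) % p) % p                   ≡⟨ cong (λ u → suc u % p) (toℕ-centre w) ⟨
    suc (toℕ (centre w)) % p                       ≡⟨ toℕ-rot (centre w) ⟨
    toℕ (rot (centre w))                           ∎)
    where
    open ≡-Reasoning
    k = inverse (sum w)

  -- The first weight with total prime to p decides. Totals are invariant under rotation, so a list
  -- and its rotated copy are decided at the same entry.
  sgn : List Weight → Fin p
  sgn []       = zero
  sgn (w ∷ ws) with p ∣? sum w
  ... | yes _ = sgn ws
  ... | no  _ = centre w

  sgn-cong : ∀ {ws ws′} → Pointwise _≗_ ws ws′ → sgn ws ≡ sgn ws′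
  sgn-cong [] = refl
  sgn-cong {w ∷ ws} {w′ ∷ ws′} (eq ∷ eqs) with p ∣? sum w | p ∣? sum w′
  ... | yes _ | yes _  = sgn-cong eqs
  ... | no  _ | no  _  = centre-cong eq
  ... | yes d | no  ¬d = ⊥-elim (¬d (subst (p ∣_) (sum-cong-≗ eq) d))
  ... | no ¬d | yes d  = ⊥-elim (¬d (subst (p ∣_) (sym (sum-cong-≗ eq)) d))

  sgn-Rotated : ∀ {ws ws′} → Pointwise Rotated ws ws′ → Any (λ w → ¬ (p ∣ sum w)) ws → sgn ws′ ≡ rot (sgn ws)
  sgn-Rotated {w ∷ ws} {w′ ∷ ws′} (R ∷ Rs) any with p ∣? sum w | p ∣? sum w′
  sgn-Rotated {w ∷ ws} {w′ ∷ ws′} (R ∷ Rs) (here ¬d)   | yes d | yes _  = ⊥-elim (¬d d)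
  sgn-Rotated {w ∷ ws} {w′ ∷ ws′} (R ∷ Rs) (there any) | yes _ | yes _  = sgn-Rotated Rs any
  ... | no ¬d | no  _  = centre-Rotated {w} {w′} R ¬d
  ... | yes d | no  ¬d = ⊥-elim (¬d (subst (p ∣_) (sym (sum-Rotated {w} {w′} R)) d))
  ... | no ¬d | yes d  = ⊥-elim (¬d (subst (p ∣_) (sum-Rotated {w} {w′} R) d))

  sum-<p : (f : Weight) → (∀ i → f i ≤ 1) → ∀ k → f k ≡ 0 → sum f < p
  sum-<p f f≤1 k fk≡0 = subst (sum f <_) (trans (sum-const p 1) (ℕ.*-identityʳ p))
    (sum-mono-< f≤1 k (subst (_< 1) (sym fk≡0) (s≤s z≤n)))

  ∣-<p : ∀ {m} → p ∣ m → m < p → m ≡ 0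
  ∣-<p {zero}  d m<p = refl
  ∣-<p {suc m} d m<p = ⊥-elim (ℕ.<⇒≱ m<p (ℕ.∣⇒≤ d))

  1<p : 1 < p
  1<p = nonTrivial⇒n>1 p {{prime⇒nonTrivial prime}}

-- The case of a prime r: levels and signs of sign vectors

module PrimeStep (q : ℕ) (prime : Prime (suc q)) {n l : ℕ} (𝓕 : Family n) (π : Fin n → Fin l)
  (N : Subset n) (s t : ℕ) (c : Subset n → ℕ)
  (N-small : ∀ j → ∣ N ∩ fibre π j ∣ ≤ suc q)
  (𝓕-large : ∀ F → 𝓕 F ≡ true → s < ∣ F ∣)
  (c-bounded : ∀ A → Vertex 𝓕 π ⌊ s /2⌋ A → c A < t) where

  open Sphere q using (p; rot; rot-period; V; ρ; _≼_; NonZero; Equivariant; just-injective-map)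
  open Signs q prime

  Parts : Set
  Parts = Fin p → Subset n

  infix 4 _⊑_
  _⊑_ : Parts → Parts → Set
  U ⊑ U′ = ∀ i → U i ⊆ U′ i

  RotatedParts : Parts → Parts → Set
  RotatedParts U U′ = ∀ i → U′ (rot i) ≡ U i

  Hit : Fin t → Subset n → Set
  Hit k U = ∃[ F ] (Vertex 𝓕 π ⌊ s /2⌋ F × c F ≡ toℕ k × ∣ F ─ U ∣ ≤ ⌊ s /2⌋)

  abstract
    hit? : ∀ k U → Dec (Hit k U)
    hit? k U = search-Subset λ F → vertex? 𝓕 π _ F ×-dec (c F ℕ.≟ toℕ k) ×-dec (∣ F ─ U ∣ ℕ.≤? _)

  hits : Parts → Fin t → Weight
  hits U k i = 𝟙 (does (hit? k (U i)))

  colours : Parts → ℕ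
  colours U = sum (λ k → sum (hits U k))

  rows : Parts → Fin l → Weight
  rows U j i = meets π (U i) j

  blocks : Parts → Weight
  blocks U i = sum (meets π (U i))

  least : (f : Weight) → ∃[ i ] ∀ j → f i ≤ f j
  least f = extremum {_≤_} ℕ.≤-trans ℕ.≤-total f

  low : Parts → ℕ
  low U = blocks U (proj₁ (least (blocks U)))

  low≤ : ∀ U i → low U ≤ blocks U i
  low≤ U = proj₂ (least (blocks U))

  -- The sizes of a largest equitable family of subsets of disjoint transversals with blocks U i elements.
  levelled : Parts → Weight
  levelled U i = blocks U i ⊓ suc (low U)

  rank : Parts → ℕ
  rank U = sum (levelled U)

  -- Membership of `x` is consulted only if its block meets all p parts: otherwise a larger vector
  -- of the same level might still assign `x` to a part.
  full : Parts → Fin n → Weight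
  full U x i = 𝟙 (does (sum (rows U (π x)) ℕ.≟ p)) * mem (U i) x

  -- Weights for a rank divisible by p, where `levelled` has no centre of mass. The decision is an
  -- argument so that the decisions for two vectors can be matched together.
  deep : ∀ {m} → Dec (p ∣ m) → Parts → List Weight
  deep (no _)  U = []
  deep (yes _) U = List.tabulate (rows U) List.++ List.tabulate (full U)

  inner : ℕ → Parts → List Weight
  inner zero    U = levelled U ∷ deep (p ∣? rank U) U
  inner (suc _) U = []

  -- U is the part of a sign vector inside N and O the part outside.
  keys : Parts → Parts → List Weight
  keys U O = List.tabulate (λ x i → mem (O i) x) List.++ List.tabulate (hits U) List.++ inner (colours U) U

  module _ {U U′ : Parts} (R : RotatedParts U U′) where

    hits-Rotated : ∀ k → Rotated (hits U k) (hits U′ k)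
    hits-Rotated k i = cong (λ A → 𝟙 (does (hit? k A))) (R i)

    colours-Rotated : colours U′ ≡ colours U
    colours-Rotated = sum-cong-≗ {t} (λ k → sum-Rotated {hits U k} {hits U′ k} (hits-Rotated k))

    rows-Rotated : ∀ j → Rotated (rows U j) (rows U′ j)
    rows-Rotated j i = cong (λ A → meets π A j) (R i)

    blocks-Rotated : Rotated (blocks U) (blocks U′)
    blocks-Rotated i = cong (λ A → sum (meets π A)) (R i)

    -- The index found by `least` need not rotate with the parts, so the minimal values are compared
    -- from both sides.
    low-Rotated : low U′ ≡ low U
    low-Rotated = ℕ.≤-antisym (ℕ.≤-trans (low≤ U′ (rot i)) (ℕ.≤-reflexive (blocks-Rotated i))) ≥
      where
      i = proj₁ (least (blocks U))
      ≥ : low U ≤ low U′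
      ≥ with i′ , eq ← rot-surjective (proj₁ (least (blocks U′))) =
        ℕ.≤-trans (low≤ U i′) (ℕ.≤-reflexive (trans (sym (blocks-Rotated i′)) (cong (blocks U′) eq)))

    levelled-Rotated : Rotated (levelled U) (levelled U′)
    levelled-Rotated i = cong₂ (λ a b → a ⊓ suc b) (blocks-Rotated i) low-Rotated

    rank-Rotated : rank U′ ≡ rank U
    rank-Rotated = sum-Rotated {levelled U} {levelled U′} levelled-Rotated

    full-Rotated : ∀ x → Rotated (full U x) (full U′ x)
    full-Rotated x i = cong₂ (λ a A → 𝟙 (does (a ℕ.≟ p)) * mem A x)
      (sum-Rotated {rows U (π x)} {rows U′ (π x)} (rows-Rotated (π x))) (R i)

    deep-Rotated : ∀ {m m′} → m′ ≡ m → (d : Dec (p ∣ m)) (d′ : Dec (p ∣ m′)) →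
        Pointwise Rotated (deep d U) (deep d′ U′)
    deep-Rotated eq   (yes _) (yes _) = Pointwise.++⁺ (Pointwise.tabulate⁺ rows-Rotated)
        (Pointwise.tabulate⁺ full-Rotated)
    deep-Rotated eq   (no  _) (no  _) = []
    deep-Rotated refl (yes d) (no ¬d) = ⊥-elim (¬d d)
    deep-Rotated refl (no ¬d) (yes d) = ⊥-elim (¬d d)

    inner-Rotated : ∀ k → Pointwise Rotated (inner k U) (inner k U′)
    inner-Rotated zero    = levelled-Rotated ∷ deep-Rotated rank-Rotated (p ∣? rank U) (p ∣? rank U′)
    inner-Rotated (suc _) = []

    keys-Rotated : {O O′ : Parts} → RotatedParts O O′ → Pointwise Rotated (keys U O) (keys U′ O′)
    keys-Rotated RO = Pointwise.++⁺ (Pointwise.tabulate⁺ (λ x i → cong (λ A → mem A x) (RO i)))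
      (Pointwise.++⁺ (Pointwise.tabulate⁺ hits-Rotated)
        (subst (λ k → Pointwise Rotated (inner (colours U) U) (inner k U′)) (sym colours-Rotated)
            (inner-Rotated (colours U))))

  module _ {U U′ : Parts} (U⊑U′ : U ⊑ U′) where

    hits-mono : ∀ k i → hits U k i ≤ hits U′ k i
    hits-mono k i = 𝟙-mono (hit? k (U i)) (hit? k (U′ i))
      λ { (F , v , eq , near) → F , v , eq , ℕ.≤-trans (─-antimono F (U⊑U′ i)) near }

    colours-mono : colours U ≤ colours U′
    colours-mono = sum-mono (λ k → sum-mono (hits-mono k))

    blocks-mono : ∀ i → blocks U i ≤ blocks U′ i
    blocks-mono i = sum-mono (meets-mono π (U⊑U′ i))

    low-mono : low U ≤ low U′
    low-mono = ℕ.≤-trans (low≤ U i) (blocks-mono i)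
      where i = proj₁ (least (blocks U′))

    levelled-mono : ∀ i → levelled U i ≤ levelled U′ i
    levelled-mono i = ℕ.⊓-mono-≤ (blocks-mono i) (s≤s low-mono)

    rank-mono : rank U ≤ rank U′
    rank-mono = sum-mono levelled-mono

    hits-squeeze : colours U ≡ colours U′ → ∀ k i → hits U k i ≡ hits U′ k i
    hits-squeeze eq k = sum-squeeze (hits-mono k) (sum-squeeze (λ k → sum-mono (hits-mono k)) eq k)

    levelled-squeeze : rank U ≡ rank U′ → ∀ i → levelled U i ≡ levelled U′ i
    levelled-squeeze = sum-squeeze levelled-mono

  low≤levelled : ∀ U i → low U ≤ levelled U i
  low≤levelled U i = ℕ.⊓-glb (low≤ U i) (ℕ.n≤1+n (low U))

  levelled≤ : ∀ U i → levelled U i ≤ suc (low U)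
  levelled≤ U i = ℕ.m⊓n≤n (blocks U i) (suc (low U))

  -- The excess over `low` is 0 or 1 for every part and 0 for a least one, so the total excess is
  -- below p; divisibility makes it 0.
  ∣rank⇒levelled : ∀ U → p ∣ rank U → ∀ i → levelled U i ≡ low U
  ∣rank⇒levelled U p∣rank i = begin
    levelled U i           ≡⟨ split i ⟩
    low U + excess i       ≡⟨ cong (low U +_) (ℕ.n≤0⇒n≡0 (subst (excess i ≤_) excess≡0 (term≤sum excess i))) ⟩
    low U + 0              ≡⟨ ℕ.+-identityʳ (low U) ⟩
    low U                  ∎
    where
    open ≡-Reasoning
    excess : Weight
    excess i = levelled U i ∸ low U
    split : ∀ i → levelled U i ≡ low U + excess i
    split i = sym (ℕ.m+[n∸m]≡n (low≤levelled U i))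
    k = proj₁ (least (blocks U))
    excess-low : excess k ≡ 0
    excess-low = ℕ.m≤n⇒m∸n≡0 (ℕ.m⊓n≤m (blocks U k) (suc (low U)))
    excess≤1 : ∀ i → excess i ≤ 1
    excess≤1 i = ℕ.m≤n+o⇒m∸n≤o _ (low U) (subst (levelled U i ≤_) (ℕ.+-comm 1 (low U)) (levelled≤ U i))
    rank≡ : rank U ≡ p * low U + sum excess
    rank≡ = begin
      rank U                                    ≡⟨ sum-cong-≗ split ⟩
      sum (λ i → low U + excess i)              ≡⟨ ∑-distrib-+ {p} (λ _ → low U) excess ⟩
      sum {p} (λ _ → low U) + sum excess        ≡⟨ cong (_+ sum excess) (sum-const p (low U)) ⟩
      p * low U + sum excess                    ∎
    excess≡0 : sum excess ≡ 0
    excess≡0 = ∣-<p (ℕ.∣m+n∣m⇒∣n (subst (p ∣_) rank≡ p∣rank) (ℕ.m∣m*n (low U)))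
        (sum-<p excess excess≤1 k excess-low)

  -- A part that meets more than `low` blocks would be cut to `suc (low U)`, not to `low U`.
  ∣rank⇒blocks : ∀ U → p ∣ rank U → ∀ i → blocks U i ≡ low U
  ∣rank⇒blocks U p∣rank i with ℕ.≤-total (blocks U i) (suc (low U))
  ... | inj₁ le = trans (sym (ℕ.m≤n⇒m⊓n≡m le)) (∣rank⇒levelled U p∣rank i)
  ... | inj₂ ge = ⊥-elim (ℕ.1+n≢n (trans (sym (ℕ.m≥n⇒m⊓n≡n ge)) (∣rank⇒levelled U p∣rank i)))

  -- If p divides the rank, cutting removes nothing, so equal ranks mean equal numbers of blocks met
  -- by each part; the sets of blocks met can only grow.
  rows-squeeze : ∀ {U U′} → U ⊑ U′ → rank U ≡ rank U′ → p ∣ rank U → ∀ j i → rows U j i ≡ rows U′ j i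
  rows-squeeze {U} {U′} U⊑U′ eq p∣rank j i = sum-squeeze (meets-mono π (U⊑U′ i)) (begin
    blocks U i     ≡⟨ ∣rank⇒blocks U p∣rank i ⟩
    low U          ≡⟨ ∣rank⇒levelled U p∣rank i ⟨
    levelled U i   ≡⟨ levelled-squeeze U⊑U′ eq i ⟩
    levelled U′ i  ≡⟨ ∣rank⇒levelled U′ p∣rank′ i ⟩
    low U′         ≡⟨ ∣rank⇒blocks U′ p∣rank′ i ⟨
    blocks U′ i    ∎) j
    where
    open ≡-Reasoning
    p∣rank′ = subst (p ∣_) eq p∣rank

  record Disjoint (U : Parts) : Set where
    field
      within   : ∀ i → U i ⊆ N
      disjoint : ∀ i j → i ≢ j → ∀ x → x ∈ U i → x ∉ U j

  -- |N ∩ P_j| ≤ p enters here: a block that meets all p parts has no points left outside them.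
  full-row : ∀ {U} → Disjoint U → ∀ j → sum (rows U j) ≡ p → ∀ x → x ∈ N → π x ≡ j → ∃[ i ] x ∈ U i
  full-row {U} D j sum≡p x x∈N refl =
    let i , x∈ = ∈⟪⟫⁻ covered? (⊆-squeeze A⊆ p≤A (∈∩fibre⁺ π x∈N)) in i , proj₁ (∈∩fibre⁻ π x∈)
    where
    open Disjoint D
    covered? : ∀ y → Dec (∃[ i ] y ∈ U i ∩ fibre π (π x))
    covered? y = Fin.any? (λ i → y ∈? (U i ∩ fibre π (π x)))
    A = ⟪ covered? ⟫
    A⊆ : A ⊆ N ∩ fibre π (π x)
    A⊆ y∈ with i , y∈i ← ∈⟪⟫⁻ covered? y∈ = ∩fibre-mono π (within i) (π x) y∈i
    p≤A : ∣ N ∩ fibre π (π x) ∣ ≤ ∣ A ∣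
    p≤A = begin
      ∣ N ∩ fibre π (π x) ∣                 ≤⟨ N-small (π x) ⟩
      p                                     ≡⟨ sum≡p ⟨
      sum (rows U (π x))                    ≤⟨ sum-mono (λ i → meets-≤-∣∣ π (U i) (π x)) ⟩
      sum (λ i → ∣ U i ∩ fibre π (π x) ∣)
        ≤⟨ sum-≤-∣∣ A (λ i → U i ∩ fibre π (π x)) (λ i y∈ → ∈⟪⟫⁺ covered? (i , y∈))
                                                 (λ i k i≢k y y∈i y∈k → disjoint i k i≢k y
                                                     (proj₁ (∈∩fibre⁻ π y∈i)) (proj₁ (∈∩fibre⁻ π y∈k))) ⟩
      ∣ A ∣                                 ∎
      where open ℕ.≤-Reasoning

  -- In a block met by all p parts a point already has its part in `U`, and disjointness in `U′`
  -- keeps it from joining another.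
  full-squeeze : ∀ {U U′} → Disjoint U → Disjoint U′ → U ⊑ U′ → (∀ j i → rows U j i ≡ rows U′ j i) →
                 ∀ x i → full U x i ≡ full U′ x i
  full-squeeze {U} {U′} D D′ U⊑U′ rows≡ x i = trans
    (cong (λ a → 𝟙 (does (a ℕ.≟ p)) * mem (U i) x) (sum-cong-≗ (rows≡ (π x))))
    (by-cases (sum (rows U′ (π x)) ℕ.≟ p))
    where
    back : sum (rows U′ (π x)) ≡ p → x ∈ U′ i → x ∈ U i
    back eq x∈ with k , x∈k ← full-row D (π x) (trans (sum-cong-≗ (rows≡ (π x))) eq) x
        (Disjoint.within D′ i x∈) refl with k Fin.≟ i
    ... | yes refl = x∈k
    ... | no  k≢i  = ⊥-elim (Disjoint.disjoint D′ k i k≢i x (U⊑U′ k x∈k) x∈)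
    by-cases : (d : Dec (sum (rows U′ (π x)) ≡ p)) → 𝟙 (does d) * mem (U i) x ≡ 𝟙 (does d) * mem (U′ i) x
    by-cases (no  _)  = refl
    by-cases (yes eq) = cong (_+ 0) (ℕ.≤-antisym (mem-mono x (U⊑U′ i)) (mem-mono x (back eq)))

  module _ {U U′ : Parts} (D : Disjoint U) (D′ : Disjoint U′) (U⊑U′ : U ⊑ U′) where

    deep-squeeze : ∀ {m m′} → m ≡ rank U → m ≡ m′ → rank U ≡ rank U′ → (d : Dec (p ∣ m)) (d′ : Dec (p ∣ m′)) →
                   Pointwise _≗_ (deep d U) (deep d′ U′)
    deep-squeeze m≡ refl eq (no  _) (no  _) = []
    deep-squeeze m≡ refl eq (yes d) (no ¬d) = ⊥-elim (¬d d)
    deep-squeeze m≡ refl eq (no ¬d) (yes d) = ⊥-elim (¬d d)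
    deep-squeeze refl _  eq (yes d) (yes _) = Pointwise.++⁺ (Pointwise.tabulate⁺ rows≡)
      (Pointwise.tabulate⁺ (full-squeeze D D′ U⊑U′ rows≡))
      where rows≡ = rows-squeeze U⊑U′ eq d

    inner-squeeze : ∀ k → (k ≡ 0 → rank U ≡ rank U′) → Pointwise _≗_ (inner k U) (inner k U′)
    inner-squeeze (suc _) eq = []
    inner-squeeze zero    eq = levelled-squeeze U⊑U′ (eq refl) ∷ deep-squeeze refl (eq refl) (eq refl)
        (p ∣? rank U) (p ∣? rank U′)

    -- Equality of ranks is available only without hits, because `height` forgets the rank
    -- otherwise; `inner` is empty in that case.
    keys-squeeze : {O O′ : Parts} → O ⊑ O′ → sum (λ i → ∣ O i ∣) ≡ sum (λ i → ∣ O′ i ∣) →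
      colours U ≡ colours U′ → (colours U ≡ 0 → rank U ≡ rank U′) → Pointwise _≗_ (keys U O) (keys U′ O′)
    keys-squeeze {O} {O′} O⊑O′ eqO eqC eqR = Pointwise.++⁺ (Pointwise.tabulate⁺ (λ x i → ℕ.≤-antisym
        (mem-mono x (O⊑O′ i))
        (mem-mono x (⊆-squeeze (O⊑O′ i) (ℕ.≤-reflexive
            (sym (sum-squeeze (λ i → Sub.p⊆q⇒∣p∣≤∣q∣ (O⊑O′ i)) eqO i)))))))
      (Pointwise.++⁺ (Pointwise.tabulate⁺ (hits-squeeze U⊑U′ eqC))
        (subst (λ k → Pointwise _≗_ (inner (colours U) U) (inner k U′)) eqC (inner-squeeze (colours U) eqR)))

  -- A colour that hits all p parts would supply p vertices near pairwise disjoint sets, that is, a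
  -- monochromatic edge.
  row-of-hits : ¬ Mono 𝓕 π s c p N → ∀ {U} → Disjoint U → ∀ k → sum (hits U k) < p
  row-of-hits ¬mono {U} D k with Fin.all? (λ i → hit? k (U i))
  ... | no ¬all with i , ¬hit ← Fin.¬∀⟶∃¬ p _ (λ i → hit? k (U i)) ¬all =
    sum-<p (hits U k) (λ i → 𝟙-≤1 (does (hit? k (U i)))) i (𝟙-no (hit? k (U i)) ¬hit)
  ... | yes all = ⊥-elim (¬mono (mono-edge 𝓕 (λ i → proj₁ (all i)) record
    { vertex  = λ i → proj₁ (proj₂ (all i))
    ; near    = λ i → ℕ.≤-trans (─-antimono (proj₁ (all i)) (within i)) (near i)
    ; small-∩ = λ i j i≢j → near-disjoint s (proj₁ (all i)) (proj₁ (all j)) (disjoint i j i≢j) (near i)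
        (near j)
    ; mono    = λ i j → trans (proj₁ (proj₂ (proj₂ (all i)))) (sym (proj₁ (proj₂ (proj₂ (all j)))))
    }))
    where
    open Disjoint D
    near : ∀ i → ∣ proj₁ (all i) ─ U i ∣ ≤ ⌊ s /2⌋
    near i = proj₂ (proj₂ (proj₂ (all i)))

  colours≡0⇒¬Hit : ∀ {U} → colours U ≡ 0 → ∀ k i → ¬ Hit k (U i)
  colours≡0⇒¬Hit {U} eq k i hit = ℕ.<⇒≱ (begin
    1                ≡⟨ 𝟙-yes (hit? k (U i)) hit ⟨
    hits U k i       ≤⟨ term≤sum (hits U k) i ⟩
    sum (hits U k)   ≤⟨ term≤sum (λ k → sum (hits U k)) k ⟩
    colours U        ∎) (ℕ.≤-reflexive eq)
    where open ℕ.≤-Reasoning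

  rank-bound : ¬ Good 𝓕 ⌊ s /2⌋ t p N → ∀ {U} → Disjoint U → colours U ≡ 0 → rank U + q * t < ∣ N ∣
  rank-bound ¬good {U} D eq = ℕ.≰⇒> λ N≤ → ¬good (good 𝓕 B record
    { within    = λ i x∈ → within i (A⊆U i (B⊆A i x∈))
    ; disjoint  = λ i j i≢j x x∈i x∈j → disjoint i j i≢j x (A⊆U i (B⊆A i x∈i)) (A⊆U j (B⊆A j x∈j))
    ; equitable = λ i j → subst₂ (λ a b → a ≤ suc b) (sym (∣B∣ i)) (sym (∣B∣ j))
                    (ℕ.≤-trans (levelled≤ U i) (s≤s (low≤levelled U j)))
    ; free      = free
    ; large     = subst (λ m → ∣ N ∣ ≤ m + q * t) (sum-cong-≗ (λ i → sym (∣B∣ i))) N≤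
    })
    where
    open Disjoint D
    A : Parts
    A i = proj₁ (∃-transversal π (U i))
    A⊆U : ∀ i → A i ⊆ U i
    A⊆U i = proj₁ (proj₂ (∃-transversal π (U i)))
    transversal : ∀ i → Transversal π (A i)
    transversal i = proj₁ (proj₂ (proj₂ (∃-transversal π (U i))))
    levelled≤∣A∣ : ∀ i → levelled U i ≤ ∣ A i ∣
    levelled≤∣A∣ i = ℕ.≤-trans (ℕ.m⊓n≤m (blocks U i) _) (proj₂ (proj₂ (proj₂ (∃-transversal π (U i)))))
    B : Parts
    B i = proj₁ (subset-of-size (A i) (levelled U i) (levelled≤∣A∣ i))
    B⊆A : ∀ i → B i ⊆ A i
    B⊆A i = proj₁ (proj₂ (subset-of-size (A i) (levelled U i) (levelled≤∣A∣ i)))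
    ∣B∣ : ∀ i → ∣ B i ∣ ≡ levelled U i
    ∣B∣ i = proj₂ (proj₂ (subset-of-size (A i) (levelled U i) (levelled≤∣A∣ i)))
    -- A member near `B i` is near a transversal, hence a vertex, and its colour would hit `U i`.
    free : ∀ i → Free 𝓕 ⌊ s /2⌋ (B i)
    free i (F , F∈𝓕 , near) = colours≡0⇒¬Hit {U} eq (fromℕ< (c-bounded F vertex)) i
      (F , vertex , sym (Fin.toℕ-fromℕ< _) , near-U)
      where
      near-A : ∣ F ─ A i ∣ ≤ ⌊ s /2⌋
      near-A = ℕ.≤-trans (─-antimono F (B⊆A i)) near
      near-U : ∣ F ─ U i ∣ ≤ ⌊ s /2⌋
      near-U = ℕ.≤-trans (─-antimono F (A⊆U i)) near-A
      vertex : Vertex 𝓕 π ⌊ s /2⌋ F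
      vertex = F∈𝓕 , near-transversal⇒stable π (A i) F (transversal i) near-A

  p∤ : ∀ {m} → 1 ≤ m → m < p → ¬ (p ∣ m)
  p∤ 1≤m m<p p∣m = ℕ.<⇒≢ 1≤m (sym (∣-<p p∣m m<p))

  sum-mem : ∀ (U : Parts) → (∀ i j → i ≢ j → ∀ x → x ∈ U i → x ∉ U j) → ∀ {k x} → x ∈ U k →
      sum (λ i → mem (U i) x) ≡ 1
  sum-mem U disjoint {k} {x} x∈ = trans
    (sum-cong-≗ (λ i → ℕ.≤-antisym (𝟙-mono (x ∈? U i) (i Fin.≟ k) (only i))
                                   (𝟙-mono (i Fin.≟ k) (x ∈? U i) λ { refl → x∈ })))
    (sum-𝟙-unique k)
    where
    only : ∀ i → x ∈ U i → i ≡ k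
    only i x∈i with i Fin.≟ k
    ... | yes eq = eq
    ... | no  ne = ⊥-elim (disjoint i k ne x x∈i x∈)

  sum-full : ∀ {U} → Disjoint U → ∀ {k x} → x ∈ U k → sum (rows U (π x)) ≡ p → sum (full U x) ≡ 1
  sum-full {U} D {x = x} x∈ eq = trans
    (sum-cong-≗ (λ i → trans (cong (_* mem (U i) x) (𝟙-yes (sum (rows U (π x)) ℕ.≟ p) eq))
        (ℕ.*-identityˡ (mem (U i) x))))
    (sum-mem U (Disjoint.disjoint D) x∈)

  inner-sign : ∀ {U} → Disjoint U → ∀ {k x} → x ∈ U k → Any (λ w → ¬ (p ∣ sum w)) (inner 0 U)
  inner-sign {U} D {k} {x} x∈ with p ∣? rank U
  ... | no ¬d = here ¬d
  ... | yes _ = there (by-row (ℕ.m≤n⇒m<n∨m≡n row≤p))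
    where
    row≥1 : 1 ≤ sum (rows U (π x))
    row≥1 = ℕ.≤-trans (ℕ.≤-reflexive (sym (𝟙-yes (Sub.nonempty? (U k ∩ fibre π (π x))) (x , ∈∩fibre⁺ π x∈))))
                      (term≤sum (rows U (π x)) k)
    row≤p : sum (rows U (π x)) ≤ p
    row≤p = subst (sum (rows U (π x)) ≤_) (ℕ.*-identityʳ p)
      (sum-bounded 1 (λ i → 𝟙-≤1 (does (Sub.nonempty? (U i ∩ fibre π (π x))))))
    by-row : sum (rows U (π x)) < p ⊎ sum (rows U (π x)) ≡ p →
             Any (λ w → ¬ (p ∣ sum w)) (List.tabulate (rows U) List.++ List.tabulate (full U))
    by-row (inj₁ <p) = Any.++⁺ˡ (Any.tabulate⁺ (π x) (p∤ row≥1 <p))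
    by-row (inj₂ ≡p) = Any.++⁺ʳ (List.tabulate (rows U)) (Any.tabulate⁺ x
      (subst (λ m → ¬ (p ∣ m)) (sym (sum-full D x∈ ≡p)) (p∤ ℕ.≤-refl 1<p)))

  keys-in-sign : ¬ Mono 𝓕 π s c p N → ∀ {U} → Disjoint U → ∀ {k x} → x ∈ U k → ∀ m → m ≡ colours U →
                 Any (λ w → ¬ (p ∣ sum w)) (List.tabulate (hits U) List.++ inner m U)
  keys-in-sign ¬mono {U} D x∈ zero    eq = Any.++⁺ʳ (List.tabulate (hits U)) (inner-sign D x∈)
  keys-in-sign ¬mono {U} D x∈ (suc m) eq with k , pos ← sum-positive (λ k → sum (hits U k))
      (subst (1 ≤_) eq (s≤s z≤n)) =
    Any.++⁺ˡ (Any.tabulate⁺ k (p∤ pos (row-of-hits ¬mono D k)))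

  part? : ∀ (X : V n) i x → Dec (lookup X x ≡ just i)
  part? X i x = Maybe.≡-dec Fin._≟_ (lookup X x) (just i)

  in? : ∀ (X : V n) i x → Dec (x ∈ N × lookup X x ≡ just i)
  in? X i x = (x ∈? N) ×-dec part? X i x

  out? : ∀ (X : V n) i x → Dec (x ∉ N × lookup X x ≡ just i)
  out? X i x = ¬? (x ∈? N) ×-dec part? X i x

  -- Vectors keep a coordinate for every point, which saves re-indexing `N`: each signed point
  -- outside `N` raises the level by one and shows its sign through its own membership weight.
  ins outs : V n → Parts
  ins  X i = ⟪ in? X i ⟫
  outs X i = ⟪ out? X i ⟫

  just-unique : ∀ {a : Maybe (Fin p)} {i j} → a ≡ just i → a ≡ just j → i ≡ j
  just-unique eq eq′ = Maybe.just-injective (trans (sym eq) eq′)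

  ins-Disjoint : ∀ X → Disjoint (ins X)
  ins-Disjoint X = record
    { within   = λ i x∈ → proj₁ (∈⟪⟫⁻ (in? X i) x∈)
    ; disjoint = λ i j i≢j x x∈i x∈j → i≢j (just-unique (proj₂ (∈⟪⟫⁻ (in? X i) x∈i))
        (proj₂ (∈⟪⟫⁻ (in? X j) x∈j)))
    }

  outs-disjoint : ∀ X i j → i ≢ j → ∀ x → x ∈ outs X i → x ∉ outs X j
  outs-disjoint X i j i≢j x x∈i x∈j = i≢j (just-unique (proj₂ (∈⟪⟫⁻ (out? X i) x∈i))
      (proj₂ (∈⟪⟫⁻ (out? X j) x∈j)))

  ins-mono : ∀ X Y → X ≼ Y → ins X ⊑ ins Y
  ins-mono X Y X≼Y i {x} x∈ with x∈N , eq ← ∈⟪⟫⁻ (in? X i) x∈ = ∈⟪⟫⁺ (in? Y i) (x∈N , X≼Y x i eq)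

  outs-mono : ∀ X Y → X ≼ Y → outs X ⊑ outs Y
  outs-mono X Y X≼Y i {x} x∈ with x∉N , eq ← ∈⟪⟫⁻ (out? X i) x∈ = ∈⟪⟫⁺ (out? Y i) (x∉N , X≼Y x i eq)

  rot-injective : ∀ {i j} → rot i ≡ rot j → i ≡ j
  rot-injective {i} {j} eq = begin
    i                       ≡⟨ rot-period i ⟨
    iter rot q (rot i)      ≡⟨ cong (iter rot q) eq ⟩
    iter rot q (rot j)      ≡⟨ rot-period j ⟩
    j                       ∎
    where open ≡-Reasoning

  part-ρ⁺ : ∀ (X : V n) x {i} → lookup X x ≡ just i → lookup (ρ X) x ≡ just (rot i)
  part-ρ⁺ X x eq = trans (Vec.lookup-map x (Maybe.map rot) X) (cong (Maybe.map rot) eq)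

  part-ρ⁻ : ∀ (X : V n) x {i} → lookup (ρ X) x ≡ just (rot i) → lookup X x ≡ just i
  part-ρ⁻ X x eq with just-injective-map (trans (sym (Vec.lookup-map x (Maybe.map rot) X)) eq)
  ... | j , Xx , rot-eq = trans Xx (cong just (rot-injective rot-eq))

  ins-Rotated : ∀ X → RotatedParts (ins X) (ins (ρ X))
  ins-Rotated X i = Sub.⊆-antisym
    (λ {x} x∈ → let x∈N , eq = ∈⟪⟫⁻ (in? (ρ X) (rot i)) x∈ in ∈⟪⟫⁺ (in? X i) (x∈N , part-ρ⁻ X x eq))
    (λ {x} x∈ → let x∈N , eq = ∈⟪⟫⁻ (in? X i) x∈ in ∈⟪⟫⁺ (in? (ρ X) (rot i)) (x∈N , part-ρ⁺ X x eq))

  outs-Rotated : ∀ X → RotatedParts (outs X) (outs (ρ X))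
  outs-Rotated X i = Sub.⊆-antisym
    (λ {x} x∈ → let x∉N , eq = ∈⟪⟫⁻ (out? (ρ X) (rot i)) x∈ in ∈⟪⟫⁺ (out? X i) (x∉N , part-ρ⁻ X x eq))
    (λ {x} x∈ → let x∉N , eq = ∈⟪⟫⁻ (out? X i) x∈ in ∈⟪⟫⁺ (out? (ρ X) (rot i)) (x∉N , part-ρ⁺ X x eq))

  -- The bound that `rank≤α` puts on the rank of a vector without hits if `N` has no good partition.
  α : ℕ
  α = ∣ N ∣ ∸ suc (q * t)

  -- The first argument is the number of pairs (colour, part) with a hit; without hits the rank is at most α.
  height : ℕ → ℕ → ℕ
  height zero    rank = rank
  height (suc m) rank = α + suc m

  outsize : V n → ℕ
  outsize X = sum (λ i → ∣ outs X i ∣)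

  level : V n → ℕ
  level X = outsize X + height (colours (ins X)) (rank (ins X))

  sign : V n → Fin p
  sign X = sgn (keys (ins X) (outs X))

  height-mono : ∀ {m m′ r r′} → m ≤ m′ → r ≤ r′ → (m ≡ 0 → r ≤ α) → height m r ≤ height m′ r′
  height-mono {zero}  {zero}   _ r≤ _ = r≤
  height-mono {zero}  {suc m′} _ _ r≤α = ℕ.≤-trans (r≤α refl) (ℕ.m≤m+n α (suc m′))
  height-mono {suc m} {suc m′} m≤ _ _ = ℕ.+-monoʳ-≤ α m≤

  -- Ranks end at α and hit counts begin at α + 1, so a height reveals which of the two it records.
  height-squeeze : ∀ {m m′ r r′} → m ≤ m′ → (m ≡ 0 → r ≤ α) → height m r ≡ height m′ r′ →
                   m ≡ m′ × (m ≡ 0 → r ≡ r′)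
  height-squeeze {zero}  {zero}   _ _   eq = refl , λ _ → eq
  height-squeeze {zero}  {suc m′} _ r≤α eq = ⊥-elim (ℕ.<⇒≢ (begin-strict
    _                ≤⟨ r≤α refl ⟩
    α                <⟨ ℕ.m<m+n α (s≤s z≤n) ⟩
    α + suc m′       ∎) eq)
    where open ℕ.≤-Reasoning
  height-squeeze {suc m} {suc m′} _ _   eq = ℕ.+-cancelˡ-≡ α _ _ eq , λ ()

  outsize≤ : ∀ X → outsize X ≤ n ∸ ∣ N ∣
  outsize≤ X = subst (outsize X ≤_) (Sub.∣∁p∣≡n∸∣p∣ N) (sum-≤-∣∣ (∁ N) (outs X)
    (λ i x∈ → Sub.x∉p⇒x∈∁p (proj₁ (∈⟪⟫⁻ (out? X i) x∈))) (outs-disjoint X))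

  module _ (¬mono : ¬ Mono 𝓕 π s c p N) (¬good : ¬ Good 𝓕 ⌊ s /2⌋ t p N) where

    rank≤α : ∀ X → colours (ins X) ≡ 0 → rank (ins X) ≤ α
    rank≤α X eq = ℕ.m+n≤o⇒m≤o∸n _ (subst (_≤ ∣ N ∣) (sym (ℕ.+-suc (rank (ins X)) (q * t)))
      (rank-bound ¬good (ins-Disjoint X) eq))

    colours≤ : ∀ X → colours (ins X) ≤ q * t
    colours≤ X = subst (colours (ins X) ≤_) (ℕ.*-comm t q)
      (sum-bounded q (λ k → ℕ.≤-pred (row-of-hits ¬mono (ins-Disjoint X) k)))

    height≤ : ∀ X → height (colours (ins X)) (rank (ins X)) ≤ α + q * t
    height≤ X with colours (ins X) | colours≤ X | rank≤α X
    ... | zero  | _  | r≤α = ℕ.≤-trans (r≤α refl) (ℕ.m≤m+n α (q * t))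
    ... | suc m | m≤ | _   = ℕ.+-monoʳ-≤ α m≤

    large : q * t < ∣ N ∣
    large = ℕ.≰⇒> λ N≤ → ¬good (empty-good 𝓕 (⌊s/2⌋<∣F∣ {𝓕 = 𝓕} 𝓕-large) N≤)

    level< : ∀ X → level X < n
    level< X = begin-strict
      level X                              ≤⟨ ℕ.+-mono-≤ (outsize≤ X) (height≤ X) ⟩
      -- The `suc` in `α` leaves the one point that makes the inequality strict.
      n ∸ ∣ N ∣ + (α + q * t)              <⟨ ℕ.+-monoʳ-< (n ∸ ∣ N ∣) (ℕ.+-monoʳ-< α (ℕ.n<1+n (q * t))) ⟩
      n ∸ ∣ N ∣ + (α + suc (q * t))        ≡⟨ cong (n ∸ ∣ N ∣ +_) (ℕ.m∸n+n≡m large) ⟩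
      n ∸ ∣ N ∣ + ∣ N ∣                    ≡⟨ ℕ.m∸n+n≡m (Sub.∣p∣≤n N) ⟩
      n                                    ∎
      where open ℕ.≤-Reasoning

    positive : ∀ X → NonZero X → 1 ≤ level X
    positive X (x , i , eq) with x ∈? N
    ... | no x∉N = ℕ.≤-trans (ℕ.≤-trans (∣∣-nonempty (x , ∈⟪⟫⁺ (out? X i) (x∉N , eq)))
      (term≤sum (λ i → ∣ outs X i ∣) i)) (ℕ.m≤m+n (outsize X) _)
    ... | yes x∈N = ℕ.≤-trans height≥1 (ℕ.m≤n+m _ (outsize X))
      where
      U = ins X
      x∈U : x ∈ U i
      x∈U = ∈⟪⟫⁺ (in? X i) (x∈N , eq)
      block≥1 : 1 ≤ blocks U i
      block≥1 = ℕ.≤-trans (ℕ.≤-reflexive (sym (𝟙-yes (Sub.nonempty? (U i ∩ fibre π (π x)))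
          (x , ∈∩fibre⁺ π x∈U))))
                          (term≤sum (meets π (U i)) (π x))
      rank≥1 : 1 ≤ rank U
      rank≥1 = ℕ.≤-trans (ℕ.⊓-glb block≥1 (s≤s z≤n)) (term≤sum (levelled U) i)
      height≥1 : 1 ≤ height (colours U) (rank U)
      height≥1 with colours U
      ... | zero  = rank≥1
      ... | suc m = ℕ.≤-trans (s≤s z≤n) (ℕ.m≤n+m (suc m) α)

    level-mono : ∀ X Y → NonZero X → X ≼ Y → level X ≤ level Y
    level-mono X Y _ X≼Y = ℕ.+-mono-≤ (sum-mono (λ i → Sub.p⊆q⇒∣p∣≤∣q∣ (outs-mono X Y X≼Y i)))
      (height-mono (colours-mono (ins-mono X Y X≼Y)) (rank-mono (ins-mono X Y X≼Y)) (rank≤α X))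

    sign-equivariant : Equivariant sign
    sign-equivariant X (x , i , eq) = sgn-Rotated (keys-Rotated (ins-Rotated X) (outs-Rotated X)) any
      where
      any : Any (λ w → ¬ (p ∣ sum w)) (keys (ins X) (outs X))
      any with x ∈? N
      ... | no x∉N = Any.++⁺ˡ (Any.tabulate⁺ x (subst (λ m → ¬ (p ∣ m))
        (sym (sum-mem (outs X) (outs-disjoint X) (∈⟪⟫⁺ (out? X i) (x∉N , eq)))) (p∤ ℕ.≤-refl 1<p)))
      ... | yes x∈N = Any.++⁺ʳ (List.tabulate (λ x i → mem (outs X i) x))
        (keys-in-sign ¬mono (ins-Disjoint X) (∈⟪⟫⁺ (in? X i) (x∈N , eq)) (colours (ins X)) refl)

    same : ∀ X Y → NonZero X → X ≼ Y → level X ≡ level Y → sign X ≡ sign Y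
    same X Y _ X≼Y eq with eqO , eqH ← +-squeeze (sum-mono (λ i → Sub.p⊆q⇒∣p∣≤∣q∣ (outs-mono X Y X≼Y i)))
        (height-mono (colours-mono (ins-mono X Y X≼Y)) (rank-mono (ins-mono X Y X≼Y)) (rank≤α X)) eq
      with eqC , eqR ← height-squeeze (colours-mono (ins-mono X Y X≼Y)) (rank≤α X) eqH =
      sgn-cong (keys-squeeze (ins-Disjoint X) (ins-Disjoint Y) (ins-mono X Y X≼Y) (outs-mono X Y X≼Y) eqO eqC
          eqR)

theorem-prime : ∀ {r} → Prime r → Theorem r
theorem-prime {zero}  isPrime = ⊥-elim (¬prime[0] isPrime)
theorem-prime {suc q} isPrime {n} 𝓕 π N s t c N-small 𝓕-large c-bounded
  with mono? 𝓕 {π = π} {s} {c} {suc q} {N} | good? 𝓕 {⌊ s /2⌋} {t} {N} {suc q}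
... | yes m    | _         = inj₁ m
... | no  _    | yes g     = inj₂ g
... | no ¬mono | no ¬good  = ⊥-elim (impossible n 𝓕 π N N-small 𝓕-large c-bounded ¬mono ¬good)
  where
  -- `Z-Tucker` concerns vectors of positive length; for n = 0 the empty parts are good.
  impossible : ∀ n {l} (𝓕 : Family n) (π : Fin n → Fin l) N {c} → (∀ j → ∣ N ∩ fibre π j ∣ ≤ suc q) →
    (∀ F → 𝓕 F ≡ true → s < ∣ F ∣) → (∀ A → Vertex 𝓕 π ⌊ s /2⌋ A → c A < t) →
    ¬ Mono 𝓕 π s c (suc q) N → ¬ Good 𝓕 ⌊ s /2⌋ t (suc q) N → ⊥
  impossible zero 𝓕 π [] {c} N-small 𝓕-large c-bounded ¬mono ¬good =
    ¬good (empty-good 𝓕 (⌊s/2⌋<∣F∣ {𝓕 = 𝓕} 𝓕-large) z≤n)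
  impossible (suc m) 𝓕 π N {c} N-small 𝓕-large c-bounded ¬mono ¬good =
    Z-Tucker 1<p level sign (positive ¬mono ¬good) (λ X _ → ℕ.≤-pred (level< ¬mono ¬good X))
      (level-mono ¬mono ¬good) (same ¬mono ¬good) (sign-equivariant ¬mono ¬good)
    where
    open Sphere q using (Z-Tucker)
    open Signs q isPrime using (1<p)
    open PrimeStep q isPrime 𝓕 π N s t c N-small 𝓕-large c-bounded

-- Splitting sets, trimming and balancing equitable families

─-+-≤ : ∀ {n} {A B : Subset n} → A ⊆ B → ∣ B ─ A ∣ + ∣ A ∣ ≤ ∣ B ∣
─-+-≤ {n} {A} {B} A⊆B = ℕ.≤-trans (ℕ.≤-reflexive (cong (∣ B ─ A ∣ +_) (sym (ℕ.+-identityʳ ∣ A ∣))))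
  (sum-≤-∣∣ B halves halves⊆ halves-disjoint)
  where
  halves : Fin 2 → Subset n
  halves zero    = B ─ A
  halves (suc _) = A
  halves⊆ : ∀ i → halves i ⊆ B
  halves⊆ zero       = Sub.p─q⊆p B A
  halves⊆ (suc zero) = A⊆B
  halves-disjoint : ∀ i j → i ≢ j → ∀ x → x ∈ halves i → x ∉ halves j
  halves-disjoint zero       zero       i≢j x x∈i x∈j = i≢j refl
  halves-disjoint zero       (suc zero) i≢j x x∈i x∈j = proj₂ (x∈p─q⁻ B A x∈i) x∈j
  halves-disjoint (suc zero) zero       i≢j x x∈i x∈j = proj₂ (x∈p─q⁻ B A x∈j) x∈i
  halves-disjoint (suc zero) (suc zero) i≢j x x∈i x∈j = i≢j refl

-- Greedy: the first piece takes a points, or all of `B` if there are fewer.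
split-into : ∀ {n} b a (B : Subset n) → ∣ B ∣ ≤ suc b * a → ∃[ κ ] ∀ (k : Fin (suc b)) → ∣ B ∩ fibre κ k ∣ ≤ a
split-into zero    a B B≤ = (λ _ → zero) , λ k →
    ℕ.≤-trans (Sub.∣p∩q∣≤∣p∣ B _) (subst (∣ B ∣ ≤_) (ℕ.+-identityʳ a) B≤)
split-into {n} (suc b) a B B≤ = κ , bound
  where
  first = subset-of-size B (∣ B ∣ ⊓ a) (ℕ.m⊓n≤m ∣ B ∣ a)
  A = proj₁ first
  A⊆B = proj₁ (proj₂ first)
  ∣A∣ = proj₂ (proj₂ first)
  rest-bound : ∣ B ∣ ≤ a ⊎ a ≤ ∣ B ∣ → ∣ B ─ A ∣ ≤ suc b * a
  rest-bound (inj₁ B≤a) = ℕ.≤-trans (ℕ.+-cancelʳ-≤ ∣ A ∣ _ 0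
    (ℕ.≤-trans (─-+-≤ A⊆B) (ℕ.≤-reflexive (sym (trans ∣A∣ (ℕ.m≤n⇒m⊓n≡m B≤a)))))) z≤n
  rest-bound (inj₂ a≤B) = ℕ.+-cancelʳ-≤ ∣ A ∣ _ (suc b * a) (begin
    ∣ B ─ A ∣ + ∣ A ∣   ≤⟨ ─-+-≤ A⊆B ⟩
    ∣ B ∣               ≤⟨ B≤ ⟩
    a + suc b * a       ≡⟨ ℕ.+-comm a (suc b * a) ⟩
    suc b * a + a       ≡⟨ cong (suc b * a +_) (trans ∣A∣ (ℕ.m≥n⇒m⊓n≡n a≤B)) ⟨
    suc b * a + ∣ A ∣   ∎)
    where open ℕ.≤-Reasoning
  rest = split-into b a (B ─ A) (rest-bound (ℕ.≤-total ∣ B ∣ a))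
  κ : Fin n → Fin (suc (suc b))
  κ x with x ∈? A
  ... | yes _ = zero
  ... | no  _ = suc (proj₁ rest x)
  κ-zero : ∀ x → κ x ≡ zero → x ∈ A
  κ-zero x eq with x ∈? A
  ... | yes x∈A = x∈A
  κ-suc : ∀ x {k} → κ x ≡ suc k → x ∉ A × proj₁ rest x ≡ k
  κ-suc x eq with x ∈? A
  κ-suc x refl | no x∉A = x∉A , refl
  bound : ∀ k → ∣ B ∩ fibre κ k ∣ ≤ a
  bound zero = ℕ.≤-trans (Sub.p⊆q⇒∣p∣≤∣q∣ {p = B ∩ fibre κ zero} (λ {x} x∈ →
      κ-zero x (proj₂ (∈∩fibre⁻ κ {B} x∈))))
    (ℕ.≤-trans (ℕ.≤-reflexive ∣A∣) (ℕ.m⊓n≤n ∣ B ∣ a))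
  bound (suc k) = ℕ.≤-trans (Sub.p⊆q⇒∣p∣≤∣q∣ into) (proj₂ rest k)
    where
    into : B ∩ fibre κ (suc k) ⊆ (B ─ A) ∩ fibre (proj₁ rest) k
    into {x} x∈ with x∈B , eq ← ∈∩fibre⁻ κ x∈ with x∉A , eq′ ← κ-suc x eq =
      Sub.x∈p∩q⁺ (Sub.x∈p∧x∉q⇒x∈p─q x∈B x∉A , ∈fibre⁺ (proj₁ rest) eq′)

Equitable : ∀ {r} → (Fin r → ℕ) → Set
Equitable y = ∀ i j → y i ≤ suc (y j)

greatest : ∀ {m} (f : Fin (suc m) → ℕ) → ∃[ i ] ∀ j → f j ≤ f i
greatest f = extremum {λ a b → b ≤ a} (λ p q → ℕ.≤-trans q p) (λ a b → ℕ.≤-total b a) f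

-- One unit at a time is taken from a greatest entry, which keeps the family equitable.
trim : ∀ {b} d a (y : Fin (suc b) → ℕ) → Equitable y → sum y ≡ d + a →
       ∃[ z ] ((∀ k → z k ≤ y k) × Equitable z × sum z ≡ a)
trim zero    a y eq-y sum≡ = y , (λ k → ℕ.≤-refl) , eq-y , sum≡
trim {b} (suc d) a y eq-y sum≡ =
  let z , z≤ , eq-z , sum-z = trim d a y′ eq-y′ sum-y′ in z , (λ k → ℕ.≤-trans (z≤ k) (y′≤y k)) , eq-z , sum-z
  where
  k = proj₁ (greatest y)
  k-greatest = proj₂ (greatest y)
  y′ : Fin (suc b) → ℕ
  y′ j = y j ∸ 𝟙 (does (j Fin.≟ k))
  y′≤y : ∀ j → y′ j ≤ y j
  y′≤y j = ℕ.m∸n≤m (y j) (𝟙 (does (j Fin.≟ k)))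
  yk≥1 : 1 ≤ y k
  yk≥1 with i , yi≥1 ← sum-positive y (subst (1 ≤_) (sym sum≡) (s≤s z≤n)) = ℕ.≤-trans yi≥1 (k-greatest i)
  y′+ : ∀ j → y j ≡ y′ j + 𝟙 (does (j Fin.≟ k))
  y′+ j with j Fin.≟ k
  ... | yes refl = sym (ℕ.m∸n+n≡m yk≥1)
  ... | no  _    = sym (ℕ.+-identityʳ (y j))
  eq-y′ : Equitable y′
  eq-y′ i j with j Fin.≟ k
  ... | no  _    = ℕ.≤-trans (y′≤y i) (eq-y i j)
  ... | yes refl = ℕ.≤-trans (y′≤y i) (ℕ.≤-trans (k-greatest i)
      (ℕ.≤-reflexive (trans (sym (ℕ.m∸n+n≡m yk≥1)) (ℕ.+-comm (y k ∸ 1) 1))))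
  sum-y′ : sum y′ ≡ d + a
  sum-y′ = ℕ.+-cancelʳ-≡ 1 (sum y′) (d + a) (begin
    sum y′ + 1                                 ≡⟨ cong (sum y′ +_) (sum-𝟙-unique k) ⟨
    sum y′ + sum (λ j → 𝟙 (does (j Fin.≟ k)))  ≡⟨ ∑-distrib-+ y′ (λ j → 𝟙 (does (j Fin.≟ k))) ⟨
    sum (λ j → y′ j + 𝟙 (does (j Fin.≟ k)))    ≡⟨ sum-cong-≗ y′+ ⟨
    sum y                                      ≡⟨ sum≡ ⟩
    suc (d + a)                                ≡⟨ ℕ.+-comm 1 (d + a) ⟩
    d + a + 1                                  ∎)
    where open ≡-Reasoning

-- If z j were at least y i + 2, all z k would be at least y i + 1 and all y k at most y i + 1,
-- strictly at j and at i respectively; the sums would then differ by at least two.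
balance : ∀ {b} {y z : Fin b → ℕ} → Equitable y → Equitable z → sum z ≤ suc (sum y) → ∀ i j → z j ≤ suc (y i)
balance {b} {y} {z} eq-y eq-z sum≤ i j = ℕ.≮⇒≥ λ lt → ℕ.<⇒≱ (begin-strict
  suc (sum y)                       ≤⟨ sum-mono-< (λ k → eq-y k i) i (ℕ.n<1+n (y i)) ⟩
  sum {b} (λ _ → suc (y i))         <⟨ sum-mono-< (λ k → ℕ.≤-pred (ℕ.≤-trans lt (eq-z j k))) j lt ⟩
  sum z                             ∎) sum≤
  where open ℕ.≤-Reasoning

split-injective : ∀ a b {i j : Fin (a * b)} → remQuot {a} b i ≡ remQuot {a} b j → i ≡ j
split-injective a b {i} {j} eq = begin
  i                                 ≡⟨ Fin.combine-remQuot {a} b i ⟨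
  uncurry combine (remQuot {a} b i) ≡⟨ cong (uncurry combine) eq ⟩
  uncurry combine (remQuot {a} b j) ≡⟨ Fin.combine-remQuot {a} b j ⟩
  j                                 ∎
  where open ≡-Reasoning

trim-parts : ∀ {n} m b (Y : Fin (suc b) → Subset n) → Equitable (λ k → ∣ Y k ∣) → m ≤ sum (λ k → ∣ Y k ∣) →
  Σ[ Z ∈ (Fin (suc b) → Subset n) ] ((∀ k → Z k ⊆ Y k) × Equitable (λ k → ∣ Z k ∣) × sum (λ k → ∣ Z k ∣) ≡ m)
trim-parts m b Y eq-Y m≤ with z , z≤ , eq-z , sum-z ← trim (sum (λ k → ∣ Y k ∣) ∸ m) m (λ k → ∣ Y k ∣) eq-Y
    (sym (ℕ.m∸n+n≡m m≤)) =
  (λ k → proj₁ (chosen k)) , (λ k → proj₁ (proj₂ (chosen k))) ,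
  (λ i j → subst₂ (λ u v → u ≤ suc v) (sym (proj₂ (proj₂ (chosen i)))) (sym (proj₂ (proj₂ (chosen j))))
      (eq-z i j)) ,
  trans (sum-cong-≗ (λ k → proj₂ (proj₂ (chosen k)))) sum-z
  where
  chosen : ∀ k → ∃[ B ] (B ⊆ Y k × ∣ B ∣ ≡ z k)
  chosen k = subset-of-size (Y k) (z k) (z≤ k)

module _ {n a b h t : ℕ} (𝓕 : Family n) {N : Subset n} (X : Fin (suc a) → Subset n) (Y : Fin (suc a) →
    Fin (suc b) → Subset n)
  (X-within : ∀ i → X i ⊆ N) (X-disjoint : ∀ i j → i ≢ j → ∀ x → x ∈ X i → x ∉ X j)
  (X-equitable : Equitable (λ i → ∣ X i ∣)) (X-large : ∣ N ∣ ≤ sum (λ i → ∣ X i ∣) + a * t)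
  (Y-good : ∀ i → IsGood 𝓕 h t (X i) (Y i)) where

  private
    module Y i = IsGood (Y-good i)

    -- `Y i` covers between |X i| - b t and |X i| points. Cutting it to the lower bound makes the
    -- totals for different i differ by at most one, as `balance` demands.
    size : Fin (suc a) → ℕ
    size i = ∣ X i ∣ ∸ b * t

    size-equitable : Equitable size
    size-equitable i j = ℕ.m≤n+o⇒m∸n≤o ∣ X i ∣ (b * t) (ℕ.≤-trans (X-equitable i j)
      (subst (suc ∣ X j ∣ ≤_) (sym (ℕ.+-suc (b * t) (size j))) (s≤s (ℕ.m≤n+m∸n ∣ X j ∣ (b * t)))))

  refine-trimmed : (Z : Fin (suc a) → Fin (suc b) → Subset n) → (∀ i k → Z i k ⊆ Y i k) →
    (∀ i → Equitable (λ k → ∣ Z i k ∣)) → (∀ i → sum (λ k → ∣ Z i k ∣) ≡ size i) →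
    Good 𝓕 h t (suc a * suc b) N
  refine-trimmed Z Z⊆Y Z-equitable Z-size = good 𝓕 (Z′ ∘ split) record
    { within    = λ i → X-within _ ∘ Y.within _ _ ∘ Z⊆Y _ _
    ; disjoint  = λ i j i≢j → apart (split i) (split j) (λ eq → i≢j (split-injective (suc a) (suc b) eq))
    ; equitable = λ i j → balanced (split i) (split j)
    ; free      = λ { i (F , F∈𝓕 , near) → Y.free _ _ (F , F∈𝓕 , ℕ.≤-trans (─-antimono F (Z⊆Y _ _)) near) }
    ; large     = Z-large
    }
    where
    split : Fin (suc a * suc b) → Fin (suc a) × Fin (suc b)
    split = remQuot {suc a} (suc b)
    Z′ : Fin (suc a) × Fin (suc b) → Subset n
    Z′ (i , k) = Z i k
    balanced : ∀ ik jl → ∣ Z′ ik ∣ ≤ suc ∣ Z′ jl ∣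
    balanced (i , k) (j , l) = balance (Z-equitable j) (Z-equitable i)
      (subst₂ (λ u v → u ≤ suc v) (sym (Z-size i)) (sym (Z-size j)) (size-equitable i j)) l k
    apart : ∀ ik jl → ik ≢ jl → ∀ x → x ∈ Z′ ik → x ∉ Z′ jl
    apart (i , k) (j , l) ne x x∈i x∈j with i Fin.≟ j
    ... | yes refl = Y.disjoint i k l (λ k≡l → ne (cong (i ,_) k≡l)) x (Z⊆Y i k x∈i) (Z⊆Y i l x∈j)
    ... | no  i≢j  = X-disjoint i j i≢j x (Y.within i k (Z⊆Y i k x∈i)) (Y.within j l (Z⊆Y j l x∈j))
    sum-Z : sum (λ i → ∣ Z′ (split i) ∣) ≡ sum size
    sum-Z = begin
      sum (λ i → ∣ Z′ (split i) ∣)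
        ≡⟨ sum-combine (suc a) {suc b} (λ i → ∣ Z′ (split i) ∣) ⟩
      sum (λ i → sum (λ k → ∣ Z′ (split (combine {suc a} i k)) ∣))
        ≡⟨ sum-cong-≗ {suc a} (λ i → sum-cong-≗ {suc b}
            (λ k → cong (λ ik → ∣ Z′ ik ∣) (Fin.remQuot-combine {suc a} i k))) ⟩
      sum (λ i → sum (λ k → ∣ Z i k ∣))                                 ≡⟨ sum-cong-≗ {suc a} Z-size ⟩
      sum size                                                          ∎
      where open ≡-Reasoning
    X-sum : sum (λ i → ∣ X i ∣) ≤ sum size + suc a * (b * t)
    X-sum = ℕ.≤-trans (sum-mono (λ i → ℕ.≤-trans (ℕ.m≤n+m∸n ∣ X i ∣ (b * t))
        (ℕ.≤-reflexive (ℕ.+-comm (b * t) (size i)))))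
      (ℕ.≤-reflexive (trans (∑-distrib-+ {suc a} size (λ _ → b * t))
          (cong (sum size +_) (sum-const (suc a) (b * t)))))
    -- Each of the a + 1 groups loses b t points and the coarse partition a t, together ((a + 1)(b +
    -- 1) - 1) t.
    alg : ∀ S a b t → S + suc a * (b * t) + a * t ≡ S + (b + a * suc b) * t
    alg = solve-∀
    Z-large : ∣ N ∣ ≤ sum (λ i → ∣ Z′ (split i) ∣) + (b + a * suc b) * t
    Z-large = begin
      ∣ N ∣                                                  ≤⟨ X-large ⟩
      sum (λ i → ∣ X i ∣) + a * t                            ≤⟨ ℕ.+-monoˡ-≤ (a * t) X-sum ⟩
      sum size + suc a * (b * t) + a * t                     ≡⟨ alg (sum size) a b t ⟩
      sum size + (b + a * suc b) * t                         ≡⟨ cong (_+ (b + a * suc b) * t) sum-Z ⟨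
      sum (λ i → ∣ Z′ (split i) ∣) + (b + a * suc b) * t     ∎
      where open ℕ.≤-Reasoning

  refine-good : Good 𝓕 h t (suc a * suc b) N
  refine-good = refine-trimmed (λ i → proj₁ (trimmed i)) (λ i → proj₁ (proj₂ (trimmed i)))
    (λ i → proj₁ (proj₂ (proj₂ (trimmed i)))) (λ i → proj₂ (proj₂ (proj₂ (trimmed i))))
    where
    size≤ : ∀ i → size i ≤ sum (λ k → ∣ Y i k ∣)
    size≤ i = ℕ.m≤n+o⇒m∸n≤o ∣ X i ∣ (b * t) (subst (∣ X i ∣ ≤_) (ℕ.+-comm _ (b * t)) (Y.large i))
    trimmed : ∀ i → _
    trimmed i = trim-parts (size i) b (Y i) (Y.equitable i) (size≤ i)

not-does⇒¬ : {P : Set} (P? : Dec P) → not (does P?) ≡ true → ¬ P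
not-does⇒¬ (no ¬p) _ = ¬p

not-does≢⇒ : {P : Set} (P? : Dec P) → not (does P?) ≢ true → P
not-does≢⇒ (yes p) _  = p
not-does≢⇒ (no  _) ne = ⊥-elim (ne refl)

-- Products and induction on r

module Composite (a b : ℕ) (theorem-a : Theorem (suc a)) (theorem-b : Theorem (suc b))
  {n l : ℕ} (𝓕 : Family n) (π : Fin n → Fin l) (N : Subset n) (s t : ℕ) (c : Subset n → ℕ)
  (N-small : ∀ j → ∣ N ∩ fibre π j ∣ ≤ suc a * suc b)
  (𝓕-large : ∀ F → 𝓕 F ≡ true → s < ∣ F ∣)
  (c-bounded : ∀ A → Vertex 𝓕 π ⌊ s /2⌋ A → c A < t) where

  h = ⌊ s /2⌋

  -- The sets that are too large for a good partition into suc b parts, hence contain monochromatic edges.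
  𝓣 : Family n
  𝓣 M = not (does (good? 𝓕 {h} {t} {M} {suc b}))

  𝓣⇒¬good : ∀ {M} → 𝓣 M ≡ true → ¬ Good 𝓕 h t (suc b) M
  𝓣⇒¬good = not-does⇒¬ (good? 𝓕)

  ¬𝓣⇒good : ∀ {M} → 𝓣 M ≢ true → Good 𝓕 h t (suc b) M
  ¬𝓣⇒good = not-does≢⇒ (good? 𝓕)

  𝓣-large : ∀ M → 𝓣 M ≡ true → 0 < ∣ M ∣
  𝓣-large M eq = ℕ.≰⇒> λ M≤0 → 𝓣⇒¬good eq (empty-good 𝓕 (⌊s/2⌋<∣F∣ {𝓕 = 𝓕} 𝓕-large) (ℕ.≤-trans M≤0 z≤n))

  groups : ∀ j → ∃[ κ ] ∀ (k : Fin (suc b)) → ∣ (N ∩ fibre π j) ∩ fibre κ k ∣ ≤ suc a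
  groups j = split-into b (suc a) (N ∩ fibre π j) (subst (∣ N ∩ fibre π j ∣ ≤_) (ℕ.*-comm (suc a) (suc b))
      (N-small j))

  κ : Fin l → Fin n → Fin (suc b)
  κ j = proj₁ (groups j)

  refined : Fin n → Fin (l * suc b)
  refined x = combine (π x) (κ (π x) x)

  N-small-refined : ∀ i → ∣ N ∩ fibre refined i ∣ ≤ suc a
  N-small-refined i with j , k , refl ← Fin.combine-surjective {l} {suc b} i =
    ℕ.≤-trans (Sub.p⊆q⇒∣p∣≤∣q∣ into) (proj₂ (groups j) k)
    where
    into : N ∩ fibre refined (combine j k) ⊆ (N ∩ fibre π j) ∩ fibre (κ j) k
    into {x} x∈ with x∈N , eq ← ∈∩fibre⁻ refined x∈ with refl , refl ← Fin.combine-injective (π x) (κ (π x) x)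
        j k eq =
      ∈∩fibre⁺ (κ (π x)) (∈∩fibre⁺ π x∈N)

  -- Stability with bound 0 leaves at most one point in each of the b + 1 pieces of a block; so `M`
  -- can be the ground set in `theorem-b`.
  stable⇒small : ∀ {M} → Stable refined 0 M → ∀ j → ∣ M ∩ fibre π j ∣ ≤ suc b
  stable⇒small {M} stable j = begin
    ∣ M ∩ fibre π j ∣                                   ≤⟨ ∣∣-≤-sum-fibres (κ j) (M ∩ fibre π j) ⟩
    sum (λ k → ∣ (M ∩ fibre π j) ∩ fibre (κ j) k ∣)     ≤⟨ sum-bounded 1 bound ⟩
    suc b * 1                                           ≡⟨ ℕ.*-identityʳ (suc b) ⟩
    suc b                                               ∎
    where
    open ℕ.≤-Reasoning
    into : ∀ k → (M ∩ fibre π j) ∩ fibre (κ j) k ⊆ M ∩ fibre refined (combine j k)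
    into k x∈ with x∈′ , eq ← ∈∩fibre⁻ (κ j) x∈ with x∈M , refl ← ∈∩fibre⁻ π x∈′ =
      Sub.x∈p∩q⁺ (x∈M , ∈fibre⁺ refined (cong (combine j) eq))
    bound : ∀ k → ∣ (M ∩ fibre π j) ∩ fibre (κ j) k ∣ ≤ 1
    bound k = ℕ.≤-trans (Sub.p⊆q⇒∣p∣≤∣q∣ (into k)) (ℕ.m∸n≡0⇒m≤n (ℕ.n≤0⇒n≡0
      (ℕ.≤-trans (term≤sum (λ i → ∣ M ∩ fibre refined i ∣ ∸ 1) (combine j k)) stable)))

  -- The edge comes from the decision procedure, so that the colour depends on the set alone; 0 is a
  -- default for sets without an edge.
  colour : Subset n → ℕ
  colour M with mono? 𝓕 {π = π} {s} {c} {suc b} {M}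
  ... | yes (e , _) = c (lookup e zero)
  ... | no  _       = 0

  edge : ∀ M → Vertex 𝓣 refined 0 M → Σ[ m ∈ Mono 𝓕 π s c (suc b) M ] colour M ≡ c (lookup (proj₁ m) zero)
  edge M (M∈𝓣 , stable) with mono? 𝓕 {π = π} {s} {c} {suc b} {M}
  ... | yes m = m , refl
  ... | no ¬m with theorem-b 𝓕 π M s t c (stable⇒small {M} stable) 𝓕-large c-bounded
  ...   | inj₁ m = ⊥-elim (¬m m)
  ...   | inj₂ g = ⊥-elim (𝓣⇒¬good M∈𝓣 g)

  colour-bounded : ∀ M → Vertex 𝓣 refined 0 M → colour M < t
  colour-bounded M v = subst (_< t) (sym (proj₂ (edge M v)))
    (c-bounded _ (IsMono.vertex (proj₂ (proj₁ (edge M v))) zero))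

  ─≤0⇒⊆ : ∀ {A B : Subset n} → ∣ A ─ B ∣ ≤ 0 → A ⊆ B
  ─≤0⇒⊆ {A} {B} A─B≤0 {x} x∈A with x ∈? B
  ... | yes x∈B = x∈B
  ... | no  x∉B = ⊥-elim (ℕ.<⇒≱ (∣∣-nonempty (x , Sub.x∈p∧x∉q⇒x∈p─q x∈A x∉B)) A─B≤0)

  -- With s = 0 the members of an edge of `𝓣` are pairwise disjoint subsets of `N`; sets from edges
  -- inside different members therefore share at most s points.
  join-edges : Mono 𝓣 refined 0 colour (suc a) N → Mono 𝓕 π s c (suc a * suc b) N
  join-edges (Ms , m) = mono-edge 𝓕 (λ i → e (split i)) record
    { vertex  = λ i → IsMono.vertex (edges (proj₁ (split i))) (proj₂ (split i))
    ; near    = λ i → ℕ.≤-trans (─-antimono (e (split i)) (─≤0⇒⊆ (near (proj₁ (split i)))))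
                  (IsMono.near (edges (proj₁ (split i))) (proj₂ (split i)))
    ; small-∩ = λ i j i≢j → apart (split i) (split j) λ eq → i≢j (split-injective (suc a) (suc b) eq)
    ; mono    = λ i j → trans (e-colour (split i)) (trans (mono _ _) (sym (e-colour (split j))))
    }
    where
    open IsMono m
    M : Fin (suc a) → Subset n
    M = lookup Ms
    split : Fin (suc a * suc b) → Fin (suc a) × Fin (suc b)
    split = remQuot {suc a} (suc b)
    e : Fin (suc a) × Fin (suc b) → Subset n
    e (i , k) = lookup (proj₁ (proj₁ (edge (M i) (vertex i)))) k
    edges : ∀ i → IsMono 𝓕 π s c (M i) (λ k → e (i , k))
    edges i = proj₂ (proj₁ (edge (M i) (vertex i)))
    e-colour : ∀ ik → c (e ik) ≡ colour (M (proj₁ ik))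
    e-colour (i , k) = trans (IsMono.mono (edges i) k zero) (sym (proj₂ (edge (M i) (vertex i))))
    apart : ∀ ik jl → ik ≢ jl → ∣ e ik ∩ e jl ∣ ≤ s
    apart (i , k) (j , l) ne with i Fin.≟ j
    ... | yes refl = IsMono.small-∩ (edges i) k l (λ k≡l → ne (cong (i ,_) k≡l))
    ... | no  i≢j  = near-disjoint s (e (i , k)) (e (j , l))
      (λ x x∈i x∈j → ℕ.<⇒≱ (∣∣-nonempty (x , Sub.x∈p∩q⁺ (x∈i , x∈j))) (small-∩ i j i≢j))
      (IsMono.near (edges i) k) (IsMono.near (edges j) l)

  -- A part in `𝓣` would be a member contained in itself, against freeness, so each part has a good
  -- partition of its own.
  join-parts : Good 𝓣 0 t (suc a) N → Good 𝓕 h t (suc a * suc b) N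
  join-parts (Xs , g) = refine-good 𝓕 (lookup Xs) (λ i → lookup (proj₁ (X-good i))) within disjoint equitable
      large (λ i → proj₂ (X-good i))
    where
    open IsGood g
    X-good : ∀ i → Good 𝓕 h t (suc b) (lookup Xs i)
    X-good i = ¬𝓣⇒good λ eq → free i (lookup Xs i , eq , ℕ.≤-reflexive (∣∣-empty λ { (x , x∈) →
      let x∈X , x∉X = x∈p─q⁻ (lookup Xs i) (lookup Xs i) x∈ in x∉X x∈X }))

  theorem-composite : Mono 𝓕 π s c (suc a * suc b) N ⊎ Good 𝓕 h t (suc a * suc b) N
  theorem-composite = Sum.map join-edges join-parts
    (theorem-a 𝓣 refined N 0 t colour N-small-refined 𝓣-large colour-bounded)

theorem-* : ∀ a b → Theorem a → Theorem b → 1 ≤ a → 1 ≤ b → Theorem (a * b)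
theorem-* (suc a) (suc b) theorem-a theorem-b _ _ = Composite.theorem-composite a b theorem-a theorem-b

theorem-all : ∀ r → 2 ≤ r → Theorem r
theorem-all = <-rec (λ r → 2 ≤ r → Theorem r) step
  where
  step : ∀ r → (∀ {k} → k < r → 2 ≤ k → Theorem k) → 2 ≤ r → Theorem r
  step r ih 2≤r with prime? r
  ... | yes isPrime = theorem-prime isPrime
  ... | no ¬prime with ¬prime⇒composite {{n>1⇒nonTrivial 2≤r}} ¬prime
  ...   | composite {d} d<r d∣r = subst Theorem (sym (ℕ.m∣n⇒n≡quotient*m d∣r))
    (theorem-* k d (ih k<r 2≤k) (ih d<r 2≤d) (ℕ.<⇒≤ 2≤k) (ℕ.<⇒≤ 2≤d))
    where
    k = ℕ.quotient d∣r
    2≤d : 2 ≤ d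
    2≤d = nonTrivial⇒n>1 d
    2≤k : 2 ≤ k
    2≤k = ℕ.quotient>1 d∣r d<r
    k<r : k < r
    k<r = ℕ.quotient-< d∣r {{n>1⇒nonTrivial 2≤d}} {{>-nonZero (ℕ.<⇒≤ 2≤r)}}

-- Return to chromatic number and equitable colourability defect

⌈/⌉≤ : ∀ {m d χ} → m ≤ suc d * χ → ⌈ m / suc d ⌉ ≤ χ
⌈/⌉≤ {m} {d} {χ} m≤ = ℕ.≤-pred (ℕ.m<n*o⇒m/o<n {m + d} {suc χ} {suc d} (begin-strict
  m + d                ≤⟨ ℕ.+-monoˡ-≤ d m≤ ⟩
  suc d * χ + d        <⟨ ℕ.n<1+n _ ⟩
  suc (suc d * χ + d)  ≡⟨ alg d χ ⟩
  suc χ * suc d        ∎))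
  where
  open ℕ.≤-Reasoning
  alg : ∀ d χ → suc (suc d * χ + d) ≡ suc χ * suc d
  alg = solve-∀

module Translation {n l s : ℕ} (P : Fin l → Subset n) (isPartition : IsPartition P) (𝓕 : Family n) where
  open IsPartition isPartition

  π : Fin n → Fin l
  π x = proj₁ (covering x)

  P≡fibre : ∀ j → P j ≡ fibre π j
  P≡fibre j = Sub.⊆-antisym (∈fibre⁺ π ∘ only) (λ {x} x∈ →
      subst (λ i → x ∈ P i) (∈fibre⁻ π x∈) (proj₂ (covering x)))
    where
    only : ∀ {x} → x ∈ P j → π x ≡ j
    only {x} x∈ with π x Fin.≟ j
    ... | yes eq = eq
    ... | no  ne = ⊥-elim (disjoint (π x) j ne x (proj₂ (covering x)) x∈)

  excess≡ : ∀ A → Vec.sum (tabulate (λ i → ∣ A ∩ P i ∣ ∸ 1)) ≡ sum (λ j → ∣ A ∩ fibre π j ∣ ∸ 1)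
  excess≡ A = trans (sum-tabulate (λ i → ∣ A ∩ P i ∣ ∸ 1))
      (sum-cong-≗ {l} (λ j → cong (λ B → ∣ A ∩ B ∣ ∸ 1) (P≡fibre j)))

  toVertex : ∀ {A} → IsVertex 𝓕 P s A → Vertex 𝓕 π ⌊ s /2⌋ A
  toVertex {A} (A∈𝓕 , le) = A∈𝓕 , subst (_≤ ⌊ s /2⌋) (excess≡ A) le

  fromVertex : ∀ {A} → Vertex 𝓕 π ⌊ s /2⌋ A → IsVertex 𝓕 P s A
  fromVertex {A} (A∈𝓕 , le) = A∈𝓕 , subst (_≤ ⌊ s /2⌋) (sym (excess≡ A)) le

  -- A colouring receives the proof of being a vertex as an argument; uniqueness of this proof makes
  -- the colour a function of the set.
  IsVertex-irrelevant : ∀ {A} (v w : IsVertex 𝓕 P s A) → v ≡ w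
  IsVertex-irrelevant (v₁ , v₂) (w₁ , w₂) = cong₂ _,_ (Decidable⇒UIP.≡-irrelevant Bool._≟_ v₁ w₁)
      (ℕ.≤-irrelevant v₂ w₂)

  module _ {k : ℕ} (col : Colouring 𝓕 P s k) where

    colourℕ : Subset n → ℕ
    colourℕ A with vertex? 𝓕 π ⌊ s /2⌋ A
    ... | yes v = toℕ (col A (fromVertex v))
    ... | no  _ = 0

    colourℕ≡ : ∀ {A} (v : IsVertex 𝓕 P s A) → colourℕ A ≡ toℕ (col A v)
    colourℕ≡ {A} v with vertex? 𝓕 π ⌊ s /2⌋ A
    ... | yes w = cong (toℕ ∘ col A) (IsVertex-irrelevant (fromVertex w) v)
    ... | no ¬v = ⊥-elim (¬v (toVertex v))

    colourℕ<k : ∀ A → Vertex 𝓕 π ⌊ s /2⌋ A → colourℕ A < k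
    colourℕ<k A v = subst (_< k) (sym (colourℕ≡ (fromVertex v))) (Fin.toℕ<n _)

    module _ {r : ℕ} (proper : IsProper 𝓕 P s r k col) (𝓕-large : ∀ F → 𝓕 F ≡ true → s < ∣ F ∣) where

      ¬mono : ∀ {N} → ¬ Mono 𝓕 π s colourℕ r N
      ¬mono (es , m) = proper (lookup es) (vertices , distinct , small-∩) λ i j → Fin.toℕ-injective (begin
        toℕ (col (lookup es i) (vertices i))   ≡⟨ colourℕ≡ (vertices i) ⟨
        colourℕ (lookup es i)                  ≡⟨ mono i j ⟩
        colourℕ (lookup es j)                  ≡⟨ colourℕ≡ (vertices j) ⟩
        toℕ (col (lookup es j) (vertices j))   ∎)
        where
        open ≡-Reasoning
        open IsMono m
        vertices : ∀ i → IsVertex 𝓕 P s (lookup es i)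
        vertices i = fromVertex (vertex i)
        distinct : ∀ i j → i ≢ j → lookup es i ≢ lookup es j
        distinct i j i≢j eq = ℕ.<⇒≱ (𝓕-large (lookup es i) (proj₁ (vertex i)))
          (subst (λ A → ∣ A ∣ ≤ s) (trans (cong (lookup es i ∩_) (sym eq)) (Sub.∩-idem (lookup es i)))
              (small-∩ i j i≢j))

good⇒admissible : ∀ {n r h t} (𝓕 : Family n) → Good 𝓕 h t r ⊤ →
    ∃[ X₀ ] (∣ X₀ ∣ ≤ (r ∸ 1) * t × EcdAdmissible r 𝓕 h X₀)
good⇒admissible {n} {r} {h} {t} 𝓕 (Xs , g) = X₀ , X₀-small , lookup Xs , partition , free′
  where
  open IsGood g
  outside? : ∀ x → Dec (¬ (∃[ i ] x ∈ lookup Xs i))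
  outside? x = ¬? (Fin.any? (λ i → x ∈? lookup Xs i))
  X₀ = ⟪ outside? ⟫
  partition : IsEquitablePartition X₀ (lookup Xs)
  partition = record
    { disjoint  = disjoint
    ; avoidX₀   = λ i x x∈i x∈X₀ → ∈⟪⟫⁻ outside? x∈X₀ (i , x∈i)
    ; covering  = covering
    ; equitable = equitable
    }
    where
    covering : ∀ x → x ∉ X₀ → ∃[ i ] x ∈ lookup Xs i
    covering x x∉X₀ with Fin.any? (λ i → x ∈? lookup Xs i)
    ... | yes found = found
    ... | no  none  = ⊥-elim (x∉X₀ (∈⟪⟫⁺ outside? none))
  -- X₀ and the r parts are counted together as r + 1 disjoint sets.
  all : Fin (suc r) → Subset n
  all zero    = X₀
  all (suc i) = lookup Xs i
  all-disjoint : ∀ i j → i ≢ j → ∀ x → x ∈ all i → x ∉ all j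
  all-disjoint zero    zero    i≢j x x∈i x∈j = i≢j refl
  all-disjoint zero    (suc j) i≢j x x∈i x∈j = ∈⟪⟫⁻ outside? x∈i (j , x∈j)
  all-disjoint (suc i) zero    i≢j x x∈i x∈j = ∈⟪⟫⁻ outside? x∈j (i , x∈i)
  all-disjoint (suc i) (suc j) i≢j x x∈i x∈j = disjoint i j (i≢j ∘ cong suc) x x∈i x∈j
  X₀-small : ∣ X₀ ∣ ≤ (r ∸ 1) * t
  X₀-small = ℕ.+-cancelʳ-≤ (sum (λ i → ∣ lookup Xs i ∣)) _ _ (begin
    ∣ X₀ ∣ + sum (λ i → ∣ lookup Xs i ∣)        ≤⟨ sum-≤-∣∣ ⊤ all (λ i _ → Sub.∈⊤) all-disjoint ⟩
    ∣ ⊤ {n} ∣                                   ≤⟨ large ⟩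
    sum (λ i → ∣ lookup Xs i ∣) + (r ∸ 1) * t   ≡⟨ ℕ.+-comm (sum (λ i → ∣ lookup Xs i ∣)) _ ⟩
    (r ∸ 1) * t + sum (λ i → ∣ lookup Xs i ∣)   ∎)
    where open ℕ.≤-Reasoning
  free′ : ∀ F → 𝓕 F ≡ true → ∀ i → ¬ (F ⊆[ h ] lookup Xs i)
  free′ F F∈𝓕 i (E , E≤h , F─E⊆X) = free i (F , F∈𝓕 , ℕ.≤-trans (Sub.p⊆q⇒∣p∣≤∣q∣ into) E≤h)
    where
    into : F ─ lookup Xs i ⊆ E
    into {x} x∈ with x∈F , x∉X ← x∈p─q⁻ F (lookup Xs i) x∈ with x ∈? E
    ... | yes x∈E = x∈E
    ... | no  x∉E = ⊥-elim (x∉X (F─E⊆X (Sub.x∈p∧x∉q⇒x∈p─q x∈F x∉E)))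

theorem4 : (n r s l : ℕ) → 1 ≤ n → 2 ≤ r →
    (P : Fin l → Subset n) → IsPartition P → (∀ i → ∣ P i ∣ ≤ r) →
    (𝓕 : Family n) → (∀ F → 𝓕 F ≡ true → Nonempty F) →
    (∀ F → 𝓕 F ≡ true → s < ∣ F ∣) →
    (χ m : ℕ) → IsChromaticNumber 𝓕 P s r χ → IsEcd r 𝓕 ⌊ s /2⌋ m →
    ⌈ m / (r ∸ 1) ⌉ ≤ χ
theorem4 n (suc zero) s l _ (s≤s ())
theorem4 n r@(suc (suc _)) s l _ 2≤r P isPartition P-small 𝓕 _ 𝓕-large χ m ((col , proper) , _) (_ , minimal) =
  conclude (theorem-all r 2≤r 𝓕 π ⊤ s χ (colourℕ col) blocks-small 𝓕-large (colourℕ<k col))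
  where
  open Translation {s = s} P isPartition 𝓕
  blocks-small : ∀ j → ∣ ⊤ ∩ fibre π j ∣ ≤ r
  blocks-small j = ℕ.≤-trans (Sub.∣p∩q∣≤∣q∣ ⊤ (fibre π j)) (subst (λ A → ∣ A ∣ ≤ r) (P≡fibre j) (P-small j))
  conclude : Mono 𝓕 π s (colourℕ col) r ⊤ ⊎ Good 𝓕 ⌊ s /2⌋ χ r ⊤ → ⌈ m / (r ∸ 1) ⌉ ≤ χ
  conclude (inj₁ mono) = ⊥-elim (¬mono col proper 𝓕-large mono)
  conclude (inj₂ g) with X₀ , X₀-small , admissible ← good⇒admissible 𝓕 g =
      ⌈/⌉≤ (ℕ.≤-trans (minimal X₀ admissible) X₀-small)
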